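{- Let $n\ge3$, let $\mathbb T$ be a triangulation of an $n$-gon with quiddity $(c_u)_{u\in\mathbb Z}$, and let $\{\zeta_{k,\ell}\}$ be its $q$-deformed Conway--Coxeter frieze. For all $k,\ell\in\mathbb Z$ with $k+1\le\ell\le k+n-1$, the trailing degree $\deg_{\min}$ and the degree $\deg$ of the polynomial $\zeta_{k,\ell}$ are $$\deg_{\min}\zeta_{k,\ell}=\nu^{\mathrm{tri}}_{k,\ell-1},\qquad \deg\zeta_{k,\ell}=\sum_{u=k+1}^{\ell-1}(c_u-1)-\nu^{\mathrm{tri}}_{k+1,\ell}=\nu^{\mathrm{tri}}_{k,\ell-1}+\nu^{\mathrm{rec}}_{k+1,\ell-1,k+n-1},$$ where for $\ell=k+1$ the sum is regarded as $0$.
   Context: Triangulations. Let $n\ge3$ and let $\mathcal P$ be a convex $n$-gon with vertices numbered clockwise $v_0,\dots,v_{n-1}$; indices are extended to $\mathbb Z$ by $v_{u+n}=v_u$. A triangulation $\mathbb T$ of $\mathcal P$ is by $n-3$ non-crossing diagonals; its triangles are called cells. Let $c_u$ be the number of cells having $v_u$ as a vertex; the $n$-periodic sequence $(c_u)_{u\in\mathbb Z}$ is the quiddity of $\mathbb T$. For an integer $a\ge0$ put $[a]_q=1+q+\cdots+q^{a-1}$ (with $[0]_q=0$). $q$-deformed Conway--Coxeter frieze of $\mathbb T$: the array of polynomials $\zeta_{k,\ell}\in\mathbb Z[q]$, for $0\le\ell-k\le n+1$, determined by $\zeta_{k,k}=0$, $\zeta_{k,k+1}=1$, $\zeta_{k,k+2}=[c_{k+1}]_q$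 and, recursively for $\ell-k\ge3$, by $$\zeta_{k,\ell-1}\zeta_{k+1,\ell}-\zeta_{k+1,\ell-1}\zeta_{k,\ell}=q^{\sum_{u=k+1}^{\ell-2}(c_u-1)}$$ (in this range the divisors $\zeta_{k+1,\ell-1}$ are nonzero and the array is well defined). Conway--Coxeter frieze of $\mathbb T$: the array of integers $\sigma_{k,\ell}$, $0\le\ell-k\le n+1$, determined by $\sigma_{k,k}=0$, $\sigma_{k,k+1}=1$, $\sigma_{k,k+2}=c_{k+1}$ and, for $\ell-k\ge3$, $\sigma_{k,\ell-1}\sigma_{k+1,\ell}-\sigma_{k+1,\ell-1}\sigma_{k,\ell}=1$ (well defined in this range; $\sigma_{k,\ell}$ is the value of $\zeta_{k,\ell}$ at $q=1$). Numbers of occurrences of $1$: $\nu^{\mathrm{tri}}_{k,\ell}=\#\{(a,b): k\le a,\ a+2\le b\le\ell,\ \sigma_{a,b}=1\}$ and $\nu^{\mathrm{rec}}_{k,u,\ell}=\#\{(a,b): k\le a\le u,\ u+2\le b\le\ell,\ \sigma_{a,b}=1\}$ (in particular they are $0$ when the index set is empty). For a nonzero polynomial $f$, $\deg_{\min}f$ is the smallest and $\deg f$ the largest exponent of $q$ occurring in $f$ with nonzero coefficient. -}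

module Defs where

open import Data.Fin.Base using (Fin; toℕ; fromℕ<) renaming (_<_ to _<ᶠ_)
import Data.Fin.Properties as Fin
open import Data.Integer.Base as ℤ using (ℤ; +_; 0ℤ; 1ℤ; ∣_∣)
import Data.Integer.Properties as ℤ
open import Data.Integer.DivMod using (_%ℕ_; n%ℕd<d)
open import Data.List.Base
  using (List; []; _∷_; _++_; map; foldr; length; filter; replicate; upTo; allFin; cartesianProduct)
open import Data.List.Relation.Unary.All using (All)
open import Data.List.Relation.Unary.AllPairs using (AllPairs)
open import Data.List.Relation.Unary.Unique.Propositional using (Unique)
open import Data.List.Membership.Propositional using (_∈_)
import Data.List.Membership.DecPropositional as DecMembership
open import Data.Nat.Base as ℕ using (ℕ; zero; suc; NonZero)
import Data.Nat.Properties as ℕ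
open import Data.Product.Base using (_×_; _,_)
open import Data.Product.Properties using (≡-dec)
open import Data.Sum.Base using (_⊎_)
open import Relation.Binary.PropositionalEquality using (_≡_; _≢_)
open import Relation.Nullary using (Dec; ¬_)
open import Relation.Nullary.Decidable using (_×-dec_; _⊎-dec_)

------------------------------------------------------------------------
-- Polynomials in ℤ[q]

-- Coefficient lists, constant term first.  Trailing zeros are allowed, so
-- equality of polynomials is _≈_ and not _≡_.
Poly : Set
Poly = List ℤ

coeff : Poly → ℕ → ℤ
coeff []      _       = 0ℤ
coeff (a ∷ p) zero    = a
coeff (a ∷ p) (suc i) = coeff p i

infix 4 _≈_
_≈_ : Poly → Poly → Set
f ≈ g = ∀ i → coeff f i ≡ coeff g i

infixl 6 _⊕_ _⊖_
infixl 7 _⊗_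

_⊕_ : Poly → Poly → Poly
[]      ⊕ g       = g
(a ∷ f) ⊕ []      = a ∷ f
(a ∷ f) ⊕ (b ∷ g) = (a ℤ.+ b) ∷ (f ⊕ g)

_⊖_ : Poly → Poly → Poly
f ⊖ g = f ⊕ map ℤ.-_ g

_⊗_ : Poly → Poly → Poly
[]      ⊗ g = []
(a ∷ f) ⊗ g = map (a ℤ.*_) g ⊕ (0ℤ ∷ (f ⊗ g))

0ₚ 1ₚ : Poly
0ₚ = []
1ₚ = 1ℤ ∷ []

q^_ : ℕ → Poly
q^ e = replicate e 0ℤ ++ 1ₚ

-- [ a ]q = 1 + q + ⋯ + q^(a-1)
[_]q : ℕ → Poly
[ a ]q = replicate a 1ℤ

-- The degrees are relations, since they are defined for nonzero
-- polynomials only; either relation forces f to be nonzero.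
HasTrailingDegree : Poly → ℕ → Set
HasTrailingDegree f d = coeff f d ≢ 0ℤ × (∀ i → i ℕ.< d → coeff f i ≡ 0ℤ)

HasDegree : Poly → ℕ → Set
HasDegree f d = coeff f d ≢ 0ℤ × (∀ i → d ℕ.< i → coeff f i ≡ 0ℤ)

------------------------------------------------------------------------
-- Triangulations of the convex n-gon with vertices 0, …, n-1 in cyclic order

-- A segment joining two vertices is the pair (i , j) of its ends with i < j.
Segment : ℕ → Set
Segment n = Fin n × Fin n

IsSide : ∀ {n} → Segment n → Set
IsSide {n} (i , j) = (toℕ j ≡ suc (toℕ i)) ⊎ (toℕ i ≡ 0 × suc (toℕ j) ≡ n)

isSide? : ∀ {n} (s : Segment n) → Dec (IsSide s)
isSide? {n} (i , j) =
  (toℕ j ℕ.≟ suc (toℕ i)) ⊎-dec ((toℕ i ℕ.≟ 0) ×-dec (suc (toℕ j) ℕ.≟ n))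

IsDiagonal : ∀ {n} → Segment n → Set
IsDiagonal (i , j) = i <ᶠ j × ¬ IsSide (i , j)

-- The segments meet in a point interior to both.
Crossing : ∀ {n} → Segment n → Segment n → Set
Crossing (i , j) (k , l) =
  (i <ᶠ k × k <ᶠ j × j <ᶠ l) ⊎ (k <ᶠ i × i <ᶠ l × l <ᶠ j)

record Triangulation (n : ℕ) : Set where
  field
    diagonals   : List (Segment n)
    isDiagonal  : All IsDiagonal diagonals
    distinct    : Unique diagonals
    nonCrossing : AllPairs (λ d e → ¬ Crossing d e) diagonals
    number      : length diagonals ≡ n ℕ.∸ 3

module _ {n : ℕ} (T : Triangulation n) where
  open Triangulation T

  IsEdge : Segment n → Set
  IsEdge s = IsSide s ⊎ s ∈ diagonals

  -- A triangle all of whose edges are sides of the polygon or chosen diagonals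
  -- is not cut by any further chosen diagonal (this would cross one of its
  -- edges), so these triples are exactly the triangles of the triangulation.
  IsCell : Fin n × Fin n × Fin n → Set
  IsCell (i , j , k) =
    (i <ᶠ j × j <ᶠ k) × IsEdge (i , j) × IsEdge (j , k) × IsEdge (i , k)

  isEdge? : (s : Segment n) → Dec (IsEdge s)
  isEdge? s = isSide? s ⊎-dec (s ∈? diagonals)
    where open DecMembership (≡-dec Fin._≟_ Fin._≟_) using (_∈?_)

  isCell? : (t : Fin n × Fin n × Fin n) → Dec (IsCell t)
  isCell? (i , j , k) =
    ((i Fin.<? j) ×-dec (j Fin.<? k)) ×-dec
    (isEdge? (i , j) ×-dec (isEdge? (j , k) ×-dec isEdge? (i , k)))

  cells : List (Fin n × Fin n × Fin n)
  cells = filter isCell?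
    (cartesianProduct (allFin n) (cartesianProduct (allFin n) (allFin n)))

HasVertex : ∀ {n} → Fin n → Fin n × Fin n × Fin n → Set
HasVertex v (i , j , k) = v ≡ i ⊎ v ≡ j ⊎ v ≡ k

hasVertex? : ∀ {n} (v : Fin n) (t : Fin n × Fin n × Fin n) → Dec (HasVertex v t)
hasVertex? v (i , j , k) = (v Fin.≟ i) ⊎-dec ((v Fin.≟ j) ⊎-dec (v Fin.≟ k))

vertex : ∀ n .{{_ : NonZero n}} → ℤ → Fin n
vertex n u = fromℕ< (n%ℕd<d u n)

quiddity : ∀ {n} .{{_ : NonZero n}} → Triangulation n → ℤ → ℕ
quiddity {n} T u = length (filter (hasVertex? (vertex n u)) (cells T))

------------------------------------------------------------------------
-- Friezes

-- The integers k, k+1, …, ℓ in this order; empty if ℓ < k.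
interval : ℤ → ℤ → List ℤ
interval k ℓ = map (λ i → k ℤ.+ + i) (upTo ∣ (ℓ ℤ.+ 1ℤ ℤ.- k) ℤ.⊔ 0ℤ ∣)

sumℤ : List ℤ → ℤ
sumℤ = foldr ℤ._+_ 0ℤ

-- The sum of c u - 1 over k ≤ u ≤ ℓ.
Σ[c-1] : (ℤ → ℕ) → ℤ → ℤ → ℤ
Σ[c-1] c k ℓ = sumℤ (map (λ u → + c u ℤ.- 1ℤ) (interval k ℓ))

-- Arrays are total functions of (k , ℓ), constrained only for
-- 0 ≤ ℓ - k ≤ n + 1.  Their values outside this range are irrelevant.

-- The exponent of q is nonnegative for a quiddity c, because every vertex of
-- the polygon lies on some cell; ∣_∣ only converts it to ℕ.
record IsQFrieze (n : ℕ) (c : ℤ → ℕ) (ζ : ℤ → ℤ → Poly) : Set where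
  field
    diag₀ : ∀ k → ζ k k ≈ 0ₚ
    diag₁ : ∀ k → ζ k (k ℤ.+ + 1) ≈ 1ₚ
    diag₂ : ∀ k → ζ k (k ℤ.+ + 2) ≈ [ c (k ℤ.+ + 1) ]q
    rule  : ∀ k ℓ → k ℤ.+ + 3 ℤ.≤ ℓ → ℓ ℤ.≤ k ℤ.+ + (n ℕ.+ 1) →
            ζ k (ℓ ℤ.- + 1) ⊗ ζ (k ℤ.+ + 1) ℓ
              ⊖ ζ (k ℤ.+ + 1) (ℓ ℤ.- + 1) ⊗ ζ k ℓ
            ≈ q^ ∣ Σ[c-1] c (k ℤ.+ + 1) (ℓ ℤ.- + 2) ∣

record IsFrieze (n : ℕ) (c : ℤ → ℕ) (σ : ℤ → ℤ → ℤ) : Set where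
  field
    diag₀ : ∀ k → σ k k ≡ 0ℤ
    diag₁ : ∀ k → σ k (k ℤ.+ + 1) ≡ 1ℤ
    diag₂ : ∀ k → σ k (k ℤ.+ + 2) ≡ + c (k ℤ.+ + 1)
    rule  : ∀ k ℓ → k ℤ.+ + 3 ℤ.≤ ℓ → ℓ ℤ.≤ k ℤ.+ + (n ℕ.+ 1) →
            σ k (ℓ ℤ.- + 1) ℤ.* σ (k ℤ.+ + 1) ℓ
              ℤ.- σ (k ℤ.+ + 1) (ℓ ℤ.- + 1) ℤ.* σ k ℓ
            ≡ 1ℤ

module _ (σ : ℤ → ℤ → ℤ) where

  -- #{(a , b) : k ≤ a, a + 2 ≤ b ≤ ℓ, σ a b = 1}; these conditions put both
  -- a and b in the interval from k to ℓ.
  νtri : ℤ → ℤ → ℕ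
  νtri k ℓ = length (filter
    (λ (a , b) → (a ℤ.+ + 2 ℤ.≤? b) ×-dec (σ a b ℤ.≟ 1ℤ))
    (cartesianProduct (interval k ℓ) (interval k ℓ)))

  -- #{(a , b) : k ≤ a ≤ u, u + 2 ≤ b ≤ ℓ, σ a b = 1}
  νrec : ℤ → ℤ → ℤ → ℕ
  νrec k u ℓ = length (filter
    (λ (a , b) → σ a b ℤ.≟ 1ℤ)
    (cartesianProduct (interval k u) (interval (u ℤ.+ + 2) ℓ)))

{-# OPTIONS --safe #-}
-- Fix k and read the triangulation T from v_k, with N = n - 1. Put g(0) = 0 and
-- g(N) = 1, and in each cell with vertices i < m < j let
-- g(m) = g(j) + q^D g(i), where D is the number of edges from i to vertices
-- beyond m. As v_u lies on c_u + 1 edges, adding up these q-deformed Farey sums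
-- around each vertex shows that q^t g, with t(m) the number of chords inside
-- 0, …, m-1, satisfies the linear recursion of the continuants
-- ζ(ℓ+1) = [c_ℓ] ζ(ℓ) - q^(c_{ℓ-1}-1) ζ(ℓ-1), which in turn solve the frieze
-- rule; hence ζ_{k,k+m} = q^t(m) g(m). The Farey sums keep the constant
-- coefficient of g at 1, and q^D g(i), unless i = 0, has the larger degree,
-- so g is monic of degree the number of edges passing over m that avoid 0. At
-- q = 1 they give σ_{k,k+m} = 1 if m is joined to 0 and σ_{k,k+m} ≥ 2 otherwise,
-- which identifies the numbers ν with numbers of chords.
module Submission where

-- The obstacle is that a triangulation is a bare list of n - 3 non-crossing diagonals, whereas the
-- Farey sums need a recursion over cells. Counting supplies it: non-crossing chords inside i, ...,
-- j number at most j - i - 1, and as the diagonals together with the side 0 N attain this bound,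
-- every edge that is not a side of the polygon, and 0 N itself, has a cell on the side away from 0
-- N. `Cut` is the resulting binary tree; its indices carry the numbers of chords at the two ends of
-- each edge, so the exponents D and the quiddity are read off the same tree. These properties
-- survive a rotation by one vertex, so every v_k can serve as base point. The frieze rule
-- determines an entry only after division by another one. The arrays are therefore identified by an
-- induction over ℓ - k for all k together, in which the divisor is already known: it is q^t g with
-- g of constant coefficient 1, or a positive integer when q = 1, and so cancels.

-- The ring of polynomials in q: cancellation and monic polynomials.

module Polynomials where

  open import Defs
  open import Algebra.Bundles using (CommutativeRing)
  open import Data.Integer.Base using (ℤ; 0ℤ; 1ℤ; _+_; _*_; -_)
  open import Data.Integer.Properties
  open import Data.List.Base using ([]; _∷_; map)
  open import Data.Nat.Base as ℕ using (ℕ; zero; suc; s≤s)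
  open import Data.Product.Base using (_×_; _,_)
  open import Level using (0ℓ)
  open import Relation.Binary.Bundles using (Setoid)
  open import Relation.Binary.PropositionalEquality
    using (_≡_; _≢_; refl; sym; trans; cong; cong₂)
  import Relation.Binary.Reasoning.Setoid as SetoidReasoning
  open import Algebra.Properties.CommutativeSemigroup +-commutativeSemigroup
    using (interchange)

  -- _≈_ unfolds to a function type, from which Agda cannot recover the two
  -- polynomials; the record wrapper makes them inferable.
  infix 4 _≋_
  record _≋_ (f g : Poly) : Set where
    constructor coeffs
    field at : f ≈ g
  open _≋_ public

  scale : ℤ → Poly → Poly
  scale a = map (a *_)

  coeff-⊕ : ∀ f g i → coeff (f ⊕ g) i ≡ coeff f i + coeff g i
  coeff-⊕ []      g       i       = sym (+-identityˡ _)
  coeff-⊕ (a ∷ f) []      i       = sym (+-identityʳ _)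
  coeff-⊕ (a ∷ f) (b ∷ g) zero    = refl
  coeff-⊕ (a ∷ f) (b ∷ g) (suc i) = coeff-⊕ f g i

  coeff-scale : ∀ a f i → coeff (scale a f) i ≡ a * coeff f i
  coeff-scale a []      i       = sym (*-zeroʳ a)
  coeff-scale a (b ∷ f) zero    = refl
  coeff-scale a (b ∷ f) (suc i) = coeff-scale a f i

  coeff-neg : ∀ f i → coeff (map -_ f) i ≡ - coeff f i
  coeff-neg []      i       = refl
  coeff-neg (b ∷ f) zero    = refl
  coeff-neg (b ∷ f) (suc i) = coeff-neg f i

  polySetoid : Setoid 0ℓ 0ℓ
  polySetoid = record
    { Carrier = Poly ; _≈_ = _≋_
    ; isEquivalence = record
      { refl = coeffs λ _ → refl
      ; sym = λ p → coeffs λ i → sym (at p i)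
      ; trans = λ p q → coeffs λ i → trans (at p i) (at q i) } }

  open Setoid polySetoid public
    using () renaming (refl to ≋-refl; sym to ≋-sym; trans to ≋-trans)
  open SetoidReasoning polySetoid

  ∷-cong : ∀ {a b f g} → a ≡ b → f ≋ g → a ∷ f ≋ b ∷ g
  ∷-cong p q = coeffs λ { zero → p ; (suc i) → at q i }

  0∷[]≋[] : 0ℤ ∷ [] ≋ []
  0∷[]≋[] = coeffs λ { zero → refl ; (suc i) → refl }

  ⊕-cong : ∀ {f f′ g g′} → f ≋ f′ → g ≋ g′ → f ⊕ g ≋ f′ ⊕ g′
  ⊕-cong {f} {f′} {g} {g′} p q = coeffs λ i →
    trans (coeff-⊕ f g i) (trans (cong₂ _+_ (at p i) (at q i)) (sym (coeff-⊕ f′ g′ i)))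

  ⊕-comm : ∀ f g → f ⊕ g ≋ g ⊕ f
  ⊕-comm f g = coeffs λ i →
    trans (coeff-⊕ f g i) (trans (+-comm (coeff f i) _) (sym (coeff-⊕ g f i)))

  ⊕-assoc : ∀ f g h → (f ⊕ g) ⊕ h ≋ f ⊕ (g ⊕ h)
  ⊕-assoc f g h = coeffs eq
    where
    eq : (f ⊕ g) ⊕ h ≈ f ⊕ (g ⊕ h)
    eq i rewrite coeff-⊕ (f ⊕ g) h i | coeff-⊕ f g i | coeff-⊕ f (g ⊕ h) i | coeff-⊕ g h i
      = +-assoc (coeff f i) _ _

  ⊕-identityʳ : ∀ f → f ⊕ 0ₚ ≋ f
  ⊕-identityʳ f = coeffs λ i → trans (coeff-⊕ f [] i) (+-identityʳ _)

  ⊕-interchange : ∀ f g h k → (f ⊕ g) ⊕ (h ⊕ k) ≋ (f ⊕ h) ⊕ (g ⊕ k)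
  ⊕-interchange f g h k = coeffs eq
    where
    eq : (f ⊕ g) ⊕ (h ⊕ k) ≈ (f ⊕ h) ⊕ (g ⊕ k)
    eq i rewrite coeff-⊕ (f ⊕ g) (h ⊕ k) i | coeff-⊕ f g i | coeff-⊕ h k i
               | coeff-⊕ (f ⊕ h) (g ⊕ k) i | coeff-⊕ f h i | coeff-⊕ g k i
      = interchange (coeff f i) _ _ _

  neg-cong : ∀ {f g} → f ≋ g → map -_ f ≋ map -_ g
  neg-cong {f} {g} p = coeffs λ i →
    trans (coeff-neg f i) (trans (cong -_ (at p i)) (sym (coeff-neg g i)))

  ⊖-inverseʳ : ∀ f → f ⊖ f ≋ 0ₚ
  ⊖-inverseʳ f = coeffs λ i →
    trans (coeff-⊕ f (map -_ f) i)
          (trans (cong (coeff f i +_) (coeff-neg f i)) (+-inverseʳ (coeff f i)))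

  scale-cong : ∀ a {f g} → f ≋ g → scale a f ≋ scale a g
  scale-cong a {f} {g} p = coeffs λ i →
    trans (coeff-scale a f i) (trans (cong (a *_) (at p i)) (sym (coeff-scale a g i)))

  scale-zero : ∀ f → scale 0ℤ f ≋ 0ₚ
  scale-zero f = coeffs (coeff-scale 0ℤ f)

  scale-⊕ : ∀ a f g → scale a (f ⊕ g) ≋ scale a f ⊕ scale a g
  scale-⊕ a f g = coeffs eq
    where
    eq : scale a (f ⊕ g) ≈ scale a f ⊕ scale a g
    eq i rewrite coeff-scale a (f ⊕ g) i | coeff-⊕ f g i | coeff-⊕ (scale a f) (scale a g) i
               | coeff-scale a f i | coeff-scale a g i
      = *-distribˡ-+ a _ _

  scale-+ : ∀ a b f → scale (a + b) f ≋ scale a f ⊕ scale b f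
  scale-+ a b f = coeffs eq
    where
    eq : scale (a + b) f ≈ scale a f ⊕ scale b f
    eq i rewrite coeff-scale (a + b) f i | coeff-⊕ (scale a f) (scale b f) i
               | coeff-scale a f i | coeff-scale b f i
      = *-distribʳ-+ (coeff f i) a b

  scale-scale : ∀ a b f → scale (a * b) f ≋ scale a (scale b f)
  scale-scale a b f = coeffs eq
    where
    eq : scale (a * b) f ≈ scale a (scale b f)
    eq i rewrite coeff-scale (a * b) f i | coeff-scale a (scale b f) i | coeff-scale b f i
      = *-assoc a b _

  0∷-⊕ : ∀ f g → 0ℤ ∷ (f ⊕ g) ≋ (0ℤ ∷ f) ⊕ (0ℤ ∷ g)
  0∷-⊕ f g = ∷-cong refl ≋-refl

  0∷-⊗ : ∀ f g → (0ℤ ∷ f) ⊗ g ≋ 0ℤ ∷ (f ⊗ g)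
  0∷-⊗ f g = ⊕-cong (scale-zero g) ≋-refl

  ⊗-zeroʳ : ∀ f → f ⊗ 0ₚ ≋ 0ₚ
  ⊗-zeroʳ []      = ≋-refl
  ⊗-zeroʳ (a ∷ f) = ≋-trans (∷-cong refl (⊗-zeroʳ f)) 0∷[]≋[]

  -- Mirror image of the defining clause of `_⊗_`, which takes only the first factor apart;
  -- commutativity follows from it by induction.
  ⊗-∷ : ∀ f b g → f ⊗ (b ∷ g) ≋ scale b f ⊕ (0ℤ ∷ (f ⊗ g))
  ⊗-∷ []      b g = ≋-sym 0∷[]≋[]
  ⊗-∷ (a ∷ f) b g = ∷-cong (cong (_+ 0ℤ) (*-comm a b)) (begin
    scale a g ⊕ f ⊗ (b ∷ g)                       ≈⟨ ⊕-cong ≋-refl (⊗-∷ f b g) ⟩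
    scale a g ⊕ (scale b f ⊕ (0ℤ ∷ (f ⊗ g)))      ≈⟨ ⊕-assoc (scale a g) (scale b f) _ ⟨
    (scale a g ⊕ scale b f) ⊕ (0ℤ ∷ (f ⊗ g))
      ≈⟨ ⊕-cong (⊕-comm (scale a g) (scale b f)) ≋-refl ⟩
    (scale b f ⊕ scale a g) ⊕ (0ℤ ∷ (f ⊗ g))      ≈⟨ ⊕-assoc (scale b f) (scale a g) _ ⟩
    scale b f ⊕ (scale a g ⊕ (0ℤ ∷ (f ⊗ g)))      ∎)

  ⊗-comm : ∀ f g → f ⊗ g ≋ g ⊗ f
  ⊗-comm []      g = ≋-sym (⊗-zeroʳ g)
  ⊗-comm (a ∷ f) g =
    ≋-trans (⊕-cong ≋-refl (∷-cong refl (⊗-comm f g))) (≋-sym (⊗-∷ g a f))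

  ⊗-congʳ : ∀ f {g g′} → g ≋ g′ → f ⊗ g ≋ f ⊗ g′
  ⊗-congʳ []      p = ≋-refl
  ⊗-congʳ (a ∷ f) p = ⊕-cong (scale-cong a p) (∷-cong refl (⊗-congʳ f p))

  ⊗-cong : ∀ {f f′ g g′} → f ≋ f′ → g ≋ g′ → f ⊗ g ≋ f′ ⊗ g′
  ⊗-cong {f} {f′} {g} {g′} p q = begin
    f ⊗ g    ≈⟨ ⊗-congʳ f q ⟩
    f ⊗ g′   ≈⟨ ⊗-comm f g′ ⟩
    g′ ⊗ f   ≈⟨ ⊗-congʳ g′ p ⟩
    g′ ⊗ f′  ≈⟨ ⊗-comm g′ f′ ⟩
    f′ ⊗ g′  ∎

  ⊗-distribʳ : ∀ h f g → (f ⊕ g) ⊗ h ≋ (f ⊗ h) ⊕ (g ⊗ h)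
  ⊗-distribʳ h []      g       = ≋-refl
  ⊗-distribʳ h (a ∷ f) []      = ≋-sym (⊕-identityʳ ((a ∷ f) ⊗ h))
  ⊗-distribʳ h (a ∷ f) (b ∷ g) = begin
    scale (a + b) h ⊕ (0ℤ ∷ ((f ⊕ g) ⊗ h))
      ≈⟨ ⊕-cong (scale-+ a b h)
           (≋-trans (∷-cong refl (⊗-distribʳ h f g)) (0∷-⊕ (f ⊗ h) (g ⊗ h))) ⟩
    (scale a h ⊕ scale b h) ⊕ ((0ℤ ∷ (f ⊗ h)) ⊕ (0ℤ ∷ (g ⊗ h)))
      ≈⟨ ⊕-interchange (scale a h) (scale b h) (0ℤ ∷ (f ⊗ h)) (0ℤ ∷ (g ⊗ h)) ⟩
    (scale a h ⊕ (0ℤ ∷ (f ⊗ h))) ⊕ (scale b h ⊕ (0ℤ ∷ (g ⊗ h)))  ∎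

  ⊗-distribˡ : ∀ h f g → h ⊗ (f ⊕ g) ≋ (h ⊗ f) ⊕ (h ⊗ g)
  ⊗-distribˡ h f g = begin
    h ⊗ (f ⊕ g)          ≈⟨ ⊗-comm h (f ⊕ g) ⟩
    (f ⊕ g) ⊗ h          ≈⟨ ⊗-distribʳ h f g ⟩
    (f ⊗ h) ⊕ (g ⊗ h)    ≈⟨ ⊕-cong (⊗-comm f h) (⊗-comm g h) ⟩
    (h ⊗ f) ⊕ (h ⊗ g)    ∎

  scale-⊗ : ∀ a f g → scale a f ⊗ g ≋ scale a (f ⊗ g)
  scale-⊗ a []      g = ≋-refl
  scale-⊗ a (b ∷ f) g = begin
    scale (a * b) g ⊕ (0ℤ ∷ (scale a f ⊗ g))
      ≈⟨ ⊕-cong (scale-scale a b g) (∷-cong (sym (*-zeroʳ a)) (scale-⊗ a f g)) ⟩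
    scale a (scale b g) ⊕ scale a (0ℤ ∷ (f ⊗ g))
      ≈⟨ scale-⊕ a (scale b g) (0ℤ ∷ (f ⊗ g)) ⟨
    scale a (scale b g ⊕ (0ℤ ∷ (f ⊗ g)))  ∎

  ⊗-assoc : ∀ f g h → (f ⊗ g) ⊗ h ≋ f ⊗ (g ⊗ h)
  ⊗-assoc []      g h = ≋-refl
  ⊗-assoc (a ∷ f) g h = begin
    (scale a g ⊕ (0ℤ ∷ (f ⊗ g))) ⊗ h
      ≈⟨ ⊗-distribʳ h (scale a g) (0ℤ ∷ (f ⊗ g)) ⟩
    (scale a g ⊗ h) ⊕ ((0ℤ ∷ (f ⊗ g)) ⊗ h)
      ≈⟨ ⊕-cong (scale-⊗ a g h) (≋-trans (0∷-⊗ (f ⊗ g) h) (∷-cong refl (⊗-assoc f g h))) ⟩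
    scale a (g ⊗ h) ⊕ (0ℤ ∷ (f ⊗ (g ⊗ h)))  ∎

  ⊗-identityˡ : ∀ f → 1ₚ ⊗ f ≋ f
  ⊗-identityˡ f = begin
    scale 1ℤ f ⊕ (0ℤ ∷ [])  ≈⟨ ⊕-cong ≋-refl 0∷[]≋[] ⟩
    scale 1ℤ f ⊕ []         ≈⟨ ⊕-identityʳ (scale 1ℤ f) ⟩
    scale 1ℤ f              ≈⟨ coeffs (λ i → trans (coeff-scale 1ℤ f i) (*-identityˡ _)) ⟩
    f                       ∎

  polyRing : CommutativeRing 0ℓ 0ℓ
  polyRing = record
    { Carrier = Poly ; _≈_ = _≋_ ; _+_ = _⊕_ ; _*_ = _⊗_ ; -_ = map -_ ; 0# = 0ₚ ; 1# = 1ₚ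
    ; isCommutativeRing = record
      { isRing = record
        { +-isAbelianGroup = record
          { isGroup = record
            { isMonoid = record
              { isSemigroup = record
                { isMagma = record
                  { isEquivalence = Setoid.isEquivalence polySetoid ; ∙-cong = ⊕-cong }
                ; assoc = ⊕-assoc }
              ; identity = (λ _ → ≋-refl) , ⊕-identityʳ }
            ; inverse = (λ f → ≋-trans (⊕-comm (map -_ f) f) (⊖-inverseʳ f)) , ⊖-inverseʳ
            ; ⁻¹-cong = neg-cong }
          ; comm = ⊕-comm }
        ; *-cong = ⊗-cong
        ; *-assoc = ⊗-assoc
        ; *-identity = ⊗-identityˡ , λ f → ≋-trans (⊗-comm f 1ₚ) (⊗-identityˡ f)
        ; distrib = ⊗-distribˡ , ⊗-distribʳ }
      ; *-comm = ⊗-comm } }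

  q^-+ : ∀ a b → q^ (a ℕ.+ b) ≋ (q^ a) ⊗ (q^ b)
  q^-+ zero    b = ≋-sym (⊗-identityˡ (q^ b))
  q^-+ (suc a) b = ≋-trans (∷-cong refl (q^-+ a b)) (≋-sym (0∷-⊗ (q^ a) (q^ b)))

  []q-+ : ∀ a b → [ a ℕ.+ b ]q ≋ [ a ]q ⊕ (q^ a) ⊗ [ b ]q
  []q-+ zero    b = ≋-sym (⊗-identityˡ [ b ]q)
  []q-+ (suc a) b = begin
    1ℤ ∷ [ a ℕ.+ b ]q                        ≈⟨ ∷-cong refl ([]q-+ a b) ⟩
    (1ℤ ∷ [ a ]q) ⊕ (0ℤ ∷ (q^ a) ⊗ [ b ]q)
      ≈⟨ ⊕-cong {1ℤ ∷ [ a ]q} ≋-refl (≋-sym (0∷-⊗ (q^ a) [ b ]q)) ⟩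
    (1ℤ ∷ [ a ]q) ⊕ (q^ suc a) ⊗ [ b ]q      ∎

  coeff-q^⊗ : ∀ e f i → coeff ((q^ e) ⊗ f) (e ℕ.+ i) ≡ coeff f i
  coeff-q^⊗ zero    f i = at (⊗-identityˡ f) i
  coeff-q^⊗ (suc e) f i = trans (at (0∷-⊗ (q^ e) f) (suc (e ℕ.+ i))) (coeff-q^⊗ e f i)

  coeff-q^⊗-< : ∀ e f i → i ℕ.< e → coeff ((q^ e) ⊗ f) i ≡ 0ℤ
  coeff-q^⊗-< (suc e) f zero    _       = at (0∷-⊗ (q^ e) f) zero
  coeff-q^⊗-< (suc e) f (suc i) (s≤s p) = trans (at (0∷-⊗ (q^ e) f) (suc i)) (coeff-q^⊗-< e f i p)

  1≢0 : 1ℤ ≢ 0ℤ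
  1≢0 ()

  -- Stronger than `HasDegree`: a leading coefficient fixed at 1 passes unchanged through the shifts
  -- and sums of which the frieze entries are made.
  Monic : Poly → ℕ → Set
  Monic f d = coeff f d ≡ 1ℤ × (∀ i → d ℕ.< i → coeff f i ≡ 0ℤ)

  Monic-resp : ∀ {f g d} → f ≋ g → Monic f d → Monic g d
  Monic-resp p (l , z) = trans (sym (at p _)) l , λ i d<i → trans (sym (at p i)) (z i d<i)

  Monic-q^⊗ : ∀ e f {d} → Monic f d → Monic ((q^ e) ⊗ f) (e ℕ.+ d)
  Monic-q^⊗ zero    f m = Monic-resp (≋-sym (⊗-identityˡ f)) m
  Monic-q^⊗ (suc e) f m with Monic-q^⊗ e f m
  ... | l , z = Monic-resp (≋-sym (0∷-⊗ (q^ e) f)) (l , λ { (suc i) (s≤s p) → z i p })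

  Monic-⊕ : ∀ f g {c d} → c ℕ.< d → Monic f c → Monic g d → Monic (f ⊕ g) d
  Monic-⊕ f g c<d (_ , fz) (gl , gz) =
      trans (coeff-⊕ f g _) (cong₂ _+_ (fz _ c<d) gl)
    , λ i d<i → trans (coeff-⊕ f g i) (cong₂ _+_ (fz i (ℕ.<-trans c<d d<i)) (gz i d<i))
    where import Data.Nat.Properties as ℕ

  Monic⇒HasDegree : ∀ f {d} → Monic f d → HasDegree f d
  Monic⇒HasDegree f (leading , vanish) = (λ p → 1≢0 (trans (sym leading) p)) , vanish

  -- A constant coefficient 1 lets the coefficients of the other factor be
  -- read off one at a time.
  ⊗-cancelˡ-zero : ∀ f g → coeff f 0 ≡ 1ℤ → f ⊗ g ≋ 0ₚ → g ≋ 0ₚ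
  ⊗-cancelˡ-zero f []      _    _ = ≋-refl
  ⊗-cancelˡ-zero f (b ∷ g) f₀≡1 p =
    ≋-trans (∷-cong b≡0 (⊗-cancelˡ-zero f g f₀≡1 fg≋0)) 0∷[]≋[]
    where
    expand : ∀ i → b * coeff f i + coeff (0ℤ ∷ (f ⊗ g)) i ≡ 0ℤ
    expand i = trans (sym (trans (at (⊗-∷ f b g) i) (trans (coeff-⊕ (scale b f) _ i)
      (cong (_+ coeff (0ℤ ∷ (f ⊗ g)) i) (coeff-scale b f i))))) (at p i)
    b≡0 : b ≡ 0ℤ
    b≡0 = trans (sym (trans (+-identityʳ _) (trans (cong (b *_) f₀≡1) (*-identityʳ b)))) (expand 0)
    fg≋0 : f ⊗ g ≋ 0ₚ
    fg≋0 = coeffs λ i → trans (sym (+-identityˡ _))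
      (trans (cong (λ a → a * coeff f (suc i) + coeff (f ⊗ g) i) (sym b≡0)) (expand (suc i)))

  ⊗-cancelˡ : ∀ f g h → coeff f 0 ≡ 1ℤ → f ⊗ g ≋ f ⊗ h → g ≋ h
  ⊗-cancelˡ f g h f₀≡1 p = coeffs λ i →
    i-j≡0⇒i≡j (coeff g i) (coeff h i)
      (trans (sym (trans (coeff-⊕ g (map -_ h) i) (cong (coeff g i +_) (coeff-neg h i))))
             (at (⊗-cancelˡ-zero f (g ⊖ h) f₀≡1 zero-product) i))
    where
    open import Algebra.Properties.Ring (CommutativeRing.ring polyRing) using (-‿distribʳ-*)
    zero-product : f ⊗ (g ⊖ h) ≋ 0ₚ
    zero-product = begin
      f ⊗ (g ⊖ h)                ≈⟨ ⊗-distribˡ f g (map -_ h) ⟩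
      (f ⊗ g) ⊕ (f ⊗ map -_ h)   ≈⟨ ⊕-cong p (≋-sym (-‿distribʳ-* f h)) ⟩
      (f ⊗ h) ⊖ (f ⊗ h)          ≈⟨ ⊖-inverseʳ (f ⊗ h) ⟩
      0ₚ                         ∎

  -- The divisors in the frieze rule have the form q^e f with f of constant coefficient 1.
  q^⊗-cancelˡ : ∀ e f g h → coeff f 0 ≡ 1ℤ → ((q^ e) ⊗ f) ⊗ g ≋ ((q^ e) ⊗ f) ⊗ h → g ≋ h
  q^⊗-cancelˡ e f g h f₀≡1 p = ⊗-cancelˡ f g h f₀≡1 (coeffs λ i →
    trans (sym (coeff-q^⊗ e (f ⊗ g) i)) (trans (at q^-equal (e ℕ.+ i)) (coeff-q^⊗ e (f ⊗ h) i)))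
    where
    q^-equal : (q^ e) ⊗ (f ⊗ g) ≋ (q^ e) ⊗ (f ⊗ h)
    q^-equal = ≋-trans (≋-sym (⊗-assoc (q^ e) f g)) (≋-trans p (⊗-assoc (q^ e) f h))

-- Finite sums of natural numbers and counting by indicators.

module Sums where

  open import Data.Bool.Base using (if_then_else_; true; false)
  open import Data.Empty using (⊥-elim)
  open import Data.List.Base using ([]; _∷_; map; length; filter; applyUpTo; cartesianProduct; _++_)
  open import Data.List.Properties using (filter-++; length-++)
  open import Data.Nat.Base
  open import Data.Nat.Properties
  open import Algebra.Properties.CommutativeSemigroup +-commutativeSemigroup using (interchange)
  open import Data.Product.Base using (_×_; _,_)
  open import Data.Sum.Base using (_⊎_; inj₁; inj₂)
  open import Function.Base using (_∘_)
  open import Relation.Binary.PropositionalEquality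
  open import Relation.Nullary using (Dec; yes; no; does; ¬_)
  open import Relation.Unary using (Pred; Decidable)

  ∑ : ℕ → (ℕ → ℕ) → ℕ
  ∑ zero    f = 0
  ∑ (suc m) f = ∑ m f + f m

  ∑-cong : ∀ m {f g} → (∀ i → i < m → f i ≡ g i) → ∑ m f ≡ ∑ m g
  ∑-cong zero    p = refl
  ∑-cong (suc m) p = cong₂ _+_ (∑-cong m (λ i i<m → p i (m<n⇒m<1+n i<m))) (p m (n<1+n m))

  ∑-mono : ∀ m {f g} → (∀ i → i < m → f i ≤ g i) → ∑ m f ≤ ∑ m g
  ∑-mono zero    p = z≤n
  ∑-mono (suc m) p = +-mono-≤ (∑-mono m (λ i i<m → p i (m<n⇒m<1+n i<m))) (p m (n<1+n m))

  ∑-+ : ∀ m f g → ∑ m (λ i → f i + g i) ≡ ∑ m f + ∑ m g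
  ∑-+ zero    f g = refl
  ∑-+ (suc m) f g = trans (cong (_+ (f m + g m)) (∑-+ m f g)) (interchange (∑ m f) _ _ _)

  ∑-zero : ∀ m {f} → (∀ i → i < m → f i ≡ 0) → ∑ m f ≡ 0
  ∑-zero zero    p = refl
  ∑-zero (suc m) p = cong₂ _+_ (∑-zero m (λ i i<m → p i (m<n⇒m<1+n i<m))) (p m (n<1+n m))

  ∑-swap : ∀ m n (f : ℕ → ℕ → ℕ) → ∑ m (λ i → ∑ n (f i)) ≡ ∑ n (λ j → ∑ m (λ i → f i j))
  ∑-swap zero    n f = sym (∑-zero n (λ _ _ → refl))
  ∑-swap (suc m) n f = trans (cong (_+ ∑ n (f m)) (∑-swap m n f)) (sym (∑-+ n _ (f m)))

  ∑-split : ∀ m n f → ∑ (m + n) f ≡ ∑ m f + ∑ n (λ i → f (m + i))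
  ∑-split m zero    f rewrite +-identityʳ m = sym (+-identityʳ _)
  ∑-split m (suc n) f rewrite +-suc m n | ∑-split m n f = +-assoc (∑ m f) _ _

  ∑-head : ∀ m f → ∑ (suc m) f ≡ f 0 + ∑ m (f ∘ suc)
  ∑-head m f = ∑-split 1 m f

  ∑-truncate : ∀ {m n} f → m ≤ n → (∀ i → m ≤ i → i < n → f i ≡ 0) → ∑ n f ≡ ∑ m f
  ∑-truncate {m} {n} f m≤n p with m≤n⇒∃[o]m+o≡n m≤n
  ... | o , refl = trans (∑-split m o f)
    (trans (cong (∑ m f +_) (∑-zero o (λ i i<o → p (m + i) (m≤m+n m i) (+-monoʳ-< m i<o))))
           (+-identityʳ _))

  ∑-single : ∀ m {i} f → i < m → (∀ j → j < m → j ≢ i → f j ≡ 0) → ∑ m f ≡ f i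
  ∑-single (suc m) {i} f i<1+m p with i ≟ m
  ... | yes refl = cong (_+ f m) (∑-zero m (λ j j<m → p j (m<n⇒m<1+n j<m) (<⇒≢ j<m)))
  ... | no i≢m   = trans
    (cong₂ _+_ (∑-single m f (≤∧≢⇒< (≤-pred i<1+m) i≢m) (λ j j<m → p j (m<n⇒m<1+n j<m)))
               (p m (n<1+n m) (i≢m ∘ sym)))
    (+-identityʳ _)

  ∑-rotate : ∀ n f → f n ≡ f 0 → ∑ n (f ∘ suc) ≡ ∑ n f
  ∑-rotate n f p = +-cancelˡ-≡ (f 0) _ _
    (trans (sym (∑-head n f)) (trans (cong (∑ n f +_) p) (+-comm (∑ n f) _)))

  𝟙 : ∀ {a} {P : Set a} → Dec P → ℕ
  𝟙 P? = if does P? then 1 else 0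

  module _ {a b} {P : Set a} {Q : Set b} where

    𝟙-mono : (P → Q) → (P? : Dec P) (Q? : Dec Q) → 𝟙 P? ≤ 𝟙 Q?
    𝟙-mono f (no _)  Q?      = z≤n
    𝟙-mono f (yes p) (yes q) = ≤-refl
    𝟙-mono f (yes p) (no ¬q) = ⊥-elim (¬q (f p))

    𝟙-cong : (P → Q) → (Q → P) → (P? : Dec P) (Q? : Dec Q) → 𝟙 P? ≡ 𝟙 Q?
    𝟙-cong f g (yes p) (yes q) = refl
    𝟙-cong f g (yes p) (no ¬q) = ⊥-elim (¬q (f p))
    𝟙-cong f g (no ¬p) (yes q) = ⊥-elim (¬p (g q))
    𝟙-cong f g (no _)  (no _)  = refl

  𝟙-yes : ∀ {a} {P : Set a} (P? : Dec P) → P → 𝟙 P? ≡ 1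
  𝟙-yes (yes _) p = refl
  𝟙-yes (no ¬p) p = ⊥-elim (¬p p)

  𝟙-no : ∀ {a} {P : Set a} (P? : Dec P) → ¬ P → 𝟙 P? ≡ 0
  𝟙-no (no _)  ¬p = refl
  𝟙-no (yes p) ¬p = ⊥-elim (¬p p)

  𝟙-≤1 : ∀ {a} {P : Set a} (P? : Dec P) → 𝟙 P? ≤ 1
  𝟙-≤1 (yes _) = ≤-refl
  𝟙-≤1 (no _)  = z≤n

  module _ {a b c} {P : Set a} {Q : Set b} {R : Set c} where

    𝟙-⊎-≤ : (P → Q ⊎ R) → (P? : Dec P) (Q? : Dec Q) (R? : Dec R) → 𝟙 P? ≤ 𝟙 Q? + 𝟙 R?
    𝟙-⊎-≤ f (no _)  Q?      R? = z≤n
    𝟙-⊎-≤ f (yes p) (yes _) R? = s≤s z≤n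
    𝟙-⊎-≤ f (yes p) (no ¬q) R? with f p
    ... | inj₁ q = ⊥-elim (¬q q)
    ... | inj₂ r = ≤-reflexive (sym (𝟙-yes R? r))

    𝟙-⊎-≥ : (Q → P) → (R → P) → (Q → ¬ R) →
            (P? : Dec P) (Q? : Dec Q) (R? : Dec R) → 𝟙 Q? + 𝟙 R? ≤ 𝟙 P?
    𝟙-⊎-≥ f g h P? (yes q) R? = ≤-reflexive
      (trans (cong suc (𝟙-no R? (h q))) (sym (𝟙-yes P? (f q))))
    𝟙-⊎-≥ f g h P? (no _) R? = 𝟙-mono g R? P?

    𝟙-⊎ : (P → Q ⊎ R) → (Q → P) → (R → P) → (Q → ¬ R) →
          (P? : Dec P) (Q? : Dec Q) (R? : Dec R) → 𝟙 P? ≡ 𝟙 Q? + 𝟙 R?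
    𝟙-⊎ k f g h P? Q? R? = ≤-antisym (𝟙-⊎-≤ k P? Q? R?) (𝟙-⊎-≥ f g h P? Q? R?)

  ∑-𝟙-≡ : ∀ m {i} → i < m → ∑ m (λ j → 𝟙 (j ≟ i)) ≡ 1
  ∑-𝟙-≡ m {i} i<m = trans
    (∑-single m (λ j → 𝟙 (j ≟ i)) i<m (λ j _ j≢i → 𝟙-no (j ≟ i) j≢i)) (𝟙-yes (i ≟ i) refl)

  ∑-𝟙-unique : ∀ {p} {P : ℕ → Set p} (P? : ∀ j → Dec (P j)) m {i} → i < m → P i →
               (∀ j → j < m → P j → j ≡ i) → ∑ m (𝟙 ∘ P?) ≡ 1
  ∑-𝟙-unique P? m {i} i<m pᵢ unique = trans
    (∑-single m (𝟙 ∘ P?) i<m (λ j j<m j≢i → 𝟙-no (P? j) (j≢i ∘ unique j j<m)))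
    (𝟙-yes (P? i) pᵢ)

  module _ {a p} {A : Set a} {P : Pred A p} (P? : Decidable P) where

    length-filter-applyUpTo : ∀ (f : ℕ → A) m →
      length (filter P? (applyUpTo f m)) ≡ ∑ m (λ i → 𝟙 (P? (f i)))
    length-filter-applyUpTo f zero    = refl
    length-filter-applyUpTo f (suc m) =
      trans first (trans (cong (𝟙 (P? (f 0)) +_) (length-filter-applyUpTo (f ∘ suc) m))
                         (sym (∑-head m _)))
      where
      first : length (filter P? (applyUpTo f (suc m)))
              ≡ 𝟙 (P? (f 0)) + length (filter P? (applyUpTo (f ∘ suc) m))
      first with does (P? (f 0))
      ... | true  = refl
      ... | false = refl

  length-filter-map : ∀ {a b p} {A : Set a} {B : Set b} {P : Pred B p} (P? : Decidable P)
    (f : A → B) xs → length (filter P? (map f xs)) ≡ length (filter (P? ∘ f) xs)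
  length-filter-map P? f []       = refl
  length-filter-map P? f (x ∷ xs) with does (P? (f x))
  ... | true  = cong suc (length-filter-map P? f xs)
  ... | false = length-filter-map P? f xs

  module _ {a b p} {A : Set a} {B : Set b} {P : Pred (A × B) p} (P? : Decidable P) where

    length-filter-cartesianProduct : ∀ (f : ℕ → A) m ys →
      length (filter P? (cartesianProduct (applyUpTo f m) ys))
        ≡ ∑ m (λ i → length (filter (λ y → P? (f i , y)) ys))
    length-filter-cartesianProduct f zero    ys = refl
    length-filter-cartesianProduct f (suc m) ys = begin
      length (filter P? (row ++ rest))
        ≡⟨ cong length (filter-++ P? row rest) ⟩
      length (filter P? row ++ filter P? rest)
        ≡⟨ length-++ (filter P? row) ⟩
      length (filter P? row) + length (filter P? rest)
        ≡⟨ cong₂ _+_ (length-filter-map P? (f 0 ,_) ys)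
                     (length-filter-cartesianProduct (f ∘ suc) m ys) ⟩
      F 0 + ∑ m (F ∘ suc)
        ≡⟨ ∑-head m F ⟨
      ∑ (suc m) F ∎
      where
      open ≡-Reasoning
      row  = map (f 0 ,_) ys
      rest = cartesianProduct (applyUpTo (f ∘ suc) m) ys
      F : ℕ → ℕ
      F i = length (filter (λ y → P? (f i , y)) ys)

-- Farey sums on a tree of cells, continuants and the frieze rule over a ring with q-numbers.

module Friezes where

  open import Algebra.Bundles using (CommutativeRing)
  open import Data.Integer.Base as ℤ using (ℤ; +_)
  import Data.Integer.Properties as ℤ
  open import Data.Nat.Base using (ℕ; zero; suc; _+_; _∸_; _≤_; _<_; z≤n; s≤s; z<s)
  open import Data.Nat.Properties hiding (*-identityˡ; *-identityʳ)
  open import Data.Bool.Base using (if_then_else_)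
  open import Function.Base using (_∘_)
  open import Level using (0ℓ)
  open import Relation.Binary.PropositionalEquality as ≡ using (_≡_; refl; sym; cong)
  open import Relation.Binary.Definitions using (tri<; tri≈; tri>)
  open import Relation.Nullary using (yes; no; does; contradiction)
  open import Relation.Nullary.Decidable using (dec-true; dec-false)
  open Sums using (∑)

  -- The cell of an edge i j of the polygon 0, …, N on the side of i j away from
  -- the edge 0 N splits the polygon cut off by i j into two; l and r count the
  -- cells at j and at i in the latter, L m and B m those at m on either side of
  -- the cell of which m is the apex.
  data Cut (E : ℕ → ℕ → Set) (L B : ℕ → ℕ) : (i j l r : ℕ) → Set where
    side : ∀ {i} → E i (suc i) → Cut E L B i (suc i) 0 0
    node : ∀ {i m j l r} → E i j → Cut E L B i m (L m) r → Cut E L B m j l (B m) →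
           Cut E L B i j (suc l) (suc r)

  module _ {E : ℕ → ℕ → Set} {L B : ℕ → ℕ} where

    Cut-edge : ∀ {i j l r} → Cut E L B i j l r → E i j
    Cut-edge (side e)     = e
    Cut-edge (node e _ _) = e

    Cut-< : ∀ {i j l r} → Cut E L B i j l r → i < j
    Cut-< (side {i} _)   = n<1+n i
    Cut-< (node _ C D) = <-trans (Cut-< C) (Cut-< D)

  -- Both friezes are instances: q itself in ℤ[q], and q = 1 in ℤ.
  record QNumbers (R : CommutativeRing 0ℓ 0ℓ) : Set where
    open CommutativeRing R using (Carrier; _≈_; 0#; 1#) renaming (_+_ to _+ᴿ_; _*_ to _*ᴿ_)
    field
      pow   : ℕ → Carrier
      br    : ℕ → Carrier
      pow-0 : pow 0 ≈ 1#
      pow-+ : ∀ a b → pow (a + b) ≈ pow a *ᴿ pow b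
      br-0  : br 0 ≈ 0#
      br-1  : br 1 ≈ 1#
      br-+  : ∀ a b → br (a + b) ≈ br a +ᴿ pow a *ᴿ br b

  module Solutions (R : CommutativeRing 0ℓ 0ℓ) (Q : QNumbers R) where

    open CommutativeRing R
      using (Carrier; _≈_; 0#; 1#; setoid; commutativeSemiring; _-_; *-identityˡ; *-identityʳ;
             zeroˡ; zeroʳ; -‿inverseˡ; -‿inverseʳ; *-congˡ; *-congʳ)
      renaming (_+_ to _⊞_; _*_ to _·_; -_ to neg; refl to ≈-refl; sym to ≈-sym; trans to ≈-trans;
                reflexive to ≈-reflexive; +-cong to ⊞-cong; *-cong to ·-cong; *-assoc to ·-assoc;
                +-identityˡ to ⊞-identityˡ; +-identityʳ to ⊞-identityʳ; +-assoc to ⊞-assoc)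
    open QNumbers Q
    open import Algebra.Solver.Ring.NaturalCoefficients.Default commutativeSemiring
      using (solve; _:+_; _:*_; _:=_; con)
    open import Algebra.Properties.Ring (CommutativeRing.ring R)
      using () renaming (+-cancelʳ to ⊞-cancelʳ)
    open import Relation.Binary.Reasoning.Setoid setoid

    br-suc : ∀ a → br (suc a) ≈ 1# ⊞ pow 1 · br a
    br-suc a = ≈-trans (br-+ 1 a) (⊞-cong br-1 ≈-refl)

    br-sucʳ : ∀ a → br (suc a) ≈ br a ⊞ pow a
    br-sucʳ a = ≈-trans (≈-reflexive (cong br (+-comm 1 a)))
      (≈-trans (br-+ a 1) (⊞-cong ≈-refl (≈-trans (*-congˡ br-1) (*-identityʳ _))))

    pow-suc : ∀ a → pow (suc a) ≈ pow a · pow 1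
    pow-suc a = ≈-trans (≈-reflexive (cong pow (+-comm 1 a))) (pow-+ a 1)

    module _ {E : ℕ → ℕ → Set} {L B : ℕ → ℕ} where

      -- The frieze entries between a fixed vertex 0 and the vertices of the
      -- polygon cut off by i j, up to powers of q, determined by the q-deformed
      -- Farey sum in each cell; d is the number of edges from i to vertices
      -- beyond j, x and y are the values at i and j.
      val : ∀ {i j l r} → Cut E L B i j l r → (d : ℕ) (x y : Carrier) → ℕ → Carrier
      val (side {i} _)         d x y u = if does (u ≤? i) then x else y
      val (node {m = m} _ C D) d x y u =
        -- Seen from m, the edge i j is one more edge from i to a vertex beyond, hence `suc d`; no
        -- edge from m passes beyond j, as it would cross i j, hence 0.
        if does (u ≤? m) then val C (suc d) x (y ⊞ pow (suc d) · x) u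
                         else val D 0 (y ⊞ pow (suc d) · x) y u

      val-≤ : ∀ {i j l r} (C : Cut E L B i j l r) d x y {u} → u ≤ i → val C d x y u ≡ x
      val-≤ (side {i} _) d x y {u} u≤i rewrite dec-true (u ≤? i) u≤i = refl
      val-≤ (node {m = m} _ C D) d x y {u} u≤i
        rewrite dec-true (u ≤? m) (≤-trans u≤i (<⇒≤ (Cut-< C))) = val-≤ C _ _ _ u≤i

      val-≥ : ∀ {i j l r} (C : Cut E L B i j l r) d x y {u} → j ≤ u → val C d x y u ≡ y
      val-≥ (side {i} _) d x y {u} i<u rewrite dec-false (u ≤? i) (<⇒≱ i<u) = refl
      val-≥ (node {m = m} _ C D) d x y {u} j≤u
        rewrite dec-false (u ≤? m) (<⇒≱ (≤-trans (Cut-< D) j≤u)) = val-≥ D _ _ _ j≤u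

      module _ {i m j l r : ℕ} (e : E i j)
               (C : Cut E L B i m (L m) r) (D : Cut E L B m j l (B m))
               (d : ℕ) (x y : Carrier) {u : ℕ} where

        val-node-≤ : u ≤ m → val (node e C D) d x y u ≡ val C (suc d) x (y ⊞ pow (suc d) · x) u
        val-node-≤ u≤m rewrite dec-true (u ≤? m) u≤m = refl

        val-node-≥ : m ≤ u → val (node e C D) d x y u ≡ val D 0 (y ⊞ pow (suc d) · x) y u
        val-node-≥ m≤u with m ≟ u
        ... | yes refl = ≡.trans (val-node-≤ ≤-refl)
                                 (≡.trans (val-≥ C _ _ _ ≤-refl) (sym (val-≤ D _ _ _ ≤-refl)))
        ... | no m≢u rewrite dec-false (u ≤? m) (<⇒≱ (≤∧≢⇒< m≤u m≢u)) = refl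

      -- Running through the neighbours of i from j down to i + 1 crosses the r cells at i, and each
      -- cell adds the next power of q times x, beginning with q^(d+1). The powers form a geometric
      -- sum.
      val-next : ∀ {i j l r} (C : Cut E L B i j l r) d x y →
                 val C d x y (suc i) ≈ y ⊞ pow (suc d) · (br r · x)
      val-next {i} C@(side _) d x y = begin
        val C d x y (suc i)          ≡⟨ val-≥ C d x y ≤-refl ⟩
        y                            ≈⟨ ⊞-identityʳ y ⟨
        y ⊞ 0#                       ≈⟨ ⊞-cong ≈-refl (zeroʳ _) ⟨
        y ⊞ pow (suc d) · 0#         ≈⟨ ⊞-cong ≈-refl (*-congˡ (≈-trans (*-congʳ br-0) (zeroˡ x))) ⟨
        y ⊞ pow (suc d) · (br 0 · x) ∎
      val-next {i} (node {m = m} {r = r} e C D) d x y = begin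
        val (node e C D) d x y (suc i)
          ≡⟨ val-node-≤ e C D d x y (Cut-< C) ⟩
        val C (suc d) x (y ⊞ p · x) (suc i)
          ≈⟨ val-next C (suc d) x _ ⟩
        (y ⊞ p · x) ⊞ pow (suc (suc d)) · (br r · x)
          ≈⟨ ⊞-cong ≈-refl (*-congʳ (pow-suc (suc d))) ⟩
        (y ⊞ p · x) ⊞ (p · pow 1) · (br r · x)
          ≈⟨ solve 5 (λ p q b x y → (y :+ p :* x) :+ (p :* q) :* (b :* x)
                       := y :+ p :* ((con 1 :+ q :* b) :* x)) ≈-refl p (pow 1) (br r) x y ⟩
        y ⊞ p · ((1# ⊞ pow 1 · br r) · x)
          ≈⟨ ⊞-cong ≈-refl (*-congˡ (*-congʳ (br-suc r))) ⟨
        y ⊞ p · (br (suc r) · x) ∎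
        where p = pow (suc d)

      -- Counterpart of `val-next` at the right end: running through the neighbours of `suc j` from
      -- i up to j, the first cell turns x into y + q^(d+1) x and every later one turns z into y + q
      -- z. If j > i, the last side forces B j = 0 and the power on the left is 1; if j = i, then l
      -- = 0 and B i = d, and the power makes the formula cover this case too.
      val-prev : ∀ {i j l r} (C : Cut E L B i (suc j) l r) d x y → d + r ≡ B i →
                 pow (B j) · val C d x y j ≈ br l · y ⊞ pow (l + d) · x
      val-prev {i} {j} C@(side _) d x y d+0≡Bi = begin
        pow (B i) · val C d x y i  ≡⟨ ≡.cong₂ (λ b v → pow b · v) (≡.trans (sym d+0≡Bi) (+-identityʳ d))
                                                 (val-≤ C d x y ≤-refl) ⟩
        pow d · x                  ≈⟨ ⊞-identityˡ _ ⟨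
        0# ⊞ pow d · x             ≈⟨ ⊞-cong (≈-trans (*-congʳ br-0) (zeroˡ y)) ≈-refl ⟨
        br 0 · y ⊞ pow d · x       ∎
      val-prev {i} {j} (node {m = m} {l = l} e C D) d x y d+r≡Bi = begin
        pow (B j) · val (node e C D) d x y j
          ≡⟨ cong (pow (B j) ·_) (val-node-≥ e C D d x y (≤-pred (Cut-< D))) ⟩
        pow (B j) · val D 0 (y ⊞ pow (suc d) · x) y j
          ≈⟨ val-prev D 0 _ y refl ⟩
        br l · y ⊞ pow (l + 0) · (y ⊞ pow (suc d) · x)
          ≡⟨ cong (λ a → br l · y ⊞ pow a · (y ⊞ pow (suc d) · x)) (+-identityʳ l) ⟩
        br l · y ⊞ pow l · (y ⊞ pow (suc d) · x)
          ≈⟨ solve 5 (λ b P p x y → b :* y :+ P :* (y :+ p :* x) := (b :+ P) :* y :+ (P :* p) :* x)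
               ≈-refl (br l) (pow l) (pow (suc d)) x y ⟩
        (br l ⊞ pow l) · y ⊞ (pow l · pow (suc d)) · x
          ≈⟨ ⊞-cong (*-congʳ (br-sucʳ l)) (*-congʳ (≈-trans
               (≈-reflexive (cong pow (sym (+-suc l d)))) (pow-+ l (suc d)))) ⟨
        br (suc l) · y ⊞ pow (suc l + d) · x ∎

      -- A vertex `suc u` strictly between i and j is the apex of exactly one cell of the tree. At
      -- that cell its predecessor is computed in C by `val-prev` and its successor in D by
      -- `val-next`; the L cells on the left, the cell itself and the B cells on the right combine
      -- into a single q-number. At all other cells the claim is inherited from C or D.
      val-rec : ∀ {i j l r} (C : Cut E L B i j l r) d x y → d + r ≡ B i →
                ∀ u → i ≤ u → suc u < j →
                pow (L (suc u)) · val C d x y (suc (suc u)) ⊞ pow (B u) · val C d x y u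
                  ≈ br (suc (L (suc u) + B (suc u))) · val C d x y (suc u)
      val-rec (side _) d x y _ u i≤u 1+u<j = contradiction (≤-trans 1+u<j (s≤s i≤u)) 1+n≰n
      val-rec (node {m = m} {r = r} e C D) d x y d+r≡Bi u i≤u 1+u<j with <-cmp (suc u) m
      ... | tri< 1+u<m _ _
        rewrite val-node-≤ e C D d x y 1+u<m
              | val-node-≤ e C D d x y (<⇒≤ 1+u<m)
              | val-node-≤ e C D d x y (≤-trans (n≤1+n u) (<⇒≤ 1+u<m))
        = val-rec C (suc d) x _ (≡.trans (sym (+-suc d r)) d+r≡Bi) u i≤u 1+u<m
      ... | tri> _ _ m<1+u
        rewrite val-node-≥ e C D d x y (≤-trans (≤-pred m<1+u) (≤-trans (n≤1+n u) (n≤1+n (suc u))))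
              | val-node-≥ e C D d x y (<⇒≤ m<1+u)
              | val-node-≥ e C D d x y (≤-pred m<1+u)
        = val-rec D 0 _ y refl u (≤-pred m<1+u) 1+u<j
      ... | tri≈ _ refl _
        rewrite val-node-≥ e C D d x y (n≤1+n (suc u))
              | val-node-≥ e C D d x y (≤-refl {suc u})
              | val-node-≤ e C D d x y (n≤1+n u)
              | val-≤ D 0 (y ⊞ pow (suc d) · x) y (≤-refl {suc u})
        = begin
        pow ℓ · val D 0 z y (suc (suc u)) ⊞ pow (B u) · val C (suc d) x z u
          ≈⟨ ⊞-cong (*-congˡ (val-next D 0 z y))
                    (val-prev C (suc d) x z (≡.trans (sym (+-suc d r)) d+r≡Bi)) ⟩
        pow ℓ · (y ⊞ pow 1 · (br b · z)) ⊞ (br ℓ · z ⊞ pow (ℓ + suc d) · x)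
          ≈⟨ ⊞-cong ≈-refl (⊞-cong ≈-refl (*-congʳ (pow-+ ℓ (suc d)))) ⟩
        pow ℓ · (y ⊞ pow 1 · (br b · z)) ⊞ (br ℓ · z ⊞ (pow ℓ · pow (suc d)) · x)
          ≈⟨ solve 7 (λ P q b a p x y →
               P :* (y :+ q :* (b :* (y :+ p :* x))) :+ (a :* (y :+ p :* x) :+ (P :* p) :* x)
                 := (a :+ P :* (con 1 :+ q :* b)) :* (y :+ p :* x))
               ≈-refl (pow ℓ) (pow 1) (br b) (br ℓ) (pow (suc d)) x y ⟩
        (br ℓ ⊞ pow ℓ · (1# ⊞ pow 1 · br b)) · z
          ≈⟨ *-congʳ (⊞-cong ≈-refl (*-congˡ (br-suc b))) ⟨
        (br ℓ ⊞ pow ℓ · br (suc b)) · z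
          ≈⟨ *-congʳ (br-+ ℓ (suc b)) ⟨
        br (ℓ + suc b) · z
          ≡⟨ cong (λ a → br a · z) (+-suc ℓ b) ⟩
        br (suc (ℓ + b)) · z ∎
        where
        z = y ⊞ pow (suc d) · x
        ℓ = L (suc u)
        b = B (suc u)

    -- For c i ≥ 1 the truncated difference c i ∸ 1 is exact; at i = 0 its value
    -- does not matter.
    continuant : (ℕ → ℕ) → ℕ → Carrier
    continuant c 0             = 0#
    continuant c 1             = 1#
    continuant c (suc (suc i)) =
      br (c (suc i)) · continuant c (suc i) - pow (c i ∸ 1) · continuant c i

    continuant-rec : ∀ c i → continuant c (suc (suc i)) ⊞ pow (c i ∸ 1) · continuant c i
                             ≈ br (c (suc i)) · continuant c (suc i)
    continuant-rec c i = ≈-trans (⊞-assoc _ _ _)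
      (≈-trans (⊞-cong ≈-refl (-‿inverseˡ _)) (⊞-identityʳ _))

    continuant-cong : ∀ {c c′} → (∀ i → c i ≡ c′ i) → ∀ i → continuant c i ≡ continuant c′ i
    continuant-cong p 0 = refl
    continuant-cong p 1 = refl
    continuant-cong p (suc (suc i)) = ≡.cong₂ _-_
      (≡.cong₂ (λ a x → br a · x) (p (suc i)) (continuant-cong p (suc i)))
      (≡.cong₂ (λ a x → pow (a ∸ 1) · x) (p i) (continuant-cong p i))

    -- A Casoratian: the continuants of `c` and of `c ∘ suc`, the latter shifted by one place,
    -- satisfy the same three-term recursion, so their 2 by 2 determinant is multiplied at each step
    -- by the power of q in front of the older term.
    continuant-diamond : ∀ c i →
      continuant c (suc i) · continuant (c ∘ suc) (suc i)
        ≈ continuant (c ∘ suc) i · continuant c (suc (suc i)) ⊞ pow (∑ i (λ u → c (suc u) ∸ 1))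
    continuant-diamond c zero = begin
      1# · 1#                                           ≈⟨ *-identityˡ 1# ⟩
      1#                                                ≈⟨ pow-0 ⟨
      pow 0                                             ≈⟨ ⊞-identityˡ _ ⟨
      0# ⊞ pow 0                                        ≈⟨ ⊞-cong (zeroˡ _) ≈-refl ⟨
      0# · continuant c 2 ⊞ pow 0                       ∎
    -- The solver works in semirings, so the subtracted term of the recursion is added on both sides
    -- and cancelled at the end.
    continuant-diamond c (suc i) = ⊞-cancelʳ (P · (a′ · b)) _ _ (begin
      b · c₂′ ⊞ P · (a′ · b)
        ≈⟨ solve 4 (λ b c P a → b :* c :+ P :* (a :* b) := b :* (c :+ P :* a)) ≈-refl b c₂′ P a′ ⟩
      b · (c₂′ ⊞ P · a′)
        ≈⟨ *-congˡ (continuant-rec (c ∘ suc) i) ⟩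
      b · (C · b′)
        ≈⟨ solve 3 (λ b C b′ → b :* (C :* b′) := b′ :* (C :* b)) ≈-refl b C b′ ⟩
      b′ · (C · b)
        ≈⟨ *-congˡ (continuant-rec c (suc i)) ⟨
      b′ · (c₂ ⊞ P · a)
        ≈⟨ solve 4 (λ b c P a → b :* (c :+ P :* a) := b :* c :+ P :* (a :* b)) ≈-refl b′ c₂ P a ⟩
      b′ · c₂ ⊞ P · (a · b′)
        ≈⟨ ⊞-cong ≈-refl (*-congˡ (continuant-diamond c i)) ⟩
      b′ · c₂ ⊞ P · (a′ · b ⊞ W)
        ≈⟨ solve 4 (λ x P y W → x :+ P :* (y :+ W) := (x :+ W :* P) :+ P :* y) ≈-refl
             (b′ · c₂) P (a′ · b) W ⟩
      (b′ · c₂ ⊞ W · P) ⊞ P · (a′ · b)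
        ≈⟨ ⊞-cong (⊞-cong ≈-refl (pow-+ _ (c (suc i) ∸ 1))) ≈-refl ⟨
      (b′ · c₂ ⊞ pow (∑ (suc i) (λ u → c (suc u) ∸ 1))) ⊞ P · (a′ · b) ∎)
      where
      a = continuant c (suc i)
      b = continuant c (suc (suc i))
      c₂ = continuant c (suc (suc (suc i)))
      a′ = continuant (c ∘ suc) i
      b′ = continuant (c ∘ suc) (suc i)
      c₂′ = continuant (c ∘ suc) (suc (suc i))
      C = br (c (suc (suc i)))
      P = pow (c (suc i) ∸ 1)
      W = pow (∑ i (λ u → c (suc u) ∸ 1))

    module _ {E : ℕ → ℕ → Set} {L B : ℕ → ℕ} {N l : ℕ} (C : Cut E L B 0 N l (B 0))
             (L₀ : L 0 ≡ 0) (L₁ : L 1 ≡ 0)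
             (c : ℕ → ℕ) (c≡ : ∀ u → 0 < u → u < N → c u ≡ suc (L u + B u)) where

      private
        g : ℕ → Carrier
        g = val C 0 0# 1#

      -- Multiplying `val-rec` by q to the power `∑ (suc u) L` gives the recursion of the
      -- continuants: adding L (suc u) yields the exponent belonging to u + 2, and adding B u yields
      -- `∑ u L` + (c u - 1).
      continuant-val : ∀ u → u ≤ N → continuant c u ≈ pow (∑ u L) · g u
      continuant-val 0 _ =
        ≈-sym (≈-trans (*-congˡ (≈-reflexive (val-≤ C 0 0# 1# z≤n))) (zeroʳ _))
      continuant-val 1 _ = ≈-sym (begin
        pow (L 0) · g 1                    ≡⟨ cong (λ a → pow a · g 1) L₀ ⟩
        pow 0 · g 1                        ≈⟨ ·-cong pow-0 (val-next C 0 0# 1#) ⟩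
        1# · (1# ⊞ pow 1 · (br (B 0) · 0#))
          ≈⟨ solve 2 (λ p b → con 1 :* (con 1 :+ p :* (b :* con 0)) := con 1) ≈-refl (pow 1) (br (B 0)) ⟩
        1#                                 ∎)
      continuant-val (suc (suc u)) 2+u≤N = ⊞-cancelʳ (pow (c u ∸ 1) · continuant c u) _ _ (begin
        continuant c (suc (suc u)) ⊞ pow (c u ∸ 1) · continuant c u
          ≈⟨ continuant-rec c u ⟩
        br (c (suc u)) · continuant c (suc u)
          ≈⟨ *-congˡ (continuant-val (suc u) (<⇒≤ 2+u≤N)) ⟩
        br (c (suc u)) · (T · g (suc u))
          ≡⟨ cong (λ a → br a · (T · g (suc u))) (c≡ (suc u) z<s 2+u≤N) ⟩
        br (suc (L (suc u) + B (suc u))) · (T · g (suc u))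
          ≈⟨ solve 3 (λ b T x → b :* (T :* x) := T :* (b :* x)) ≈-refl _ T (g (suc u)) ⟩
        T · (br (suc (L (suc u) + B (suc u))) · g (suc u))
          ≈⟨ *-congˡ (val-rec C 0 0# 1# refl u z≤n 2+u≤N) ⟨
        T · (pow (L (suc u)) · g (suc (suc u)) ⊞ pow (B u) · g u)
          ≈⟨ solve 5 (λ T P x Q y → T :* (P :* x :+ Q :* y) := (T :* P) :* x :+ (T :* Q) :* y) ≈-refl
               T (pow (L (suc u))) (g (suc (suc u))) (pow (B u)) (g u) ⟩
        (T · pow (L (suc u))) · g (suc (suc u)) ⊞ (T · pow (B u)) · g u
          ≈⟨ ⊞-cong (*-congʳ (pow-+ (∑ (suc u) L) (L (suc u)))) (lower u 2+u≤N) ⟨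
        pow (∑ (suc (suc u)) L) · g (suc (suc u)) ⊞ pow (c u ∸ 1) · continuant c u ∎)
        where
        T = pow (∑ (suc u) L)
        lower : ∀ u → suc (suc u) ≤ N →
                pow (c u ∸ 1) · continuant c u ≈ (pow (∑ (suc u) L) · pow (B u)) · g u
        -- The formula for `c u` is available only for u > 0; at 0 both sides vanish, the values
        -- there being 0.
        lower zero    _ = ≈-trans (zeroʳ _)
          (≈-sym (≈-trans (*-congˡ (≈-reflexive (val-≤ C 0 0# 1# z≤n))) (zeroʳ _)))
        lower v@(suc w) p = begin
          pow (c v ∸ 1) · continuant c v
            ≈⟨ ·-cong (≈-reflexive (cong (λ a → pow (a ∸ 1)) (c≡ v z<s (<⇒≤ p))))
                      (continuant-val v (≤-trans (n≤1+n v) (<⇒≤ p))) ⟩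
          pow (L v + B v) · (pow (∑ v L) · g v)
            ≈⟨ *-congʳ (pow-+ (L v) (B v)) ⟩
          (pow (L v) · pow (B v)) · (pow (∑ v L) · g v)
            ≈⟨ solve 4 (λ P Q T x → (P :* Q) :* (T :* x) := ((T :* P) :* Q) :* x) ≈-refl
                 (pow (L v)) (pow (B v)) (pow (∑ v L)) (g v) ⟩
          ((pow (∑ v L) · pow (L v)) · pow (B v)) · g v
            ≈⟨ *-congʳ (*-congʳ (pow-+ (∑ v L) (L v))) ⟨
          (pow (∑ (suc v) L) · pow (B v)) · g v ∎

    module _ (N : ℕ) (c : ℤ → ℕ → ℕ) (c-shift : ∀ k j → c (k ℤ.+ + 1) j ≡ c k (suc j))
             (s : ℤ → ℕ → Carrier)
             (diag₀ : ∀ k → s k 0 ≈ 0#) (diag₁ : ∀ k → s k 1 ≈ 1#)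
             (diag₂ : ∀ k → s k 2 ≈ br (c k 1))
             (rule : ∀ k i → suc (suc (suc i)) ≤ N →
               s k (suc (suc i)) · s (k ℤ.+ + 1) (suc (suc i))
                 - s (k ℤ.+ + 1) (suc i) · s k (suc (suc (suc i)))
               ≈ pow (∑ (suc i) (λ u → c k (suc u) ∸ 1)))
             (cancel : ∀ k i → 0 < i → i ≤ N → ∀ x y →
               continuant (c k) i · x ≈ continuant (c k) i · y → x ≈ y) where

      -- The induction runs over all k at once since the rule ties row k to row k + 1. By
      -- `continuant-diamond` the continuants obey the same rule, and three of the four entries
      -- agree by induction, so the fourth follows on cancelling the divisor. That this is possible
      -- depends on the triangulation and on the ring, which is why it enters as the hypothesis
      -- `cancel`.
      frieze-continuant : ∀ i → i ≤ N → ∀ k → s k i ≈ continuant (c k) i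
      frieze-continuant 0 _ k = diag₀ k
      frieze-continuant 1 _ k = diag₁ k
      frieze-continuant 2 _ k = begin
        s k 2                                          ≈⟨ diag₂ k ⟩
        br (c k 1)
          ≈⟨ solve 2 (λ b p → b := b :* con 1 :+ p :* con 0) ≈-refl (br (c k 1)) (pow (c k 0 ∸ 1)) ⟩
        br (c k 1) · 1# ⊞ pow (c k 0 ∸ 1) · 0#
          ≈⟨ ⊞-cong (≈-sym (continuant-rec (c k) 0)) ≈-refl ⟩
        (continuant (c k) 2 ⊞ pow (c k 0 ∸ 1) · 0#) ⊞ pow (c k 0 ∸ 1) · 0#
          ≈⟨ solve 2 (λ x p → (x :+ p :* con 0) :+ p :* con 0 := x) ≈-refl _ (pow (c k 0 ∸ 1)) ⟩
        continuant (c k) 2 ∎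
      frieze-continuant (suc (suc (suc i))) 3+i≤N k =
        cancel k′ (suc i) z<s (≤-trans (n≤1+n _) 2+i≤N) _ _
          (⊞-cancelʳ W _ _ (begin
            continuant (c k′) (suc i) · s k (suc (suc (suc i))) ⊞ W
              ≈⟨ ⊞-cong (*-congʳ (frieze-continuant (suc i) 1+i≤N k′)) ≈-refl ⟨
            X ⊞ W
              ≈⟨ ⊞-cong ≈-refl (rule k i 3+i≤N) ⟨
            X ⊞ (s k (suc (suc i)) · s k′ (suc (suc i)) - X)
              ≈⟨ ≈-trans (solve 3 (λ X Y Z → X :+ (Y :+ Z) := Y :+ (Z :+ X)) ≈-refl X _ (neg X))
                         (≈-trans (⊞-cong ≈-refl (-‿inverseˡ X)) (⊞-identityʳ _)) ⟩
            s k (suc (suc i)) · s k′ (suc (suc i))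
              ≈⟨ ·-cong (frieze-continuant (suc (suc i)) 2+i≤N k)
                        (frieze-continuant (suc (suc i)) 2+i≤N k′) ⟩
            continuant (c k) (suc (suc i)) · continuant (c k′) (suc (suc i))
              ≡⟨ cong (continuant (c k) (suc (suc i)) ·_) (continuant-cong (c-shift k) (suc (suc i))) ⟩
            continuant (c k) (suc (suc i)) · continuant (c k ∘ suc) (suc (suc i))
              ≈⟨ continuant-diamond (c k) (suc i) ⟩
            continuant (c k ∘ suc) (suc i) · continuant (c k) (suc (suc (suc i))) ⊞ W
              ≡⟨ cong (λ a → a · continuant (c k) (suc (suc (suc i))) ⊞ W)
                      (continuant-cong (c-shift k) (suc i)) ⟨
            continuant (c k′) (suc i) · continuant (c k) (suc (suc (suc i))) ⊞ W ∎))
        where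
        k′ = k ℤ.+ + 1
        W = pow (∑ (suc i) (λ u → c k (suc u) ∸ 1))
        X = s k′ (suc i) · s k (suc (suc (suc i)))
        2+i≤N : suc (suc i) ≤ N
        2+i≤N = <⇒≤ 3+i≤N
        1+i≤N : suc i ≤ N
        1+i≤N = <⇒≤ 2+i≤N

-- Constant coefficient, degree and value at q = 1 of the Farey sums.

module Degrees where

  open import Defs
  open import Data.Integer.Base as ℤ using (ℤ; 0ℤ; 1ℤ)
  import Data.Integer.Properties as ℤ
  open import Data.List.Base using ([])
  open import Data.Nat.Base using (ℕ; suc; _+_; _≤_; _<_; z≤n; s≤s; z<s)
  open import Data.Nat.Properties
  open import Data.Nat.Tactic.RingSolver using (solve-∀)
  open import Data.Product.Base using (_×_; _,_)
  open import Data.Sum.Base using (_⊎_; inj₁; inj₂)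
  open import Relation.Binary.Definitions using (tri<; tri≈; tri>)
  open import Relation.Binary.PropositionalEquality
    using (_≡_; refl; sym; trans; cong; cong₂; subst)
  open import Relation.Nullary using (¬_; contradiction)
  open Polynomials
  open Friezes

  qPolynomials : QNumbers polyRing
  qPolynomials = record
    { pow = q^_ ; br = [_]q ; pow-0 = ≋-refl ; pow-+ = q^-+
    ; br-0 = ≋-refl ; br-1 = ≋-refl ; br-+ = []q-+ }

  qIntegers : QNumbers ℤ.+-*-commutativeRing
  qIntegers = record
    { pow = λ _ → 1ℤ ; br = ℤ.+_ ; pow-0 = refl ; pow-+ = λ _ _ → refl
    ; br-0 = refl ; br-1 = refl
    ; br-+ = λ a b → trans (ℤ.pos-+ a b) (cong (ℤ._+_ (ℤ.+ a)) (sym (ℤ.*-identityˡ (ℤ.+ b)))) }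

  module ℤ[q] = Solutions polyRing qPolynomials
  module Int = Solutions ℤ.+-*-commutativeRing qIntegers

  module _ {E : ℕ → ℕ → Set} {L B : ℕ → ℕ} where

    open ℤ[q]

    -- The left summand of each Farey sum carries at least one factor q, so the constant coefficient
    -- is that of the right end.
    val-constant : ∀ {i j l r} (C : Cut E L B i j l r) d x y → coeff y 0 ≡ 1ℤ →
                   ∀ {u} → i < u → coeff (val C d x y u) 0 ≡ 1ℤ
    val-constant C@(side _) d x y y₀ i<u rewrite val-≥ C d x y i<u = y₀
    val-constant (node {m = m} e C D) d x y y₀ {u} i<u with ≤-<-connex u m
    ... | inj₁ u≤m rewrite val-node-≤ e C D d x y u≤m = val-constant C _ _ _
      (trans (coeff-⊕ y _ 0) (cong₂ ℤ._+_ y₀ (coeff-q^⊗-< (suc d) x 0 z<s))) i<u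
    ... | inj₂ m<u rewrite val-node-≥ e C D d x y (<⇒≤ m<u) = val-constant D _ _ _ y₀ m<u

    module _ (N : ℕ) (ρ L⁺ : ℕ → ℕ)
             (ρ-rec : ∀ u → 0 < u → u < N → ρ (suc u) + L⁺ (suc u) ≡ ρ u + B u) where

      -- Here `ρ u` stands for the number of chords passing over u and `L⁺ u` for the number of
      -- those ending at u from the left, chords at 0 left out in both. A chord that starts before j
      -- and reaches j or beyond either passes over i, or leads from i beyond j (d of them), or ends
      -- at j and starts at i or later (l of them). The proof merely telescopes `ρ-rec` along the
      -- tree, the inner vertices being not adjacent to 0.
      ρ-Cut : ∀ {i j l r} → Cut E L B i j l r → ∀ d → d + r ≡ B i → 0 < i → j ≤ N →
              (∀ u → i < u → u < j → L⁺ u ≡ L u) → ρ j + L⁺ j ≡ ρ i + d + l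
      -- A chord over m avoiding 0 passes over i or leads from i to j or beyond, as any other would
      -- cross the cell. Hence the expected degree at m is that of the summand q^(d+1) x.
      ρ-apex : ∀ {i m j l r} → Cut E L B i m (L m) r → Cut E L B m j l (B m) →
               ∀ d → d + suc r ≡ B i → 0 < i → j ≤ N →
               (∀ u → i < u → u < j → L⁺ u ≡ L u) → ρ m ≡ ρ i + suc d

      ρ-Cut {i} (side _) d d+0≡Bi 0<i j≤N L⁺≡L = trans (ρ-rec i 0<i j≤N)
        (trans (cong (ρ i +_) (trans (sym d+0≡Bi) (+-identityʳ d))) (sym (+-identityʳ _)))
      ρ-Cut {i} {j} (node {l = l} _ C D) d d+r≡Bi 0<i j≤N L⁺≡L = trans
        (ρ-Cut D 0 refl (<-trans 0<i (Cut-< C)) j≤N (λ u m<u → L⁺≡L u (<-trans (Cut-< C) m<u)))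
        (trans (cong (λ a → a + 0 + l) (ρ-apex C D d d+r≡Bi 0<i j≤N L⁺≡L)) (shift (ρ i) d l))
        where
        shift : ∀ a d l → a + suc d + 0 + l ≡ a + d + suc l
        shift = solve-∀

      ρ-apex {m = m} C D d d+r≡Bi 0<i j≤N L⁺≡L = +-cancelʳ-≡ (L m) _ _
        (trans (cong (ρ m +_) (sym (L⁺≡L m (Cut-< C) (Cut-< D))))
               (ρ-Cut C (suc d) (trans (sym (+-suc d _)) d+r≡Bi) 0<i (≤-trans (<⇒≤ (Cut-< D)) j≤N)
                      (λ u i<u u<m → L⁺≡L u i<u (<-trans u<m (Cut-< D)))))

      -- In y + q^(d+1) x the second summand has degree ρ m by `ρ-apex`, while `ρ-Cut` together with
      -- `l ≤ L⁺ j` gives ρ j ≤ ρ i + d, so y has strictly smaller degree and cannot interfere. The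
      -- hypothesis is an inequality because the passage to D drops the chord i j from l but not
      -- from `L⁺ j`.
      val-Monic : ∀ {i j l r} (C : Cut E L B i j l r) d x y → d + r ≡ B i → 0 < i → j ≤ N →
                  (∀ u → i < u → u < j → L⁺ u ≡ L u) → l ≤ L⁺ j →
                  Monic x (ρ i) → Monic y (ρ j) →
                  ∀ {u} → i ≤ u → u ≤ j → Monic (val C d x y u) (ρ u)
      val-Monic C@(side _) d x y _ _ _ _ _ mx my {u} i≤u u≤j with m≤n⇒m<n∨m≡n i≤u
      ... | inj₂ refl rewrite val-≤ C d x y i≤u = mx
      ... | inj₁ i<u rewrite val-≥ C d x y i<u | ≤-antisym u≤j i<u = my
      val-Monic {i} {j} (node {m = m} {l = l} e C D) d x y d+r≡Bi 0<i j≤N L⁺≡L l≤L⁺ mx my {u} i≤u u≤j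
        = by-side (≤-total u m)
        where
        ρm : ρ m ≡ suc d + ρ i
        ρm = trans (ρ-apex C D d d+r≡Bi 0<i j≤N L⁺≡L) (+-comm (ρ i) (suc d))
        ρj≤ : ρ j ≤ ρ i + d
        ρj≤ = +-cancelʳ-≤ (suc l) _ _ (≤-trans (+-monoʳ-≤ (ρ j) l≤L⁺)
          (≤-reflexive (ρ-Cut (node e C D) d d+r≡Bi 0<i j≤N L⁺≡L)))
        ρj< : ρ j < suc d + ρ i
        ρj< = s≤s (≤-trans ρj≤ (≤-reflexive (+-comm (ρ i) d)))
        z = y ⊕ (q^ suc d) ⊗ x
        mz : Monic z (ρ m)
        mz = subst (Monic z) (sym ρm) (Monic-⊕ y _ ρj< my (Monic-q^⊗ (suc d) x mx))
        by-side : u ≤ m ⊎ m ≤ u → Monic (val (node e C D) d x y u) (ρ u)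
        by-side (inj₁ u≤m) rewrite val-node-≤ e C D d x y u≤m =
          val-Monic C (suc d) x z (trans (sym (+-suc d _)) d+r≡Bi) 0<i (≤-trans (<⇒≤ (Cut-< D)) j≤N)
            (λ v i<v v<m → L⁺≡L v i<v (<-trans v<m (Cut-< D)))
            (≤-reflexive (sym (L⁺≡L m (Cut-< C) (Cut-< D)))) mx mz i≤u u≤m
        by-side (inj₂ m≤u) rewrite val-node-≥ e C D d x y m≤u =
          val-Monic D 0 z y refl (<-trans 0<i (Cut-< C)) j≤N
            (λ v m<v → L⁺≡L v (<-trans (Cut-< C) m<v)) (≤-trans (n≤1+n l) l≤L⁺) mz my m≤u u≤j

      module _ (noncrossing : ∀ {m u j} → 0 < m → m < u → u < j → j ≤ N → E m j → ¬ E 0 u)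
               (L-adjacent : ∀ u → 1 < u → u ≤ N → E 0 u → L u ≡ suc (L⁺ u))
               (L-nonadjacent : ∀ u → ¬ E 0 u → L⁺ u ≡ L u)
               (ρ-1 : ρ 1 ≡ 0) where

        private
          inner : ∀ {m j l r} → Cut E L B m j l r → 0 < m → j ≤ N → ∀ u → m < u → u < j → L⁺ u ≡ L u
          inner D 0<m j≤N u m<u u<j = L-nonadjacent u (noncrossing 0<m m<u u<j j≤N (Cut-edge D))

        -- A chord passing over a neighbour j of 0 and avoiding 0 would cross the edge 0 j.
        ρ-adjacent : ∀ {j l r} → Cut E L B 0 j l r → j ≤ N → l ≡ L j → ρ j ≡ 0
        ρ-adjacent (side _) _ _ = ρ-1
        ρ-adjacent {j} (node {m = m} {l = l} e C D) j≤N l≡L = +-cancelʳ-≡ (L⁺ j) _ _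
          (trans (ρ-Cut D 0 refl (Cut-< C) j≤N (inner D (Cut-< C) j≤N))
          (trans (cong (λ a → a + 0 + l) (ρ-adjacent C (≤-trans (<⇒≤ (Cut-< D)) j≤N) refl))
                 (suc-injective (trans l≡L (L-adjacent j (<-≤-trans (s≤s (Cut-< C)) (Cut-< D)) j≤N e)))))

        -- With value 0 at vertex 0 the Farey sum returns y, so every neighbour of 0 receives the
        -- value of the right end, of degree 0. The polygon between consecutive neighbours m and j
        -- of 0 is cut off by an edge avoiding 0, and there `val-Monic` takes over.
        val-Monic₀ : ∀ {j l r} (C : Cut E L B 0 j l r) d y → j ≤ N → l ≡ L j → Monic y 0 →
                     ∀ {u} → 0 < u → u ≤ j → Monic (val C d [] y u) (ρ u)
        val-Monic₀ C@(side _) d y _ _ my {u} 0<u u≤1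
          rewrite val-≥ C d [] y 0<u | ≤-antisym u≤1 0<u | ρ-1 = my
        val-Monic₀ {j} (node {m = m} {l = l} e C D) d y j≤N l≡L my {u} 0<u u≤j = by-side (≤-total u m)
          where
          m≤N : m ≤ N
          m≤N = ≤-trans (<⇒≤ (Cut-< D)) j≤N
          z = y ⊕ (q^ suc d) ⊗ []
          mz : Monic z 0
          mz = Monic-resp (≋-sym (≋-trans (⊕-cong ≋-refl (⊗-zeroʳ (q^ suc d))) (⊕-identityʳ y))) my
          -- The chord 0 j is lost on both sides: `L⁺` does not count it, and l has dropped by one
          -- in passing to D.
          l≤L⁺ : l ≤ L⁺ j
          l≤L⁺ = ≤-reflexive
            (suc-injective (trans l≡L (L-adjacent j (<-≤-trans (s≤s (Cut-< C)) (Cut-< D)) j≤N e)))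
          by-side : u ≤ m ⊎ m ≤ u → Monic (val (node e C D) d [] y u) (ρ u)
          by-side (inj₁ u≤m) rewrite val-node-≤ e C D d [] y u≤m =
            val-Monic₀ C (suc d) z m≤N refl mz 0<u u≤m
          by-side (inj₂ m≤u) rewrite val-node-≥ e C D d [] y m≤u =
            val-Monic D 0 z y refl (Cut-< C) j≤N (inner D (Cut-< C) j≤N) l≤L⁺
              (subst (Monic z) (sym (ρ-adjacent C m≤N refl)) mz)
              (subst (Monic y) (sym (ρ-adjacent (node e C D) j≤N l≡L)) my) m≤u u≤j

  module _ {E : ℕ → ℕ → Set} {L B : ℕ → ℕ} where

    open Int

    -- Every vertex strictly inside is an apex, and at q = 1 its value is a plain sum of two values
    -- that are at least 1.
    val-≥2 : ∀ {i j l r} (C : Cut E L B i j l r) d {x y} → 1ℤ ℤ.≤ x → 1ℤ ℤ.≤ y →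
             ∀ {u} → i < u → u < j → ℤ.+ 2 ℤ.≤ val C d x y u
    val-≥2 (side _) d _ _ i<u u<1+i = contradiction (<-≤-trans i<u (≤-pred u<1+i)) (<-irrefl refl)
    val-≥2 (node {m = m} e C D) d {x} {y} 1≤x 1≤y {u} i<u u<j = by-side (<-cmp u m)
      where
      z = y ℤ.+ 1ℤ ℤ.* x
      2≤z : ℤ.+ 2 ℤ.≤ z
      2≤z rewrite ℤ.*-identityˡ x = ℤ.+-mono-≤ 1≤y 1≤x
      1≤z : 1ℤ ℤ.≤ z
      1≤z = ℤ.≤-trans (ℤ.+≤+ (s≤s z≤n)) 2≤z
      by-side : _ → ℤ.+ 2 ℤ.≤ val (node e C D) d x y u
      by-side (tri< u<m _ _) rewrite val-node-≤ e C D d x y (<⇒≤ u<m) = val-≥2 C _ 1≤x 1≤z i<u u<m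
      by-side (tri> _ _ m<u) rewrite val-node-≥ e C D d x y (<⇒≤ m<u) = val-≥2 D _ 1≤z 1≤y m<u u<j
      by-side (tri≈ _ refl _) rewrite val-node-≤ e C D d x y ≤-refl | val-≥ C (suc d) x z ≤-refl = 2≤z

    module _ {N : ℕ} (noncrossing : ∀ {m u j} → 0 < m → m < u → u < j → j ≤ N → E m j → ¬ E 0 u) where

      -- A vertex that is not a neighbour of 0 lies strictly between consecutive neighbours m and j.
      -- Both of these have value 1, so `val-≥2` applies, and the edge m j separates the vertex from
      -- 0.
      val-adjacency : ∀ {j l r} (C : Cut E L B 0 j l r) d → j ≤ N → ∀ {u} → 0 < u → u ≤ j →
        (E 0 u × val C d 0ℤ 1ℤ u ≡ 1ℤ) ⊎ (¬ E 0 u × ℤ.+ 2 ℤ.≤ val C d 0ℤ 1ℤ u)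
      val-adjacency C@(side e) d j≤N {u} 0<u u≤j
        rewrite val-≥ C d 0ℤ 1ℤ 0<u | ≤-antisym u≤j 0<u = inj₁ (e , refl)
      val-adjacency {j} (node {m = m} e C D) d j≤N {u} 0<u u≤j with ≤-<-connex u m
      ... | inj₁ u≤m rewrite val-node-≤ e C D d 0ℤ 1ℤ u≤m =
        val-adjacency C (suc d) (≤-trans (<⇒≤ (Cut-< D)) j≤N) 0<u u≤m
      ... | inj₂ m<u with m≤n⇒m<n∨m≡n u≤j
      ...   | inj₂ refl rewrite val-≥ (node e C D) d 0ℤ 1ℤ ≤-refl = inj₁ (e , refl)
      ...   | inj₁ u<j rewrite val-node-≥ e C D d 0ℤ 1ℤ (<⇒≤ m<u) =
        inj₂ ( noncrossing (Cut-< C) m<u u<j j≤N (Cut-edge D)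
             , val-≥2 D 0 ℤ.≤-refl ℤ.≤-refl m<u u<j)

-- Triangulated polygons as edge relations: chords at a vertex, the tree of cells, rotation.

module Windows where

  open import Data.Nat.Base using (ℕ; zero; suc; _+_; _≤_; _<_; z≤n; s≤s; z<s; s<s)
  open import Data.Nat.Properties
  open import Data.Product.Base using (_×_; _,_; proj₂; ∃-syntax)
  open import Data.Sum.Base using (_⊎_; inj₁; inj₂)
  open import Function.Base using (_∘_; _on_)
  open import Relation.Binary.Definitions using (Symmetric)
  open import Relation.Binary.PropositionalEquality
    using (_≡_; refl; sym; trans; cong; subst; subst₂)
  open import Relation.Nullary using (Dec; ¬_; contradiction)
  open import Relation.Nullary.Decidable using (_×-dec_)
  open Sums
  open Friezes using (Cut; side; node; Cut-<; Cut-edge)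

  -- The edges of a triangulation of the polygon with vertices 0, …, N.
  record Window (N : ℕ) (E : ℕ → ℕ → Set) : Set where
    field
      sides       : ∀ {i} → i < N → E i (suc i)
      base        : E 0 N
      noncrossing : ∀ {i k j l} → i < k → k < j → j < l → l ≤ N → E i j → ¬ E k l
      -- The third vertex of the cell of i j on the side away from 0 N. This is the only place where
      -- maximality of the family of diagonals is recorded.
      apex        : ∀ {i j} → suc i < j → j ≤ N → E i j →
                    ∃[ m ] i < m × m < j × E i m × E m j

  Window-resp : ∀ {N} {E E′ : ℕ → ℕ → Set} →
                (∀ {i j} → E i j → E′ i j) → (∀ {i j} → E′ i j → E i j) →
                Window N E → Window N E′
  Window-resp to from W = record
    { sides       = λ i<N → to (sides i<N)
    ; base        = to base
    ; noncrossing = λ i<k k<j j<l l≤N e f → noncrossing i<k k<j j<l l≤N (from e) (from f)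
    ; apex        = λ 1+i<j j≤N e → let m , i<m , m<j , f , g = apex 1+i<j j≤N (from e)
                                    in m , i<m , m<j , to f , to g
    }
    where open Window W

  module Counts (N : ℕ) {E : ℕ → ℕ → Set} (E? : ∀ i j → Dec (E i j)) where

    -- The side 0 N counts as a chord.
    chord? : ∀ i j → Dec (suc i < j × E i j)
    chord? i j = (suc i <? j) ×-dec E? i j

    chord : ℕ → ℕ → ℕ
    chord i j = 𝟙 (chord? i j)

    left right : ℕ → ℕ
    left  u = ∑ (suc N) (λ a → chord a u)
    right u = ∑ (suc N) (λ b → chord u b)

    chord-≤ : ∀ {i j} → j ≤ suc i → chord i j ≡ 0
    chord-≤ {i} {j} j≤1+i = 𝟙-no (chord? i j) (λ { (1+i<j , _) → <⇒≱ 1+i<j j≤1+i })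

    left-≤1 : ∀ {u} → u ≤ 1 → left u ≡ 0
    left-≤1 u≤1 = ∑-zero (suc N) (λ a _ → chord-≤ (≤-trans u≤1 (s≤s z≤n)))

  module Cuts {N : ℕ} {E : ℕ → ℕ → Set} (E? : ∀ i j → Dec (E i j)) (W : Window N E) where

    open Window W
    open Counts N E?

    private
      ℓ? : ∀ i j a → Dec (i ≤ a × suc a < j × E a j)
      ℓ? i j a = (i ≤? a) ×-dec chord? a j

      r? : ∀ i j b → Dec (b ≤ j × suc i < b × E i b)
      r? i j b = (b ≤? j) ×-dec chord? i b

    -- The indices l and r of `Cut` for an edge i j: the chords at j and at i inside the polygon cut
    -- off, i j included, are as many as the cells there.
    leftWithin rightWithin : ℕ → ℕ → ℕ
    leftWithin  i j = ∑ (suc N) (𝟙 ∘ ℓ? i j)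
    rightWithin i j = ∑ (suc N) (𝟙 ∘ r? i j)

    module _ {i m j : ℕ} (i<m : i < m) (m<j : m < j) (j≤N : j ≤ N)
             (eij : E i j) (eim : E i m) (emj : E m j) where

      -- Apart from i j, a chord that ends at j and starts before m would cross i m.
      leftWithin-apex : leftWithin i j ≡ suc (leftWithin m j)
      leftWithin-apex = trans
        (∑-cong (suc N) (λ a _ → 𝟙-⊎ (split a) (λ { refl → ≤-refl , <-≤-trans (s<s i<m) m<j , eij })
          (λ { (m≤a , c) → ≤-trans (<⇒≤ i<m) m≤a , c })
          (λ { refl (m≤i , _) → <⇒≱ i<m m≤i }) (ℓ? i j a) (a ≟ i) (ℓ? m j a)))
        (trans (∑-+ (suc N) (λ a → 𝟙 (a ≟ i)) _)
               (cong (_+ leftWithin m j) (∑-𝟙-≡ (suc N)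
                 (≤-trans i<m (<⇒≤ (<-≤-trans m<j (≤-trans j≤N (n≤1+n N))))))))
        where
        split : ∀ a → i ≤ a × suc a < j × E a j → a ≡ i ⊎ (m ≤ a × suc a < j × E a j)
        split a (i≤a , c@(_ , eaj)) with m≤n⇒m<n∨m≡n i≤a | ≤-<-connex m a
        ... | inj₂ refl | _        = inj₁ refl
        ... | inj₁ _    | inj₁ m≤a = inj₂ (m≤a , c)
        ... | inj₁ i<a  | inj₂ a<m = contradiction eaj (noncrossing i<a a<m m<j j≤N eim)

      rightWithin-apex : rightWithin i j ≡ suc (rightWithin i m)
      rightWithin-apex = trans
        (∑-cong (suc N) (λ b _ → 𝟙-⊎ (split b) (λ { refl → ≤-refl , <-≤-trans (s<s i<m) m<j , eij })
          (λ { (b≤m , c) → ≤-trans b≤m (<⇒≤ m<j) , c })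
          (λ { refl (j≤m , _) → <⇒≱ m<j j≤m }) (r? i j b) (b ≟ j) (r? i m b)))
        (trans (∑-+ (suc N) (λ b → 𝟙 (b ≟ j)) _)
               (cong (_+ rightWithin i m) (∑-𝟙-≡ (suc N) (s≤s j≤N))))
        where
        split : ∀ b → b ≤ j × suc i < b × E i b → b ≡ j ⊎ (b ≤ m × suc i < b × E i b)
        split b (b≤j , c@(_ , eib)) with m≤n⇒m<n∨m≡n b≤j | ≤-<-connex b m
        ... | inj₂ refl | _        = inj₁ refl
        ... | inj₁ _    | inj₁ b≤m = inj₂ (b≤m , c)
        ... | inj₁ b<j  | inj₂ m<b = contradiction emj (noncrossing i<m m<b b<j j≤N eib)

      -- A chord reaching m from before i would cross i j, so at an apex the chords counted within
      -- i, ..., m are all chords to the left of m. This is why the index of `Cut` at m depends on m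
      -- alone.
      left-apex : leftWithin i m ≡ left m
      left-apex = ∑-cong (suc N) λ a _ → 𝟙-cong proj₂ (λ c → within (proj₂ c) , c) (ℓ? i m a) (chord? a m)
        where
        within : ∀ {a} → E a m → i ≤ a
        within {a} eam with ≤-<-connex i a
        ... | inj₁ i≤a = i≤a
        ... | inj₂ a<i = contradiction eij (noncrossing a<i i<m m<j j≤N eam)

      right-apex : rightWithin m j ≡ right m
      right-apex = ∑-cong (suc N)
        λ b b≤N → 𝟙-cong proj₂ (λ c → within (≤-pred b≤N) (proj₂ c) , c) (r? m j b) (chord? m b)
        where
        within : ∀ {b} → b ≤ N → E m b → b ≤ j
        within {b} b≤N emb with ≤-<-connex b j
        ... | inj₁ b≤j = b≤j
        ... | inj₂ j<b = contradiction emb (noncrossing i<m m<j j<b b≤N eij)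

    -- The fuel s bounds j - i, which is smaller for both polygons split off at the apex.
    cut-fuel : ∀ s {i j} → j ≤ s + i → i < j → j ≤ N → E i j →
               Cut E left right i j (leftWithin i j) (rightWithin i j)
    cut-fuel zero    j≤i i<j _ _ = contradiction j≤i (<⇒≱ i<j)
    cut-fuel (suc s) {i} {j} j≤s+i i<j j≤N eij with m≤n⇒m<n∨m≡n i<j
    ... | inj₂ refl = subst₂ (Cut E left right i (suc i))
      (sym (∑-zero (suc N) (λ a _ → 𝟙-no (ℓ? i j a) λ { (i≤a , a<i , _) → <⇒≱ (≤-pred a<i) i≤a })))
      (sym (∑-zero (suc N) (λ b _ → 𝟙-no (r? i j b) λ { (b≤j , j<b , _) → <⇒≱ j<b b≤j })))
      (side eij)
    ... | inj₁ 1+i<j with apex 1+i<j j≤N eij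
    ...   | m , i<m , m<j , eim , emj = subst₂ (Cut E left right i j)
      (sym (leftWithin-apex i<m m<j j≤N eij eim emj))
      (sym (rightWithin-apex i<m m<j j≤N eij eim emj))
      (node eij
        (subst (λ l → Cut E left right i m l (rightWithin i m)) (left-apex i<m m<j j≤N eij eim emj)
          (cut-fuel s (≤-pred (≤-trans m<j j≤s+i)) i<m (≤-trans (<⇒≤ m<j) j≤N) eim))
        (subst (Cut E left right m j (leftWithin m j)) (right-apex i<m m<j j≤N eij eim emj)
          (cut-fuel s (≤-trans j≤s+i (≤-trans (≤-reflexive (sym (+-suc s i))) (+-monoʳ-≤ s i<m)))
                    m<j j≤N emj)))

    cut : 0 < N → Cut E left right 0 N (left N) (right 0)
    cut 0<N = subst₂ (Cut E left right 0 N)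
      (∑-cong (suc N) (λ a _ → 𝟙-cong proj₂ (z≤n ,_) (ℓ? 0 N a) (chord? a N)))
      (∑-cong (suc N) (λ b b≤N → 𝟙-cong proj₂ (≤-pred b≤N ,_) (r? 0 N b) (chord? 0 b)))
      (cut-fuel N (m≤m+n N 0) 0<N ≤-refl base)

    -- The cell on the side of a b facing 0 N; its third vertex lies before a or beyond b.
    Outer : ℕ → ℕ → Set
    Outer a b = ∃[ m ] m ≤ N × ((m < a × E m a × E m b) ⊎ (b < m × E a m × E b m))

    -- Descending the tree towards a b, the node just above a b is the cell sought. An edge that
    -- straddles the apex m would cross i m or m j unless it is i j itself, so the descent never
    -- fails.
    outer-Cut : ∀ {i j l r} → Cut E left right i j l r → j ≤ N →
                ∀ {a b} → i ≤ a → a < b → b ≤ j → E a b → (a ≡ i × b ≡ j) ⊎ Outer a b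
    outer-Cut (side _) _ i≤a a<b b≤1+i _ =
      inj₁ ( ≤-antisym (≤-pred (≤-trans a<b b≤1+i)) i≤a
           , ≤-antisym b≤1+i (≤-trans (s≤s i≤a) a<b))
    outer-Cut (node {i} {m} {j} e C D) j≤N {a} {b} i≤a a<b b≤j eab
      with ≤-<-connex b m | ≤-<-connex m a
    ... | inj₁ b≤m | _ with outer-Cut C (≤-trans (<⇒≤ (Cut-< D)) j≤N) i≤a a<b b≤m eab
    ...   | inj₁ (refl , refl) = inj₂ (j , j≤N , inj₂ (Cut-< D , e , Cut-edge D))
    ...   | inj₂ o = inj₂ o
    outer-Cut (node {i} {m} {j} e C D) j≤N {a} {b} i≤a a<b b≤j eab
        | inj₂ _ | inj₁ m≤a with outer-Cut D j≤N m≤a a<b b≤j eab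
    ...   | inj₁ (refl , refl) =
      inj₂ (i , ≤-trans (<⇒≤ (<-trans (Cut-< C) (Cut-< D))) j≤N , inj₁ (Cut-< C , Cut-edge C , e))
    ...   | inj₂ o = inj₂ o
    outer-Cut (node {i} {m} {j} e C D) j≤N {a} {b} i≤a a<b b≤j eab
        | inj₂ m<b | inj₂ a<m with m≤n⇒m<n∨m≡n i≤a | m≤n⇒m<n∨m≡n b≤j
    ...   | inj₁ i<a  | _ =
      contradiction eab (noncrossing i<a a<m m<b (≤-trans b≤j j≤N) (Cut-edge C))
    ...   | inj₂ refl | inj₁ b<j = contradiction (Cut-edge D) (noncrossing (Cut-< C) m<b b<j j≤N eab)
    ...   | inj₂ refl | inj₂ refl = inj₁ (refl , refl)

    outer : ∀ {a b} → a < b → b ≤ N → E a b → (a ≡ 0 × b ≡ N) ⊎ Outer a b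
    outer a<b b≤N = outer-Cut (cut (<-≤-trans (≤-<-trans z≤n a<b) b≤N)) ≤-refl z≤n a<b b≤N

  module Rotation {A : Set} {Adj : A → A → Set} (Adj-sym : Symmetric Adj)
                  (Adj? : ∀ x y → Dec (Adj x y)) {N : ℕ} (0<N : 0 < N) where

    -- Vertex 0 becomes the last one, so the edges to the new last vertex are the old edges from 0,
    -- reversed. Such an edge needs a cell away from the new base, and that is the cell on its old
    -- outer side, supplied by `outer`.
    rotate : (v : ℕ → A) → v (suc N) ≡ v 0 → Window N (Adj on v) → Window N (Adj on (v ∘ suc))
    rotate v v≡ W = record
      { sides       = λ i<N → sides′ i<N
      ; base        = wrap (sides 0<N)
      ; noncrossing = noncrossing′
      ; apex        = apex′
      }
      where
      open Window W
      open Cuts (λ i j → Adj? (v i) (v j)) W using (outer)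
      wrap : ∀ {i} → Adj (v 0) (v i) → Adj (v i) (v (suc N))
      wrap {i} e = subst (Adj (v i)) (sym v≡) (Adj-sym e)
      unwrap : ∀ {i} → Adj (v i) (v (suc N)) → Adj (v 0) (v i)
      unwrap {i} e = Adj-sym (subst (Adj (v i)) v≡ e)
      sides′ : ∀ {i} → i < N → Adj (v (suc i)) (v (suc (suc i)))
      sides′ i<N with m≤n⇒m<n∨m≡n i<N
      ... | inj₁ 1+i<N = sides 1+i<N
      ... | inj₂ refl  = wrap base
      noncrossing′ : ∀ {i k j l} → i < k → k < j → j < l → l ≤ N →
                     Adj (v (suc i)) (v (suc j)) → ¬ Adj (v (suc k)) (v (suc l))
      noncrossing′ i<k k<j j<l l≤N e f with m≤n⇒m<n∨m≡n l≤N
      ... | inj₁ l<N  = noncrossing (s<s i<k) (s<s k<j) (s<s j<l) l<N e f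
      ... | inj₂ refl = noncrossing z<s (s<s i<k) (s<s k<j) j<l (unwrap f) e
      apex′ : ∀ {i j} → suc i < j → j ≤ N → Adj (v (suc i)) (v (suc j)) →
              ∃[ m ] i < m × m < j × Adj (v (suc i)) (v (suc m)) × Adj (v (suc m)) (v (suc j))
      apex′ {i} {j} 1+i<j j≤N e with m≤n⇒m<n∨m≡n j≤N
      ... | inj₁ j<N with apex (s<s 1+i<j) j<N e
      ...   | suc m , s≤s i<m , s≤s m<j , f , g = m , i<m , m<j , f , g
      apex′ {i} {j} 1+i<j j≤N e | inj₂ refl with outer z<s (<⇒≤ 1+i<j) (unwrap e)
      -- The old base 0 N, which has no outer cell, is now a side between neighbouring positions.
      ...   | inj₁ (_ , 1+i≡N) = contradiction 1+i<j (<-irrefl 1+i≡N)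
      ...   | inj₂ (suc m , 1+m≤N , inj₂ (s≤s i<m , f , g)) = m , i<m , 1+m≤N , g , wrap f

    rotate-by : ∀ r (v : ℕ → A) → (∀ i → v (suc N + i) ≡ v i) → Window N (Adj on v) →
                Window N (Adj on (λ i → v (r + i)))
    rotate-by zero    v _        W = W
    rotate-by (suc r) v periodic W = rotate-by r (v ∘ suc)
      (λ i → trans (cong v (sym (+-suc (suc N) i))) (periodic (suc i)))
      (rotate v (trans (cong v (cong suc (sym (+-identityʳ N)))) (periodic 0)) W)

-- Maximal non-crossing families: every non-side edge, and the base, bounds a cell away from the
-- base.

module Fullness where

  open import Data.Nat.Base using (ℕ; zero; suc; _+_; _≤_; _<_; z≤n; s≤s)
  open import Data.Nat.Properties
  open import Data.Product.Base using (_×_; _,_; proj₁; proj₂; ∃-syntax)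
  open import Data.Sum.Base using (_⊎_; inj₁; inj₂)
  open import Function.Base using (_∘_)
  open import Relation.Binary.PropositionalEquality
    using (_≡_; refl; sym; trans; cong; subst₂; module ≡-Reasoning)
  open import Relation.Nullary using (Dec; yes; no; ¬_; contradiction)
  open import Relation.Nullary.Decidable using (_×-dec_; _⊎-dec_)
  open Sums
  open Windows using (Window; module Counts)

  ∑∑-𝟙-≡ : ∀ {m n i j} → i < m → j < n →
            ∑ m (λ a → ∑ n (λ b → 𝟙 ((a ≟ i) ×-dec (b ≟ j)))) ≡ 1
  ∑∑-𝟙-≡ {m} {n} {i} {j} i<m j<n = trans
    (∑-single m (λ a → ∑ n (λ b → 𝟙 ((a ≟ i) ×-dec (b ≟ j)))) i<m
      (λ a _ a≢i → ∑-zero n (λ b _ → 𝟙-no ((a ≟ i) ×-dec (b ≟ j)) (a≢i ∘ proj₁))))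
    (trans (∑-cong n (λ b _ → 𝟙-cong proj₂ (refl ,_) ((i ≟ i) ×-dec (b ≟ j)) (b ≟ j))) (∑-𝟙-≡ n j<n))

  greatest : ∀ {p} {P : ℕ → Set p} (P? : ∀ x → Dec (P x)) {lo} hi → lo < hi → P lo →
             ∃[ m ] lo ≤ m × m < hi × P m × (∀ x → m < x → x < hi → ¬ P x)
  greatest P? {lo} (suc h) lo<1+h p with P? h
  ... | yes q = h , ≤-pred lo<1+h , n<1+n h , q , λ x h<x x<1+h → contradiction (≤-pred x<1+h) (<⇒≱ h<x)
  ... | no ¬q with m≤n⇒m<n∨m≡n (≤-pred lo<1+h)
  ...   | inj₂ refl = contradiction p ¬q
  ...   | inj₁ lo<h with greatest P? h lo<h p
  ...     | m , lo≤m , m<h , pm , max = m , lo≤m , m<n⇒m<1+n m<h , pm , max′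
    where
    max′ : ∀ x → m < x → x < suc h → ¬ _
    max′ x m<x x<1+h with m≤n⇒m<n∨m≡n (≤-pred x<1+h)
    ... | inj₁ x<h  = max x m<x x<h
    ... | inj₂ refl = ¬q

  -- Non-crossing chords inside the polygon with vertices i, …, j, the chord i j
  -- included, number at most j - i - 1, with equality only if i j is a chord
  -- and its cell splits the others into two families again attaining the bound.
  module FullIntervals {N : ℕ} {E : ℕ → ℕ → Set} (E? : ∀ i j → Dec (E i j))
    (sides : ∀ {i} → i < N → E i (suc i))
    (noncrossing : ∀ {i k j l} → i < k → k < j → j < l → l ≤ N → E i j → ¬ E k l) where

    open Counts N E? using (chord?)

    inside? : ∀ i j a b → Dec ((i ≤ a × b ≤ j) × suc a < b × E a b)
    inside? i j a b = ((i ≤? a) ×-dec (b ≤? j)) ×-dec chord? a b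

    count : ℕ → ℕ → ℕ
    count i j = ∑ (suc N) (λ a → ∑ (suc N) (λ b → 𝟙 (inside? i j a b)))

    -- Equality in `count-bound`, expressed by the inequality that can fail.
    Full : ℕ → ℕ → Set
    Full i j = j ≤ suc i + count i j

    module _ {i m j : ℕ} (i<m : i < m) (m<j : m < j) (j≤N : j ≤ N)
             (eim : E i m) (max : ∀ x → m < x → x < j → ¬ E i x) where

      private
        split : ∀ {a b} → (i ≤ a × b ≤ j) × suc a < b × E a b →
                ((a ≡ i × b ≡ j) × E i j) ⊎
                ((i ≤ a × b ≤ m) × suc a < b × E a b) ⊎ ((m ≤ a × b ≤ j) × suc a < b × E a b)
        split {a} {b} ((i≤a , b≤j) , c@(1+a<b , eab)) with ≤-<-connex b m | ≤-<-connex m a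
        ... | inj₁ b≤m | _ = inj₂ (inj₁ ((i≤a , b≤m) , c))
        ... | inj₂ _   | inj₁ m≤a = inj₂ (inj₂ ((m≤a , b≤j) , c))
        ... | inj₂ m<b | inj₂ a<m with m≤n⇒m<n∨m≡n i≤a | m≤n⇒m<n∨m≡n b≤j
        ...   | inj₁ i<a  | _ = contradiction eab (noncrossing i<a a<m m<b (≤-trans b≤j j≤N) eim)
        ...   | inj₂ refl | inj₁ b<j = contradiction eab (max b m<b b<j)
        ...   | inj₂ refl | inj₂ refl = inj₁ ((refl , refl) , eab)

        base? : ∀ a b → Dec ((a ≡ i × b ≡ j) × E i j)
        base? a b = ((a ≟ i) ×-dec (b ≟ j)) ×-dec E? i j

        i<1+N : i < suc N
        i<1+N = ≤-trans (<-trans i<m m<j) (m≤n⇒m≤1+n j≤N)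

        ∑base : ∑ (suc N) (λ a → ∑ (suc N) (λ b → 𝟙 (base? a b))) ≤ 𝟙 (E? i j)
        ∑base with E? i j
        ... | yes e = ≤-trans (∑-mono (suc N) (λ a _ → ∑-mono (suc N)
          (λ b _ → 𝟙-mono proj₁ (((a ≟ i) ×-dec (b ≟ j)) ×-dec yes e) ((a ≟ i) ×-dec (b ≟ j)))))
          (≤-reflexive (∑∑-𝟙-≡ i<1+N (s≤s j≤N)))
        ... | no ¬e = ≤-reflexive (∑-zero (suc N) (λ a _ → ∑-zero (suc N)
          (λ b _ → 𝟙-no (((a ≟ i) ×-dec (b ≟ j)) ×-dec no ¬e) (¬e ∘ proj₂))))

      -- Here m is the last neighbour of i before j. A chord straddling m would cross i m if it
      -- started after i, and would contradict the choice of m if it led from i to a vertex before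
      -- j; only i j remains.
      count-split : count i j ≤ 𝟙 (E? i j) + (count i m + count m j)
      count-split = ≤-trans
        (∑-mono (suc N) (λ a _ → ∑-mono (suc N)
          {g = λ b → B a b + (I a b + J a b)} (λ b _ → pointwise a b)))
        (≤-trans (≤-reflexive (begin
          ∑ (suc N) (λ a → ∑ (suc N) (λ b → B a b + (I a b + J a b)))
            ≡⟨ ∑-cong (suc N) (λ a _ → ∑-+ (suc N) (B a) (λ b → I a b + J a b)) ⟩
          ∑ (suc N) (λ a → ∑ (suc N) (B a) + ∑ (suc N) (λ b → I a b + J a b))
            ≡⟨ ∑-cong (suc N) (λ a _ → cong (∑ (suc N) (B a) +_) (∑-+ (suc N) (I a) (J a))) ⟩
          ∑ (suc N) (λ a → ∑ (suc N) (B a) + (∑ (suc N) (I a) + ∑ (suc N) (J a)))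
            ≡⟨ ∑-+ (suc N) (λ a → ∑ (suc N) (B a)) _ ⟩
          ∑ (suc N) (λ a → ∑ (suc N) (B a)) + ∑ (suc N) (λ a → ∑ (suc N) (I a) + ∑ (suc N) (J a))
            ≡⟨ cong (∑ (suc N) (λ a → ∑ (suc N) (B a)) +_) (∑-+ (suc N) (λ a → ∑ (suc N) (I a)) _) ⟩
          ∑ (suc N) (λ a → ∑ (suc N) (B a)) + (count i m + count m j) ∎))
        (+-monoˡ-≤ _ ∑base))
        where
        open ≡-Reasoning
        B I J : ℕ → ℕ → ℕ
        B a b = 𝟙 (base? a b)
        I a b = 𝟙 (inside? i m a b)
        J a b = 𝟙 (inside? m j a b)
        pointwise : ∀ a b → 𝟙 (inside? i j a b) ≤ B a b + (I a b + J a b)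
        pointwise a b = ≤-trans
          (𝟙-⊎-≤ split (inside? i j a b) (base? a b) (inside? i m a b ⊎-dec inside? m j a b))
          (+-monoʳ-≤ (B a b)
            (𝟙-⊎-≤ (λ p → p) (inside? i m a b ⊎-dec inside? m j a b)
                    (inside? i m a b) (inside? m j a b)))

    lastNeighbour : ∀ {i j} → suc i < j → j ≤ N →
      ∃[ m ] i < m × m < j × E i m × (∀ x → m < x → x < j → ¬ E i x)
    lastNeighbour {i} {j} 1+i<j j≤N =
      greatest (E? i) j 1+i<j (sides (≤-trans (n≤1+n _) (<-≤-trans 1+i<j j≤N)))

    count-bound-fuel : ∀ s {i j} → j ≤ s + i → i < j → j ≤ N → suc i + count i j ≤ j
    count-bound-fuel zero    j≤i i<j _ = contradiction j≤i (<⇒≱ i<j)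
    count-bound-fuel (suc s) {i} {j} j≤s+i i<j j≤N with m≤n⇒m<n∨m≡n i<j
    ... | inj₂ refl = ≤-reflexive (trans (cong (suc i +_) (∑-zero (suc N) (λ a _ → ∑-zero (suc N)
      (λ b _ → 𝟙-no (inside? i j a b) λ { ((i≤a , b≤j) , 1+a<b , _) →
        <⇒≱ (≤-trans 1+a<b b≤j) (s≤s i≤a) })))) (+-identityʳ _))
    ... | inj₁ 1+i<j with lastNeighbour 1+i<j j≤N
    ...   | m , i<m , m<j , eim , max = begin
      suc i + count i j
        ≤⟨ +-monoʳ-≤ (suc i) (≤-trans (count-split i<m m<j j≤N eim max)
             (+-monoˡ-≤ _ (𝟙-≤1 (E? i j)))) ⟩
      suc i + suc (count i m + count m j)
        ≡⟨ +-suc (suc i) _ ⟩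
      suc (suc i + (count i m + count m j))
        ≡⟨ cong suc (+-assoc (suc i) (count i m) (count m j)) ⟨
      suc (suc i + count i m + count m j)
        ≤⟨ s≤s (+-monoˡ-≤ (count m j)
             (count-bound-fuel s (≤-pred (≤-trans m<j j≤s+i)) i<m (≤-trans (<⇒≤ m<j) j≤N))) ⟩
      suc m + count m j
        ≤⟨ count-bound-fuel s (≤-trans j≤s+i (≤-trans (≤-reflexive (sym (+-suc s i))) (+-monoʳ-≤ s i<m)))
             m<j j≤N ⟩
      j ∎
      where open ≤-Reasoning

    count-bound : ∀ {i j} → i < j → j ≤ N → suc i + count i j ≤ j
    count-bound {i} {j} = count-bound-fuel j (m≤m+n j i)

    -- Without the chord i j the bounds for the two parts add up to (m - i - 1) + (j - m - 1), one
    -- short of fullness.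
    full-edge : ∀ {i j} → i < j → j ≤ N → Full i j → E i j
    full-edge {i} {j} i<j j≤N full with m≤n⇒m<n∨m≡n i<j
    ... | inj₂ refl = sides j≤N
    ... | inj₁ 1+i<j with lastNeighbour 1+i<j j≤N
    ...   | m , i<m , m<j , eim , max with E? i j | count-split i<m m<j j≤N eim max
    ...     | yes e | _ = e
    ...     | no _  | c≤ = contradiction ≤-refl (<⇒≱ (begin-strict
      j                                  ≤⟨ full ⟩
      suc i + count i j                  ≤⟨ +-monoʳ-≤ (suc i) c≤ ⟩
      suc i + (count i m + count m j)    ≡⟨ +-assoc (suc i) (count i m) (count m j) ⟨
      suc i + count i m + count m j      ≤⟨ +-monoˡ-≤ (count m j)
                                              (count-bound i<m (≤-trans (<⇒≤ m<j) j≤N)) ⟩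
      m + count m j                      <⟨ count-bound m<j j≤N ⟩
      j                                  ∎))
      where open ≤-Reasoning

    -- The bounds for the two parts and 1 for i j add up to exactly j - i - 1, so fullness leaves no
    -- slack in either part.
    full-split : ∀ {i j} → suc i < j → j ≤ N → Full i j →
                 ∃[ m ] i < m × m < j × Full i m × Full m j
    full-split {i} {j} 1+i<j j≤N full with lastNeighbour 1+i<j j≤N
    ... | m , i<m , m<j , eim , max = m , i<m , m<j , full-im , full-mj
      where
      open ≤-Reasoning
      full′ : j ≤ suc (suc i + count i m + count m j)
      full′ = begin
        j                                      ≤⟨ full ⟩
        suc i + count i j
          ≤⟨ +-monoʳ-≤ (suc i) (≤-trans (count-split i<m m<j j≤N eim max)
               (+-monoˡ-≤ _ (𝟙-≤1 (E? i j)))) ⟩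
        suc i + suc (count i m + count m j)    ≡⟨ +-suc (suc i) _ ⟩
        suc (suc i + (count i m + count m j))  ≡⟨ cong suc (+-assoc (suc i) (count i m) (count m j)) ⟨
        suc (suc i + count i m + count m j)    ∎
      full-im : Full i m
      full-im = +-cancelʳ-≤ (suc (count m j)) _ _ (begin
        m + suc (count m j)                    ≡⟨ +-suc m _ ⟩
        suc m + count m j                      ≤⟨ count-bound m<j j≤N ⟩
        j                                      ≤⟨ full′ ⟩
        suc (suc i + count i m + count m j)    ≡⟨ +-suc (suc i + count i m) (count m j) ⟨
        suc i + count i m + suc (count m j)    ∎)
      full-mj : Full m j
      full-mj = ≤-trans full′ (s≤s (+-monoˡ-≤ (count m j) (count-bound i<m (≤-trans (<⇒≤ m<j) j≤N))))

    -- Makes `full-split` applicable to every edge, which yields its apex. On descending through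
    -- full parts, an edge straddling m and different from i j would cross i m or m j, both of which
    -- are edges by `full-edge`.
    full-sub : ∀ s {i j} → j ≤ s + i → i < j → j ≤ N → Full i j →
               ∀ {a b} → i ≤ a → a < b → b ≤ j → E a b → Full a b
    full-sub zero    j≤i i<j _ _ _ _ _ _ = contradiction j≤i (<⇒≱ i<j)
    full-sub (suc s) {i} {j} j≤s+i i<j j≤N full {a} {b} i≤a a<b b≤j eab with m≤n⇒m<n∨m≡n i<j
    ... | inj₂ refl = subst₂ Full
      (≤-antisym i≤a (≤-pred (≤-trans a<b b≤j))) (≤-antisym (≤-trans (s≤s i≤a) a<b) b≤j) full
    ... | inj₁ 1+i<j with full-split 1+i<j j≤N full
    ...   | m , i<m , m<j , full-im , full-mj with ≤-<-connex b m | ≤-<-connex m a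
    ...     | inj₁ b≤m | _ =
      full-sub s (≤-pred (≤-trans m<j j≤s+i)) i<m (≤-trans (<⇒≤ m<j) j≤N) full-im i≤a a<b b≤m eab
    ...     | inj₂ _   | inj₁ m≤a =
      full-sub s (≤-trans j≤s+i (≤-trans (≤-reflexive (sym (+-suc s i))) (+-monoʳ-≤ s i<m)))
        m<j j≤N full-mj m≤a a<b b≤j eab
    ...     | inj₂ m<b | inj₂ a<m with m≤n⇒m<n∨m≡n i≤a | m≤n⇒m<n∨m≡n b≤j
    ...       | inj₂ refl | inj₂ refl = full
    ...       | inj₁ i<a  | _ = contradiction eab (noncrossing i<a a<m m<b (≤-trans b≤j j≤N)
      (full-edge i<m (≤-trans (<⇒≤ m<j) j≤N) full-im))
    ...       | inj₂ refl | inj₁ b<j =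
      contradiction (full-edge m<j j≤N full-mj) (noncrossing i<m m<b b<j j≤N eab)

    full-Window : 0 < N → Full 0 N → Window N E
    full-Window 0<N full = record
      { sides = sides ; base = full-edge 0<N ≤-refl full ; noncrossing = noncrossing ; apex = apex }
      where
      apex : ∀ {i j} → suc i < j → j ≤ N → E i j → ∃[ m ] i < m × m < j × E i m × E m j
      apex {i} {j} 1+i<j j≤N eij
        with full-split 1+i<j j≤N (full-sub N (≤-reflexive (sym (+-identityʳ N))) 0<N ≤-refl full
                                    z≤n (<⇒≤ 1+i<j) j≤N eij)
      ... | m , i<m , m<j , full-im , full-mj =
        m , i<m , m<j , full-edge i<m (≤-trans (<⇒≤ m<j) j≤N) full-im , full-edge m<j j≤N full-mj

-- Cells at a vertex counted through the edges at it.

module Cells where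

  open import Data.Nat.Base using (ℕ; suc; _+_; _≤_; _<_; s≤s; z<s; s<s)
  open import Data.Nat.Properties
  open import Data.Product.Base using (_×_; _,_; proj₂; ∃-syntax)
  open import Data.Sum.Base using (_⊎_; inj₁; inj₂)
  open import Function.Base using (_∘_; id)
  open import Relation.Binary.Definitions using (Symmetric; tri<; tri≈; tri>)
  open import Relation.Binary.PropositionalEquality
    using (_≡_; _≢_; refl; sym; trans; cong; cong₂; module ≡-Reasoning)
  open import Relation.Nullary using (Dec; yes; no; ¬_; contradiction)
  open import Relation.Nullary.Decidable using (_×-dec_; _⊎-dec_)
  open Sums
  open Windows using (Window; module Counts; module Cuts)

  module CellCount {N : ℕ} {E : ℕ → ℕ → Set} (E? : ∀ i j → Dec (E i j)) (W : Window N E) (0<N : 0 < N)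
               (E-sym : Symmetric E) (E-irrefl : ∀ {i} → i ≤ N → ¬ E i i) where

    open Window W
    open Cuts E? W using (outer)

    Cell : ℕ → ℕ → ℕ → Set
    Cell i j k = (i < j × j < k) × E i j × E j k × E i k

    Cell? : ∀ i j k → Dec (Cell i j k)
    Cell? i j k = ((i <? j) ×-dec (j <? k)) ×-dec (E? i j ×-dec (E? j k ×-dec E? i k))

    HasVertexℕ : ℕ → ℕ → ℕ → ℕ → Set
    HasVertexℕ u i j k = u ≡ i ⊎ u ≡ j ⊎ u ≡ k

    private
      n = suc N

      ∑³ : (ℕ → ℕ → ℕ → ℕ) → ℕ
      ∑³ f = ∑ n λ i → ∑ n λ j → ∑ n λ k → f i j k

      ∑³-+ : ∀ f g → ∑³ (λ i j k → f i j k + g i j k) ≡ ∑³ f + ∑³ g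
      ∑³-+ f g = trans
        (∑-cong n (λ i _ → trans (∑-cong n (λ j _ → ∑-+ n (f i j) (g i j)))
                                 (∑-+ n (λ j → ∑ n (f i j)) _)))
        (∑-+ n (λ i → ∑ n λ j → ∑ n (f i j)) _)

    module _ {u : ℕ} (u≤N : u ≤ N) where

      vertexCell? : ∀ i j k → Dec (HasVertexℕ u i j k × Cell i j k)
      vertexCell? i j k = ((u ≟ i) ⊎-dec ((u ≟ j) ⊎-dec (u ≟ k))) ×-dec Cell? i j k

      private
        -- Cells with vertices u, m and w in which w comes after m when the vertices are passed
        -- clockwise from u, so that u w is the last edge at u. The three cases are u being
        -- smallest, middle or largest in the numbering.
        first second third : ℕ → ℕ → ℕ
        first  w m = 𝟙 (Cell? u m w)
        second w m = 𝟙 (Cell? w u m)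
        third  w m = 𝟙 (Cell? m w u)

        first? second? third? : ∀ i j k → Dec _
        first?  i j k = (u ≟ i) ×-dec Cell? i j k
        second? i j k = (u ≟ j) ×-dec Cell? i j k
        third?  i j k = (u ≟ k) ×-dec Cell? i j k

        pointwise : ∀ i j k →
          𝟙 (vertexCell? i j k) ≡ 𝟙 (first? i j k) + (𝟙 (second? i j k) + 𝟙 (third? i j k))
        pointwise i j k = trans
          (𝟙-⊎ (λ { (inj₁ p , c) → inj₁ (p , c)
                  ; (inj₂ (inj₁ p) , c) → inj₂ (inj₁ (p , c))
                  ; (inj₂ (inj₂ p) , c) → inj₂ (inj₂ (p , c)) })
                (λ { (p , c) → inj₁ p , c })
                (λ { (inj₁ (p , c)) → inj₂ (inj₁ p) , c ; (inj₂ (p , c)) → inj₂ (inj₂ p) , c })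
                (λ { (refl , (i<j , j<k) , _) (inj₁ (refl , _)) → <-irrefl refl i<j
                   ; (refl , (i<j , j<k) , _) (inj₂ (refl , _)) → <-irrefl refl (<-trans i<j j<k) })
                (vertexCell? i j k) (first? i j k) (second? i j k ⊎-dec third? i j k))
          (cong (𝟙 (first? i j k) +_)
            (𝟙-⊎ id inj₁ inj₂ (λ { (refl , (_ , j<k) , _) (refl , _) → <-irrefl refl j<k })
                 (second? i j k ⊎-dec third? i j k) (second? i j k) (third? i j k)))

        select : ∀ {P : ℕ → Set} (P? : ∀ i → Dec (P i)) → ∑ n (λ i → 𝟙 ((u ≟ i) ×-dec P? i)) ≡ 𝟙 (P? u)
        select P? = trans
          (∑-single n (λ i → 𝟙 ((u ≟ i) ×-dec P? i)) (s≤s u≤N)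
            (λ i _ i≢u → 𝟙-no ((u ≟ i) ×-dec P? i) (λ { (u≡i , _) → i≢u (sym u≡i) })))
          (𝟙-cong proj₂ (refl ,_) ((u ≟ u) ×-dec P? u) (P? u))

        ∑first : ∑³ (λ i j k → 𝟙 (first? i j k)) ≡ ∑ n (λ w → ∑ n (first w))
        ∑first = begin
          ∑ n (λ i → ∑ n λ j → ∑ n λ k → 𝟙 (first? i j k))
            ≡⟨ ∑-swap n n _ ⟩
          ∑ n (λ j → ∑ n λ i → ∑ n λ k → 𝟙 (first? i j k))
            ≡⟨ ∑-cong n (λ j _ → ∑-swap n n _) ⟩
          ∑ n (λ j → ∑ n λ k → ∑ n λ i → 𝟙 (first? i j k))
            ≡⟨ ∑-cong n (λ j _ → ∑-cong n (λ k _ → select (λ i → Cell? i j k))) ⟩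
          ∑ n (λ j → ∑ n λ k → 𝟙 (Cell? u j k))
            ≡⟨ ∑-swap n n _ ⟩
          ∑ n (λ k → ∑ n λ j → 𝟙 (Cell? u j k)) ∎
          where open ≡-Reasoning

        ∑second : ∑³ (λ i j k → 𝟙 (second? i j k)) ≡ ∑ n (λ w → ∑ n (second w))
        ∑second = ∑-cong n λ i _ → trans (∑-swap n n _)
          (∑-cong n (λ k _ → select (λ j → Cell? i j k)))

        ∑third : ∑³ (λ i j k → 𝟙 (third? i j k)) ≡ ∑ n (λ w → ∑ n (third w))
        ∑third = trans (∑-cong n (λ i _ → ∑-cong n (λ j _ → select (λ k → Cell? i j k))))
          (∑-swap n n _)

        ends : ℕ → ℕ
        ends w = ∑ n (first w) + (∑ n (second w) + ∑ n (third w))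

      -- Each edge from u is the last one clockwise in exactly one cell at u,
      -- except for the side that leads clockwise from u.
      Next : ℕ → Set
      Next w = w ≡ suc u ⊎ (w ≡ 0 × u ≡ N)

      private
        Next? : ∀ w → Dec (Next w)
        Next? w = (w ≟ suc u) ⊎-dec ((w ≟ 0) ×-dec (u ≟ N))

        ∑Next : ∑ n (𝟙 ∘ Next?) ≡ 1
        ∑Next with m≤n⇒m<n∨m≡n u≤N
        ... | inj₁ u<N = ∑-𝟙-unique Next? n (s≤s u<N) (inj₁ refl)
          (λ { w _ (inj₁ p) → p ; w _ (inj₂ (_ , u≡N)) → contradiction u<N (<-irrefl u≡N) })
        ... | inj₂ refl = ∑-𝟙-unique Next? n z<s (inj₂ (refl , refl))
          (λ { w w<n (inj₁ refl) → contradiction w<n (<-irrefl refl) ; w _ (inj₂ (p , _)) → p })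

        -- For w beyond u the cell in question lies on the side of u w away from 0 N: `apex`
        -- provides it unless w = u + 1, and non-crossing makes it unique.
        above : ∀ {w} → u < w → w ≤ N → ∑ n (first w) + 𝟙 (Next? w) ≡ 𝟙 (E? u w)
        above {w} u<w w≤N = go (E? u w)
          where
          unique : ∀ {m m′} → u < m → m′ < w → E u m′ → E m w → ¬ (m < m′)
          unique u<m m′<w e e′ m<m′ = noncrossing u<m m<m′ m′<w w≤N e e′
          go : (d : Dec (E u w)) → ∑ n (first w) + 𝟙 (Next? w) ≡ 𝟙 d
          go (no ¬e) = cong₂ _+_
            (∑-zero n (λ m _ → 𝟙-no (Cell? u m w) (λ { (_ , _ , _ , e) → ¬e e })))
            (𝟙-no (Next? w) (λ { (inj₁ refl) → ¬e (sides w≤N) ; (inj₂ (refl , _)) → n≮0 u<w }))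
          go (yes e) with m≤n⇒m<n∨m≡n u<w
          ... | inj₂ refl = cong₂ _+_
            (∑-zero n (λ m _ → 𝟙-no (Cell? u m w) (λ { ((u<m , m<w) , _) → <⇒≱ u<m (≤-pred m<w) })))
            (𝟙-yes (Next? w) (inj₁ refl))
          ... | inj₁ 1+u<w with apex 1+u<w w≤N e
          ...   | m , u<m , m<w , e₁ , e₂ = cong₂ _+_
            (∑-𝟙-unique (λ m → Cell? u m w) n (≤-trans (<-≤-trans m<w w≤N) (n≤1+n N))
              ((u<m , m<w) , e₁ , e₂ , e) m-unique)
            (𝟙-no (Next? w) (λ { (inj₁ w≡1+u) → <-irrefl (sym w≡1+u) 1+u<w
                               ; (inj₂ (refl , _)) → n≮0 u<w }))
            where
            m-unique : ∀ m′ → m′ < n → Cell u m′ w → m′ ≡ m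
            m-unique m′ _ ((u<m′ , m′<w) , e₁′ , e₂′ , _) with <-cmp m′ m
            ... | tri≈ _ p _ = p
            ... | tri< m′<m _ _ = contradiction m′<m (unique u<m′ m<w e₁ e₂′)
            ... | tri> _ _ m<m′ = contradiction m<m′ (unique u<m m′<w e₁′ e₂)

        Apex : ℕ → ℕ → Set
        Apex w m = Cell w u m ⊎ Cell m w u

        Apex? : ∀ w m → Dec (Apex w m)
        Apex? w m = Cell? w u m ⊎-dec Cell? m w u

        ∑Apex : ∀ w → ∑ n (second w) + ∑ n (third w) ≡ ∑ n (𝟙 ∘ Apex? w)
        ∑Apex w = trans (sym (∑-+ n (second w) (third w)))
          (∑-cong n (λ m _ → sym (𝟙-⊎ id inj₁ inj₂
            (λ { ((w<u , u<m) , _) ((m<w , _) , _) → <-asym u<m (<-trans m<w w<u) })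
            (Apex? w m) (Cell? w u m) (Cell? m w u))))

        -- For w before u the cell lies on the outer side of w u: `outer` provides it unless w u is
        -- the base 0 N.
        below : ∀ {w} → w < u → ∑ n (second w) + ∑ n (third w) + 𝟙 (Next? w) ≡ 𝟙 (E? u w)
        below {w} w<u = trans (cong (_+ 𝟙 (Next? w)) (∑Apex w)) (go (E? u w))
          where
          next≢ : w ≢ suc u
          next≢ refl = <-asym w<u (n<1+n u)
          unique : ∀ {m m′} → m ≤ N → m′ ≤ N → Apex w m → Apex w m′ → ¬ (m < m′)
          unique _ m′≤N (inj₁ ((_ , u<m) , _ , _ , e)) (inj₁ ((_ , _) , _ , e′ , _)) m<m′ =
            noncrossing w<u u<m m<m′ m′≤N e e′
          unique _ _ (inj₁ ((_ , u<m) , _)) (inj₂ ((m′<w , _) , _)) m<m′ =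
            <-asym u<m (<-trans (<-trans m<m′ m′<w) w<u)
          unique _ m′≤N (inj₂ ((m<w , _) , _ , _ , e)) (inj₁ ((_ , u<m′) , _ , _ , e′)) m<m′ =
            noncrossing m<w w<u u<m′ m′≤N e e′
          unique _ _ (inj₂ ((m<w , _) , e , _)) (inj₂ ((m′<w , _) , _ , _ , e′)) m<m′ =
            noncrossing m<m′ m′<w w<u u≤N e e′
          go : (d : Dec (E u w)) → ∑ n (𝟙 ∘ Apex? w) + 𝟙 (Next? w) ≡ 𝟙 d
          go (no ¬e) = cong₂ _+_
            (∑-zero n (λ m _ → 𝟙-no (Apex? w m)
              (λ { (inj₁ (_ , e , _)) → ¬e (E-sym e) ; (inj₂ (_ , _ , e , _)) → ¬e (E-sym e) })))
            (𝟙-no (Next? w) (λ { (inj₁ p) → next≢ p ; (inj₂ (refl , refl)) → ¬e (E-sym base) }))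
          go (yes e) with outer w<u u≤N (E-sym e)
          ... | inj₁ (refl , refl) = cong₂ _+_
            (∑-zero n (λ m m<n → 𝟙-no (Apex? w m)
              (λ { (inj₁ ((_ , u<m) , _)) → <⇒≱ m<n u<m ; (inj₂ ((m<0 , _) , _)) → n≮0 m<0 })))
            (𝟙-yes (Next? w) (inj₂ (refl , refl)))
          ... | inj₂ (m , m≤N , o) = cong₂ _+_
            (∑-𝟙-unique (Apex? w) n (s≤s m≤N) (apex-m o) (λ m′ m′<n c → ≮⇒≡ m′<n c))
            (𝟙-no (Next? w) (λ { (inj₁ p) → next≢ p ; (inj₂ (p , q)) → not-base p q o }))
            where
            apex-m : (m < w × E m w × E m u) ⊎ (u < m × E w m × E u m) → Apex w m
            apex-m (inj₁ (m<w , e₁ , e₂)) = inj₂ ((m<w , w<u) , e₁ , E-sym e , e₂)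
            apex-m (inj₂ (u<m , e₁ , e₂)) = inj₁ ((w<u , u<m) , E-sym e , e₂ , e₁)
            ≮⇒≡ : ∀ {m′} → m′ < n → Apex w m′ → m′ ≡ m
            ≮⇒≡ {m′} m′<n c with <-cmp m′ m
            ... | tri≈ _ p _ = p
            ... | tri< m′<m _ _ = contradiction m′<m (unique (≤-pred m′<n) m≤N c (apex-m o))
            ... | tri> _ _ m<m′ = contradiction m<m′ (unique m≤N (≤-pred m′<n) (apex-m o) c)
            not-base : w ≡ 0 → u ≡ N → ¬ ((m < w × E m w × E m u) ⊎ (u < m × E w m × E u m))
            not-base refl _    (inj₁ (m<0 , _)) = n≮0 m<0
            not-base _    refl (inj₂ (u<m , _)) = <⇒≱ u<m m≤N

        ends-Next : ∀ w → w < n → ends w + 𝟙 (Next? w) ≡ 𝟙 (E? u w)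
        ends-Next w w<n with <-cmp u w
        ... | tri< u<w _ _ = trans (cong (_+ 𝟙 (Next? w)) (trans (cong (∑ n (first w) +_) (cong₂ _+_
          (∑-zero n (λ m _ → 𝟙-no (Cell? w u m) (λ { ((w<u , _) , _) → <-asym u<w w<u })))
          (∑-zero n (λ m _ → 𝟙-no (Cell? m w u) (λ { ((_ , w<u) , _) → <-asym u<w w<u })))))
          (+-identityʳ _))) (above u<w (≤-pred w<n))
        ... | tri> _ _ w<u = trans (cong (λ a → a + (∑ n (second w) + ∑ n (third w)) + 𝟙 (Next? w))
          (∑-zero n (λ m _ → 𝟙-no (Cell? u m w)
            (λ { ((u<m , m<w) , _) → <-asym w<u (<-trans u<m m<w) }))))
          (below w<u)
        ... | tri≈ _ refl _ = trans (cong₂ _+_ (cong₂ _+_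
          (∑-zero n (λ m _ → 𝟙-no (Cell? u m w) (λ { ((u<m , m<w) , _) → <-asym u<m m<w })))
          (cong₂ _+_
          (∑-zero n (λ m _ → 𝟙-no (Cell? w u m) (λ { ((w<u , _) , _) → <-irrefl refl w<u })))
          (∑-zero n (λ m _ → 𝟙-no (Cell? m w u) (λ { ((_ , w<u) , _) → <-irrefl refl w<u })))))
          (𝟙-no (Next? w) (λ { (inj₁ p) → <-irrefl p (n<1+n u) ; (inj₂ (refl , refl)) → n≮0 0<N })))
          (sym (𝟙-no (E? u w) (E-irrefl u≤N)))

      suc-cells≡degree : suc (∑³ (λ i j k → 𝟙 (vertexCell? i j k))) ≡ ∑ n (λ w → 𝟙 (E? u w))
      suc-cells≡degree = begin
        suc (∑³ (λ i j k → 𝟙 (vertexCell? i j k)))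
          ≡⟨ +-comm 1 _ ⟩
        ∑³ (λ i j k → 𝟙 (vertexCell? i j k)) + 1
          ≡⟨ cong₂ _+_ expand (sym ∑Next) ⟩
        ∑ n ends + ∑ n (𝟙 ∘ Next?)
          ≡⟨ ∑-+ n ends _ ⟨
        ∑ n (λ w → ends w + 𝟙 (Next? w))
          ≡⟨ ∑-cong n ends-Next ⟩
        ∑ n (λ w → 𝟙 (E? u w)) ∎
        where
        open ≡-Reasoning
        F S T : ℕ → ℕ → ℕ → ℕ
        F i j k = 𝟙 (first? i j k)
        S i j k = 𝟙 (second? i j k)
        T i j k = 𝟙 (third? i j k)
        expand : ∑³ (λ i j k → 𝟙 (vertexCell? i j k)) ≡ ∑ n ends
        expand = begin
          ∑³ (λ i j k → 𝟙 (vertexCell? i j k))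
            ≡⟨ ∑-cong n (λ i _ → ∑-cong n (λ j _ → ∑-cong n (λ k _ → pointwise i j k))) ⟩
          ∑³ (λ i j k → F i j k + (S i j k + T i j k))
            ≡⟨ ∑³-+ F (λ i j k → S i j k + T i j k) ⟩
          ∑³ F + ∑³ (λ i j k → S i j k + T i j k)
            ≡⟨ cong (∑³ F +_) (∑³-+ S T) ⟩
          ∑³ F + (∑³ S + ∑³ T)
            ≡⟨ cong₂ _+_ ∑first (cong₂ _+_ ∑second ∑third) ⟩
          ∑ n (λ w → ∑ n (first w)) + (∑ n (λ w → ∑ n (second w)) + ∑ n (λ w → ∑ n (third w)))
            ≡⟨ cong (∑ n (λ w → ∑ n (first w)) +_) (∑-+ n (λ w → ∑ n (second w)) _) ⟨
          ∑ n (λ w → ∑ n (first w)) + ∑ n (λ w → ∑ n (second w) + ∑ n (third w))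
            ≡⟨ ∑-+ n (λ w → ∑ n (first w)) _ ⟨
          ∑ n ends ∎

    open Counts N E? using (chord?; left; right)

    degree-split : ∀ {u} → suc u < N →
      ∑ (suc N) (λ w → 𝟙 (E? (suc u) w)) ≡ suc (suc (left (suc u) + right (suc u)))
    degree-split {u} 1+u<N = begin
      ∑ n (λ w → 𝟙 (E? (suc u) w))
        ≡⟨ ∑-cong n (λ w w<n → pointwise w (≤-pred w<n)) ⟩
      ∑ n (λ w → 𝟙 (w ≟ u) + (𝟙 (w ≟ suc (suc u)) + (𝟙 (chord? w (suc u)) + 𝟙 (chord? (suc u) w))))
        ≡⟨ trans (∑-+ n (λ w → 𝟙 (w ≟ u)) _) (cong₂ _+_ (∑-𝟙-≡ n (<⇒≤ (<-trans 1+u<N (n<1+n N))))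
            (trans (∑-+ n (λ w → 𝟙 (w ≟ suc (suc u))) _) (cong₂ _+_ (∑-𝟙-≡ n (s≤s 1+u<N))
              (∑-+ n (λ w → 𝟙 (chord? w (suc u))) _)))) ⟩
      suc (suc (left (suc u) + right (suc u))) ∎
      where
      open ≡-Reasoning
      l? r? : ∀ w → Dec _
      l? w = chord? w (suc u)
      r? w = chord? (suc u) w
      u≤N : u ≤ N
      u≤N = <⇒≤ (<-trans (n<1+n u) 1+u<N)
      cases : ∀ {w} → w ≤ N → E (suc u) w →
              w ≡ u ⊎ w ≡ suc (suc u) ⊎ (suc w < suc u × E w (suc u)) ⊎ (suc (suc u) < w × E (suc u) w)
      cases {w} w≤N e with <-cmp w (suc u)
      ... | tri≈ _ refl _ = contradiction e (E-irrefl w≤N)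
      ... | tri< w<1+u _ _ with m≤n⇒m<n∨m≡n (≤-pred w<1+u)
      ...   | inj₁ w<u  = inj₂ (inj₂ (inj₁ (s<s w<u , E-sym e)))
      ...   | inj₂ w≡u  = inj₁ w≡u
      cases {w} w≤N e | tri> _ _ 1+u<w with m≤n⇒m<n∨m≡n 1+u<w
      ...   | inj₁ 2+u<w = inj₂ (inj₂ (inj₂ (2+u<w , e)))
      ...   | inj₂ 2+u≡w = inj₂ (inj₁ (sym 2+u≡w))
      pointwise : ∀ w → w ≤ N →
        𝟙 (E? (suc u) w) ≡ 𝟙 (w ≟ u) + (𝟙 (w ≟ suc (suc u)) + (𝟙 (l? w) + 𝟙 (r? w)))
      pointwise w w≤N = trans
        (𝟙-⊎ (cases w≤N) (λ { refl → E-sym (sides (<-trans (n<1+n u) 1+u<N)) })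
          (λ { (inj₁ refl) → sides 1+u<N ; (inj₂ (inj₁ (_ , e))) → E-sym e ; (inj₂ (inj₂ (_ , e))) → e })
          (λ { refl (inj₁ p) → <-irrefl p (<-trans (n<1+n u) (n<1+n (suc u)))
             ; refl (inj₂ (inj₁ (1+u<1+u , _))) → <-irrefl refl 1+u<1+u
             ; refl (inj₂ (inj₂ (2+u<u , _))) → <-asym 2+u<u (<-trans (n<1+n u) (n<1+n (suc u))) })
          (E? (suc u) w) (w ≟ u) ((w ≟ suc (suc u)) ⊎-dec (l? w ⊎-dec r? w)))
        (cong (𝟙 (w ≟ u) +_) (trans
          (𝟙-⊎ id inj₁ inj₂
            (λ { refl (inj₁ (3+u<1+u , _)) →
                 <-asym 3+u<1+u (<-trans (n<1+n (suc u)) (n<1+n (suc (suc u))))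
               ; refl (inj₂ (2+u<2+u , _)) → <-irrefl refl 2+u<2+u })
            ((w ≟ suc (suc u)) ⊎-dec (l? w ⊎-dec r? w)) (w ≟ suc (suc u)) (l? w ⊎-dec r? w))
          (cong (𝟙 (w ≟ suc (suc u)) +_)
            (𝟙-⊎ id inj₁ inj₂
              (λ { (1+w<1+u , _) (2+u<w , _) →
                <-asym (<-trans (n<1+n w) 1+w<1+u) (<-trans (n<1+n (suc u)) 2+u<w) })
              (l? w ⊎-dec r? w) (l? w) (r? w)))))

-- Identities between numbers of chords.

module Counting where

  open import Data.Nat.Base using (ℕ; suc; _+_; _∸_; _≤_; _<_; z≤n; s≤s)
  open import Data.Nat.Properties
  open import Data.Nat.Tactic.RingSolver using (solve-∀)
  open import Data.Product.Base using (_,_; proj₂)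
  open import Function.Base using (_∘_)
  open import Relation.Binary.PropositionalEquality
    using (_≡_; sym; trans; cong; cong₂; module ≡-Reasoning)
  open import Relation.Nullary using (Dec; ¬_)
  open Sums
  open Windows using (module Counts)

  module ChordCounts (N : ℕ) {E : ℕ → ℕ → Set} (E? : ∀ i j → Dec (E i j)) where

    open Counts N E?

    -- With k at position 0 and ℓ = k + m these are ν^tri_{k,ℓ-1}, ν^tri_{k+1,ℓ}
    -- and ν^rec_{k+1,ℓ-1,k+n-1}.
    triangle₀ triangle₁ over : ℕ → ℕ
    triangle₀ m = ∑ m λ a → ∑ m λ b → chord a b
    triangle₁ m = ∑ m λ a → ∑ m λ b → chord (suc a) (suc b)
    over      m = ∑ (m ∸ 1) λ a → ∑ (N ∸ m) λ b → chord (suc a) (suc m + b)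

    left⁺ : ℕ → ℕ
    left⁺ u = ∑ N λ a → chord (suc a) u

    left-left⁺ : ∀ u → left u ≡ chord 0 u + left⁺ u
    left-left⁺ u = ∑-head N (λ a → chord a u)

    left-adjacent : ∀ u → 1 < u → E 0 u → left u ≡ suc (left⁺ u)
    left-adjacent u 1<u e = trans (left-left⁺ u) (cong (_+ left⁺ u) (𝟙-yes (chord? 0 u) (1<u , e)))

    left-nonadjacent : ∀ u → ¬ E 0 u → left⁺ u ≡ left u
    left-nonadjacent u ¬e = sym (trans (left-left⁺ u)
      (cong (_+ left⁺ u) (𝟙-no (chord? 0 u) (¬e ∘ proj₂))))

    triangle₀-left : ∀ m → m ≤ suc N → triangle₀ m ≡ ∑ m left
    triangle₀-left m m≤n = trans (∑-swap m m chord) (∑-cong m (λ u u<m →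
      sym (∑-truncate (λ a → chord a u) m≤n
        (λ a m≤a _ → chord-≤ (≤-trans (<⇒≤ (<-≤-trans u<m m≤a)) (n≤1+n a))))))

    triangle₁-left⁺ : ∀ m → m ≤ N → triangle₁ m ≡ ∑ m (left⁺ ∘ suc)
    triangle₁-left⁺ m m≤N = trans (∑-swap m m (λ a b → chord (suc a) (suc b)))
      (∑-cong m (λ u u<m → sym (∑-truncate (λ a → chord (suc a) (suc u)) m≤N
        (λ a m≤a _ → chord-≤ (≤-trans u<m (≤-trans m≤a (≤-trans (n≤1+n a) (n≤1+n (suc a)))))))))

    -- Chords starting at one of 1, ..., m are sorted by whether they end beyond m + 1 or not.
    over-triangle₁ : ∀ m → suc m ≤ N → over (suc m) + triangle₁ (suc m) ≡ ∑ m (right ∘ suc)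
    over-triangle₁ m 1+m≤N = sym (begin
      ∑ m (right ∘ suc)
        ≡⟨ ∑-cong m (λ u _ → split u) ⟩
      ∑ m (λ u → outside u + ∑ (suc m) (λ b → chord (suc u) (suc b)))
        ≡⟨ ∑-+ m outside _ ⟩
      over (suc m) + ∑ m (λ u → ∑ (suc m) (λ b → chord (suc u) (suc b)))
        ≡⟨ cong (over (suc m) +_) (∑-truncate (λ u → ∑ (suc m) (λ b → chord (suc u) (suc b)))
             (n≤1+n m) (λ u m≤u _ → ∑-zero (suc m) (λ b b≤m →
               chord-≤ (≤-trans b≤m (s≤s (≤-trans m≤u (n≤1+n u))))))) ⟨
      over (suc m) + triangle₁ (suc m) ∎)
      where
      open ≡-Reasoning
      outside : ℕ → ℕ
      outside u = ∑ (N ∸ suc m) λ b → chord (suc u) (suc (suc m) + b)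
      split : ∀ u → right (suc u) ≡ outside u + ∑ (suc m) (λ b → chord (suc u) (suc b))
      split u = begin
        ∑ (suc N) (chord (suc u))
          ≡⟨ cong (λ a → ∑ (suc a) (chord (suc u))) (m+[n∸m]≡n 1+m≤N) ⟨
        ∑ (suc (suc m) + (N ∸ suc m)) (chord (suc u))
          ≡⟨ ∑-split (suc (suc m)) (N ∸ suc m) (chord (suc u)) ⟩
        ∑ (suc (suc m)) (chord (suc u)) + outside u
          ≡⟨ cong (_+ outside u) (∑-head (suc m) (chord (suc u))) ⟩
        chord (suc u) 0 + ∑ (suc m) (λ b → chord (suc u) (suc b)) + outside u
          ≡⟨ cong (λ a → a + ∑ (suc m) (λ b → chord (suc u) (suc b)) + outside u) (chord-≤ {suc u} z≤n) ⟩
        ∑ (suc m) (λ b → chord (suc u) (suc b)) + outside u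
          ≡⟨ +-comm _ (outside u) ⟩
        outside u + ∑ (suc m) (λ b → chord (suc u) (suc b)) ∎

    -- Chords passing over u or starting at u either pass over u + 1 or end there. This is the
    -- recursion `ρ-rec` that the degree argument needs; it is obtained as the difference of two
    -- consecutive instances of `over-triangle₁`.
    over-suc : ∀ u → 0 < u → u < N → over (suc u) + left⁺ (suc u) ≡ over u + right u
    over-suc u@(suc w) _ u<N = +-cancelʳ-≡ (∑ u (left⁺ ∘ suc)) _ _ (begin
      over (suc u) + left⁺ (suc u) + V
        ≡⟨ regroup (over (suc u)) (left⁺ (suc u)) V ⟩
      over (suc u) + ∑ (suc u) (left⁺ ∘ suc)
        ≡⟨ cong (over (suc u) +_) (triangle₁-left⁺ (suc u) u<N) ⟨
      over (suc u) + triangle₁ (suc u)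
        ≡⟨ over-triangle₁ u u<N ⟩
      ∑ w (right ∘ suc) + right u
        ≡⟨ cong (_+ right u) (over-triangle₁ w (<⇒≤ u<N)) ⟨
      over u + triangle₁ u + right u
        ≡⟨ cong (λ a → over u + a + right u) (triangle₁-left⁺ u (<⇒≤ u<N)) ⟩
      over u + V + right u
        ≡⟨ swap (over u) V (right u) ⟩
      over u + right u + V ∎)
      where
      open ≡-Reasoning
      V = ∑ u (left⁺ ∘ suc)
      regroup : ∀ a l v → a + l + v ≡ a + (v + l)
      regroup = solve-∀
      swap : ∀ a v r → a + v + r ≡ a + r + v
      swap = solve-∀

    -- The exponents balance since c u - 1 = left u + right u.
    degree-balance : ∀ m → suc m ≤ N →
      ∑ m (λ u → left (suc u) + right (suc u)) ≡ (triangle₀ (suc m) + over (suc m)) + triangle₁ (suc m)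
    degree-balance m 1+m≤N = begin
      ∑ m (λ u → left (suc u) + right (suc u))
        ≡⟨ ∑-+ m (left ∘ suc) (right ∘ suc) ⟩
      ∑ m (left ∘ suc) + ∑ m (right ∘ suc)
        ≡⟨ cong₂ _+_ (sym (cong (_+ ∑ m (left ∘ suc)) (left-≤1 z≤n)))
                   (sym (over-triangle₁ m 1+m≤N)) ⟩
      left 0 + ∑ m (left ∘ suc) + (over (suc m) + triangle₁ (suc m))
        ≡⟨ cong (_+ (over (suc m) + triangle₁ (suc m))) (∑-head m left) ⟨
      ∑ (suc m) left + (over (suc m) + triangle₁ (suc m))
        ≡⟨ cong (_+ (over (suc m) + triangle₁ (suc m))) 
             (triangle₀-left (suc m) (≤-trans 1+m≤N (n≤1+n N))) ⟨
      triangle₀ (suc m) + (over (suc m) + triangle₁ (suc m))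
        ≡⟨ +-assoc (triangle₀ (suc m)) _ _ ⟨
      triangle₀ (suc m) + over (suc m) + triangle₁ (suc m) ∎
      where open ≡-Reasoning

-- From the list of diagonals to edge relations; the quiddity as a vertex degree.

module Polygon where

  open import Defs
  open import Data.Fin.Base using (Fin; toℕ; zero; suc)
  import Data.Fin.Properties as Fin
  open import Data.Integer.Base as ℤ using (ℤ; +_)
  import Data.Integer.Properties as ℤ
  open import Data.Integer.DivMod using (_%ℕ_; _/ℕ_; n%ℕd<d; a≡a%ℕn+[a/ℕn]*n)
  open import Data.Integer.Tactic.RingSolver using () renaming (solve-∀ to ℤ-solve-∀)
  open import Data.List.Base
    using (List; []; _∷_; length; filter; allFin; tabulate; applyUpTo; cartesianProduct)
  open import Data.List.Membership.Propositional using (_∈_)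
  import Data.List.Membership.DecPropositional as DecMembership
  open import Data.List.Relation.Unary.All as All using (All; []; _∷_)
  open import Data.List.Relation.Unary.AllPairs using (AllPairs; []; _∷_)
  open import Data.List.Relation.Unary.Any using (here; there)
  open import Data.List.Relation.Unary.Unique.Propositional using (Unique)
  open import Data.Nat.Base using (ℕ; zero; suc; NonZero; _+_; _*_; _∸_; _≤_; _<_; z≤n; s≤s; z<s)
  open import Data.Nat.DivMod using (_%_; _/_; m%n<n; m<n⇒m%n≡m; [m+n]%n≡m%n)
  open import Data.Nat.Properties
  open import Data.Product.Base using (_×_; _,_; proj₁; proj₂)
  open import Data.Product.Properties using (≡-dec)
  open import Data.Sum.Base using (_⊎_; inj₁; inj₂; swap)
  open import Function.Base using (_∘_; id; _on_)
  open import Relation.Binary.PropositionalEquality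
    using (_≡_; refl; sym; trans; cong; cong₂; subst; subst₂; module ≡-Reasoning)
  open import Relation.Nullary using (Dec; yes; no; does; ¬_; contradiction)
  open import Relation.Nullary.Decidable using (_×-dec_; _⊎-dec_)
  open import Relation.Unary using (Pred; Decidable)
  open import Data.Bool.Base using (true; false)
  open Sums
  open Windows using (Window; Window-resp; module Counts; module Rotation)
  open Fullness using (∑∑-𝟙-≡; module FullIntervals)
  open Cells using (module CellCount)

  AllPairs-∈ : ∀ {a r} {A : Set a} {R : A → A → Set r} {xs} → AllPairs R xs →
               ∀ {x y} → x ∈ xs → y ∈ xs → x ≡ y ⊎ R x y ⊎ R y x
  AllPairs-∈ (rs ∷ _)  (here refl) (here refl) = inj₁ refl
  AllPairs-∈ (rs ∷ _)  (here refl) (there q)   = inj₂ (inj₁ (All.lookup rs q))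
  AllPairs-∈ (rs ∷ _)  (there p)   (here refl) = inj₂ (inj₂ (All.lookup rs p))
  AllPairs-∈ (_  ∷ ps) (there p)   (there q)   = AllPairs-∈ ps p q

  length-filter-filter : ∀ {a p q} {A : Set a} {P : Pred A p} {Q : Pred A q}
    (P? : Decidable P) (Q? : Decidable Q) xs →
    length (filter P? (filter Q? xs)) ≡ length (filter (λ x → P? x ×-dec Q? x) xs)
  length-filter-filter P? Q? [] = refl
  length-filter-filter P? Q? (x ∷ xs) with Q? x
  ... | no _ with does (P? x)
  ...   | true  = length-filter-filter P? Q? xs
  ...   | false = length-filter-filter P? Q? xs
  length-filter-filter P? Q? (x ∷ xs) | yes _ with does (P? x)
  ...   | true  = cong suc (length-filter-filter P? Q? xs)
  ...   | false = length-filter-filter P? Q? xs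

  tabulate-applyUpTo : ∀ {a} {A : Set a} {n} {f : Fin n → A} {g : ℕ → A} →
                       (∀ i → f i ≡ g (toℕ i)) → tabulate f ≡ applyUpTo g n
  tabulate-applyUpTo {n = zero}  p = refl
  tabulate-applyUpTo {n = suc n} p = cong₂ _∷_ (p zero) (tabulate-applyUpTo (p ∘ suc))

  module Vertices (N : ℕ) where

    v : ℕ → Fin (suc N)
    v i = vertex (suc N) (+ i)

    toℕ-vertex : ∀ u → toℕ (vertex (suc N) u) ≡ u %ℕ suc N
    toℕ-vertex u = Fin.toℕ-fromℕ< (n%ℕd<d u (suc N))

    toℕ-v : ∀ {i} → i ≤ N → toℕ (v i) ≡ i
    toℕ-v {i} i≤N = trans (toℕ-vertex (+ i)) (m<n⇒m%n≡m (s≤s i≤N))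

    v-toℕ : ∀ x → x ≡ v (toℕ x)
    v-toℕ x = Fin.toℕ-injective (sym (toℕ-v (≤-pred (Fin.toℕ<n x))))

    v-injective : ∀ {i j} → i ≤ N → j ≤ N → v i ≡ v j → i ≡ j
    v-injective i≤N j≤N p = trans (sym (toℕ-v i≤N)) (trans (cong toℕ p) (toℕ-v j≤N))

    v-periodic : ∀ i → v (suc N + i) ≡ v i
    v-periodic i = Fin.toℕ-injective (trans (toℕ-vertex (+ (suc N + i)))
      (trans (cong (λ a → + a %ℕ suc N) (+-comm (suc N) i))
             (trans ([m+n]%n≡m%n i (suc N)) (sym (toℕ-vertex (+ i))))))

    allFin≡ : allFin (suc N) ≡ applyUpTo v (suc N)
    allFin≡ = tabulate-applyUpTo {f = id} {g = v} v-toℕ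

  %ℕ-unique : ∀ {n} .{{_ : NonZero n}} x {b} m → x ≡ + b ℤ.+ m ℤ.* + n → b < n → x %ℕ n ≡ b
  %ℕ-unique {n} x {b} m x≡ b<n = same (m ℤ.- x /ℕ n) (n%ℕd<d x n) b<n (begin
    + (x %ℕ n)
      ≡⟨ move (+ (x %ℕ n)) (x /ℕ n ℤ.* + n) ⟩
    (+ (x %ℕ n) ℤ.+ x /ℕ n ℤ.* + n) ℤ.- x /ℕ n ℤ.* + n
      ≡⟨ cong (ℤ._- x /ℕ n ℤ.* + n) (trans (sym (a≡a%ℕn+[a/ℕn]*n x n)) x≡) ⟩
    (+ b ℤ.+ m ℤ.* + n) ℤ.- x /ℕ n ℤ.* + n
      ≡⟨ collect (+ b) m (x /ℕ n) (+ n) ⟩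
    + b ℤ.+ (m ℤ.- x /ℕ n) ℤ.* + n ∎)
    where
    open ≡-Reasoning
    move : ∀ a c → a ≡ (a ℤ.+ c) ℤ.- c
    move = ℤ-solve-∀
    collect : ∀ b m q n → (b ℤ.+ m ℤ.* n) ℤ.- q ℤ.* n ≡ b ℤ.+ (m ℤ.- q) ℤ.* n
    collect = ℤ-solve-∀
    too-large : ∀ {a b} m → + a ≡ + b ℤ.+ + suc m ℤ.* + n → ¬ (a < n)
    too-large {a} {b} m p a<n = <⇒≱ a<n (≤-trans (m≤m+n n (m * n)) (≤-trans (m≤n+m _ b)
      (≤-reflexive (sym (ℤ.+-injective (trans p (cong (ℤ._+_ (+ b)) (sym (ℤ.pos-* (suc m) n)))))))))
    same : ∀ {a b} m → a < n → b < n → + a ≡ + b ℤ.+ m ℤ.* + n → a ≡ b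
    same (+ zero)  a<n b<n p = ℤ.+-injective (trans p (ℤ.+-identityʳ _))
    same (+ suc m) a<n b<n p = contradiction a<n (too-large m p)
    same {a} {b} ℤ.-[1+ m ] a<n b<n p = contradiction b<n (too-large {b} {a} m (begin
      + b                                                       ≡⟨ flip (+ b) (+ suc m) (+ n) ⟩
      (+ b ℤ.+ (ℤ.- + suc m) ℤ.* + n) ℤ.+ + suc m ℤ.* + n       ≡⟨ cong (ℤ._+ + suc m ℤ.* + n) p ⟨
      + a ℤ.+ + suc m ℤ.* + n                                   ∎))
      where
      flip : ∀ b m n → b ≡ (b ℤ.+ (ℤ.- m) ℤ.* n) ℤ.+ m ℤ.* n
      flip = ℤ-solve-∀

  ∑-rotate-by : ∀ n r (F : ℕ → ℕ) → (∀ i → F (n + i) ≡ F i) → ∑ n (λ w → F (r + w)) ≡ ∑ n F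
  ∑-rotate-by n zero    F _        = refl
  ∑-rotate-by n (suc r) F periodic = trans
    (∑-rotate-by n r (F ∘ suc) (λ i → trans (cong F (sym (+-suc n i))) (periodic (suc i))))
    (∑-rotate n F (trans (cong F (sym (+-identityʳ n))) (periodic 0)))

  module Triangulated {N : ℕ} (2≤N : 2 ≤ N) (T : Triangulation (suc N)) where

    open Triangulation T
    open Vertices N

    private
      n = suc N
      0<N : 0 < N
      0<N = ≤-trans (s≤s z≤n) 2≤N

    -- Segments are stored with increasing ends, but counting from another base point may list the
    -- ends in either order; hence the symmetric closure.
    Adj : Fin n → Fin n → Set
    Adj x y = IsEdge T (x , y) ⊎ IsEdge T (y , x)

    Adj? : ∀ x y → Dec (Adj x y)
    Adj? x y = isEdge? T (x , y) ⊎-dec isEdge? T (y , x)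

    Adj-sym : ∀ {x y} → Adj x y → Adj y x
    Adj-sym = swap

    side-< : ∀ {x y} → IsSide {n} (x , y) → toℕ x < toℕ y
    side-< {x} {y} (inj₁ p) = ≤-reflexive (sym p)
    side-< {x} {y} (inj₂ (p , q)) =
      subst₂ _<_ (sym p) (sym (suc-injective q)) 0<N

    edge-< : ∀ {x y} → IsEdge T (x , y) → toℕ x < toℕ y
    edge-< (inj₁ s) = side-< s
    edge-< (inj₂ d) = proj₁ (All.lookup isDiagonal d)

    Adj-irrefl : ∀ {x} → ¬ Adj x x
    Adj-irrefl (inj₁ e) = <-irrefl refl (edge-< e)
    Adj-irrefl (inj₂ e) = <-irrefl refl (edge-< e)

    E : ℕ → ℕ → Set
    E = Adj on v

    E? : ∀ i j → Dec (E i j)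
    E? i j = Adj? (v i) (v j)

    E-edge : ∀ {i j} → i < j → j ≤ N → E i j → IsEdge T (v i , v j)
    E-edge i<j j≤N (inj₁ e) = e
    E-edge i<j j≤N (inj₂ e) = contradiction
      (subst₂ _<_ (toℕ-v j≤N) (toℕ-v (≤-trans (<⇒≤ i<j) j≤N)) (edge-< e)) (<-asym i<j)

    E-sides : ∀ {i} → i < N → E i (suc i)
    E-sides i<N = inj₁ (inj₁ (inj₁ (trans (toℕ-v i<N) (cong suc (sym (toℕ-v (<⇒≤ i<N)))))))

    E-base : E 0 N
    E-base = inj₁ (inj₁ (inj₂ (toℕ-v z≤n , cong suc (toℕ-v ≤-refl))))

    side-v : ∀ {i j} → i ≤ N → j ≤ N → IsSide {n} (v i , v j) → j ≡ suc i ⊎ (i ≡ 0 × j ≡ N)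
    side-v i≤N j≤N (inj₁ p) = inj₁ (trans (sym (toℕ-v j≤N)) (trans p (cong suc (toℕ-v i≤N))))
    side-v i≤N j≤N (inj₂ (p , q)) =
      inj₂ (trans (sym (toℕ-v i≤N)) p , trans (sym (toℕ-v j≤N)) (suc-injective q))

    E-noncrossing : ∀ {i k j l} → i < k → k < j → j < l → l ≤ N → E i j → ¬ E k l
    E-noncrossing {i} {k} {j} {l} i<k k<j j<l l≤N e f
      with E-edge (<-trans i<k k<j) j≤N e | E-edge (<-trans k<j j<l) l≤N f
      where j≤N = ≤-trans (<⇒≤ j<l) l≤N
    ... | inj₁ s | _ with side-v (≤-trans (<⇒≤ (<-trans i<k (<-trans k<j j<l))) l≤N)
                              (≤-trans (<⇒≤ j<l) l≤N) s
    ...   | inj₁ refl = <⇒≱ i<k (≤-pred k<j)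
    ...   | inj₂ (_ , refl) = <⇒≱ j<l l≤N
    E-noncrossing {i} {k} {j} {l} i<k k<j j<l l≤N e f | inj₂ _ | inj₁ s
      with side-v (≤-trans (<⇒≤ (<-trans k<j j<l)) l≤N) l≤N s
    ...   | inj₁ refl = <⇒≱ k<j (≤-pred j<l)
    ...   | inj₂ (refl , _) = n≮0 i<k
    E-noncrossing {i} {k} {j} {l} i<k k<j j<l l≤N e f | inj₂ d | inj₂ d′ =
      refute (AllPairs-∈ nonCrossing d d′)
      where
      j≤N = ≤-trans (<⇒≤ j<l) l≤N
      k≤N = ≤-trans (<⇒≤ k<j) j≤N
      i≤N = ≤-trans (<⇒≤ i<k) k≤N
      v-< : ∀ {a b} → a < b → b ≤ N → toℕ (v a) < toℕ (v b)
      v-< a<b b≤N = subst₂ _<_ (sym (toℕ-v (≤-trans (<⇒≤ a<b) b≤N))) (sym (toℕ-v b≤N)) a<b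
      crossing = v-< i<k k≤N , v-< k<j j≤N , v-< j<l l≤N
      refute : ¬ ((v i , v j) ≡ (v k , v l) ⊎
                  ¬ Crossing (v i , v j) (v k , v l) ⊎ ¬ Crossing (v k , v l) (v i , v j))
      refute (inj₁ p) = <-irrefl (v-injective i≤N k≤N (cong proj₁ p)) i<k
      refute (inj₂ (inj₁ ¬c)) = ¬c (inj₁ crossing)
      refute (inj₂ (inj₂ ¬c)) = ¬c (inj₂ crossing)

    open FullIntervals E? E-sides E-noncrossing using (inside?; count; full-Window)
    open DecMembership (≡-dec (Fin._≟_ {n}) (Fin._≟_ {n})) using (_∈?_)

    -- Distinctness enters here: the sum sees each segment once, however often it is listed.
    length-≤-∑ : ∀ {D : List (Segment n)} → Unique D →
                 length D ≤ ∑ n (λ a → ∑ n (λ b → 𝟙 ((v a , v b) ∈? D)))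
    length-≤-∑ [] = z≤n
    length-≤-∑ {x ∷ D} (x∉ ∷ u) = begin
      suc (length D)
        ≤⟨ +-mono-≤ (≤-reflexive (sym (∑∑-𝟙-≡ (Fin.toℕ<n (proj₁ x)) (Fin.toℕ<n (proj₂ x)))))
                    (length-≤-∑ u) ⟩
      ∑ n (λ a → ∑ n (I a)) + ∑ n (λ a → ∑ n (M a))
        ≡⟨ ∑-+ n (λ a → ∑ n (I a)) _ ⟨
      ∑ n (λ a → ∑ n (I a) + ∑ n (M a))
        ≡⟨ ∑-cong n (λ a _ → ∑-+ n (I a) (M a)) ⟨
      ∑ n (λ a → ∑ n (λ b → I a b + M a b))
        ≤⟨ ∑-mono n (λ a _ → ∑-mono n (λ b _ →
             𝟙-⊎-≥ (here ∘ is-x) there (λ p q → All.lookup x∉ q (sym (is-x p)))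
               ((v a , v b) ∈? (x ∷ D)) ((a ≟ toℕ (proj₁ x)) ×-dec (b ≟ toℕ (proj₂ x)))
               ((v a , v b) ∈? D))) ⟩
      ∑ n (λ a → ∑ n (λ b → 𝟙 ((v a , v b) ∈? (x ∷ D)))) ∎
      where
      open ≤-Reasoning
      I M : ℕ → ℕ → ℕ
      I a b = 𝟙 ((a ≟ toℕ (proj₁ x)) ×-dec (b ≟ toℕ (proj₂ x)))
      M a b = 𝟙 ((v a , v b) ∈? D)
      is-x : ∀ {a b} → a ≡ toℕ (proj₁ x) × b ≡ toℕ (proj₂ x) → (v a , v b) ≡ x
      is-x (refl , refl) = cong₂ _,_ (sym (v-toℕ (proj₁ x))) (sym (v-toℕ (proj₂ x)))

    -- The n - 3 = N - 2 diagonals and the side 0 N, itself counted as a chord, make N - 1 chords,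
    -- the largest possible number.
    full : N ≤ suc (count 0 N)
    full = begin
      N                                  ≡⟨ m+[n∸m]≡n 2≤N ⟨
      2 + (N ∸ 2)                        ≡⟨ cong suc (+-comm 1 (N ∸ 2)) ⟩
      suc ((N ∸ 2) + 1)                  ≡⟨ cong (λ a → suc (a + 1)) number ⟨
      suc (length diagonals + 1)
        ≤⟨ s≤s (+-mono-≤ (length-≤-∑ distinct) (≤-reflexive (sym (∑∑-𝟙-≡ {n} {n} z<s ≤-refl)))) ⟩
      suc (∑ n (λ a → ∑ n (M a)) + ∑ n (λ a → ∑ n (I a)))
        ≡⟨ cong suc (∑-+ n (λ a → ∑ n (M a)) _) ⟨
      suc (∑ n (λ a → ∑ n (M a) + ∑ n (I a)))
        ≡⟨ cong suc (∑-cong n (λ a _ → ∑-+ n (M a) (I a))) ⟨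
      suc (∑ n (λ a → ∑ n (λ b → M a b + I a b)))
        ≤⟨ s≤s (∑-mono n (λ a a<n → ∑-mono n (λ b b<n →
             𝟙-⊎-≥ (chord (≤-pred a<n) (≤-pred b<n))
               (λ { (refl , refl) → (z≤n , ≤-refl) , 2≤N , E-base })
               (λ { d (refl , refl) → proj₂ (All.lookup isDiagonal d)
                      (inj₂ (toℕ-v z≤n , cong suc (toℕ-v ≤-refl))) })
               (inside? 0 N a b) ((v a , v b) ∈? diagonals) ((a ≟ 0) ×-dec (b ≟ N))))) ⟩
      suc (count 0 N) ∎
      where
      open ≤-Reasoning
      I M : ℕ → ℕ → ℕ
      I a b = 𝟙 ((a ≟ 0) ×-dec (b ≟ N))
      M a b = 𝟙 ((v a , v b) ∈? diagonals)
      chord : ∀ {a b} → a ≤ N → b ≤ N → (v a , v b) ∈ diagonals → (0 ≤ a × b ≤ N) × suc a < b × E a b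
      chord {a} {b} a≤N b≤N d with All.lookup isDiagonal d
      ... | a<b , ¬side = (z≤n , b≤N)
        , ≤∧≢⇒< (subst₂ _<_ (toℕ-v a≤N) (toℕ-v b≤N) a<b)
                (λ 1+a≡b → ¬side (inj₁ (trans (toℕ-v b≤N)
                  (trans (sym 1+a≡b) (cong suc (sym (toℕ-v a≤N)))))))
        , inj₁ (inj₂ d)

    window : Window N E
    window = full-Window 0<N full

    cellsAt : Fin n → ℕ
    cellsAt x = length (filter (hasVertex? x) (cells T))

    open CellCount E? window 0<N (λ {i} {j} → Adj-sym {v i} {v j}) (λ _ → Adj-irrefl)
      using (vertexCell?; suc-cells≡degree)

    cellsAt-∑ : ∀ {u} (u≤N : u ≤ N) →
      cellsAt (v u) ≡ ∑ n (λ i → ∑ n (λ j → ∑ n (λ k → 𝟙 (vertexCell? u≤N i j k))))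
    cellsAt-∑ {u} u≤N = begin
      cellsAt (v u)
        ≡⟨ length-filter-filter (hasVertex? (v u)) (isCell? T)
             (cartesianProduct (allFin n) (cartesianProduct (allFin n) (allFin n))) ⟩
      length (filter P? (cartesianProduct (allFin n) (cartesianProduct (allFin n) (allFin n))))
        ≡⟨ cong (λ xs → length (filter P? (cartesianProduct xs (cartesianProduct xs xs)))) allFin≡ ⟩
      length (filter P? (cartesianProduct V (cartesianProduct V V)))
        ≡⟨ length-filter-cartesianProduct P? v n (cartesianProduct V V) ⟩
      ∑ n (λ i → length (filter (λ y → P? (v i , y)) (cartesianProduct V V)))
        ≡⟨ ∑-cong n (λ i _ → length-filter-cartesianProduct (λ y → P? (v i , y)) v n V) ⟩
      ∑ n (λ i → ∑ n (λ j → length (filter (λ z → P? (v i , v j , z)) V)))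
        ≡⟨ ∑-cong n (λ i _ → ∑-cong n (λ j _ → length-filter-applyUpTo (λ z → P? (v i , v j , z)) v n)) ⟩
      ∑ n (λ i → ∑ n (λ j → ∑ n (λ k → 𝟙 (P? (v i , v j , v k)))))
        ≡⟨ ∑-cong n (λ i i<n → ∑-cong n (λ j j<n → ∑-cong n (λ k k<n →
             𝟙-cong (to (≤-pred i<n) (≤-pred j<n) (≤-pred k<n))
                    (from (≤-pred i<n) (≤-pred j<n) (≤-pred k<n))
                    (P? (v i , v j , v k)) (vertexCell? u≤N i j k)))) ⟩
      ∑ n (λ i → ∑ n (λ j → ∑ n (λ k → 𝟙 (vertexCell? u≤N i j k)))) ∎
      where
      open ≡-Reasoning
      V = applyUpTo v n
      P? : ∀ t → Dec (HasVertex (v u) t × IsCell T t)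
      P? t = hasVertex? (v u) t ×-dec isCell? T t
      module _ {i j k : ℕ} (i≤N : i ≤ N) (j≤N : j ≤ N) (k≤N : k ≤ N) where
        to : HasVertex (v u) (v i , v j , v k) × IsCell T (v i , v j , v k) →
             (u ≡ i ⊎ u ≡ j ⊎ u ≡ k) × (i < j × j < k) × E i j × E j k × E i k
        to (h , (i<j , j<k) , e , f , g) = at-vertex h ,
          (subst₂ _<_ (toℕ-v i≤N) (toℕ-v j≤N) i<j , subst₂ _<_ (toℕ-v j≤N) (toℕ-v k≤N) j<k) ,
          inj₁ e , inj₁ f , inj₁ g
          where
          at-vertex : HasVertex (v u) (v i , v j , v k) → u ≡ i ⊎ u ≡ j ⊎ u ≡ k
          at-vertex (inj₁ p)        = inj₁ (v-injective u≤N i≤N p)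
          at-vertex (inj₂ (inj₁ p)) = inj₂ (inj₁ (v-injective u≤N j≤N p))
          at-vertex (inj₂ (inj₂ p)) = inj₂ (inj₂ (v-injective u≤N k≤N p))
        from : (u ≡ i ⊎ u ≡ j ⊎ u ≡ k) × (i < j × j < k) × E i j × E j k × E i k →
               HasVertex (v u) (v i , v j , v k) × IsCell T (v i , v j , v k)
        from (h , (i<j , j<k) , e , f , g) = at-vertex h ,
          (subst₂ _<_ (sym (toℕ-v i≤N)) (sym (toℕ-v j≤N)) i<j ,
           subst₂ _<_ (sym (toℕ-v j≤N)) (sym (toℕ-v k≤N)) j<k) ,
          E-edge i<j j≤N e , E-edge j<k k≤N f , E-edge (<-trans i<j j<k) k≤N g
          where
          at-vertex : u ≡ i ⊎ u ≡ j ⊎ u ≡ k → HasVertex (v u) (v i , v j , v k)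
          at-vertex (inj₁ p)        = inj₁ (cong v p)
          at-vertex (inj₂ (inj₁ p)) = inj₂ (inj₁ (cong v p))
          at-vertex (inj₂ (inj₂ p)) = inj₂ (inj₂ (cong v p))

    suc-cellsAt : ∀ x → suc (cellsAt x) ≡ ∑ n (λ w → 𝟙 (Adj? x (v w)))
    suc-cellsAt x = subst (λ y → suc (cellsAt y) ≡ ∑ n (λ w → 𝟙 (Adj? y (v w)))) (sym (v-toℕ x))
      (trans (cong suc (cellsAt-∑ x≤N)) (suc-cells≡degree x≤N))
      where
      x≤N : toℕ x ≤ N
      x≤N = ≤-pred (Fin.toℕ<n x)

    module _ (k : ℤ) where

      private
        r = k %ℕ n

      vertexFrom : ℕ → Fin n
      vertexFrom i = vertex n (k ℤ.+ + i)

      -- Replaces the integer k by its remainder r, so that `rotate-by` reaches every base point.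
      vertexFrom-v : ∀ i → vertexFrom i ≡ v (r + i)
      vertexFrom-v i = Fin.toℕ-injective (trans (toℕ-vertex (k ℤ.+ + i))
        (trans (%ℕ-unique (k ℤ.+ + i) (k /ℕ n ℤ.+ + ((r + i) / n)) k+i≡ (m%n<n (r + i) n))
               (sym (toℕ-vertex (+ (r + i))))))
        where
        open ≡-Reasoning
        regroup : ∀ b q′ q n → (b ℤ.+ q′ ℤ.* n) ℤ.+ q ℤ.* n ≡ b ℤ.+ (q ℤ.+ q′) ℤ.* n
        regroup = ℤ-solve-∀
        commute : ∀ r q i → (r ℤ.+ q) ℤ.+ i ≡ (r ℤ.+ i) ℤ.+ q
        commute = ℤ-solve-∀
        k+i≡ : k ℤ.+ + i ≡ + ((r + i) % n) ℤ.+ (k /ℕ n ℤ.+ + ((r + i) / n)) ℤ.* + n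
        k+i≡ = begin
          k ℤ.+ + i
            ≡⟨ cong (ℤ._+ + i) (a≡a%ℕn+[a/ℕn]*n k n) ⟩
          (+ r ℤ.+ k /ℕ n ℤ.* + n) ℤ.+ + i
            ≡⟨ commute (+ r) (k /ℕ n ℤ.* + n) (+ i) ⟩
          + (r + i) ℤ.+ k /ℕ n ℤ.* + n
            ≡⟨ cong (ℤ._+ k /ℕ n ℤ.* + n) (a≡a%ℕn+[a/ℕn]*n (+ (r + i)) n) ⟩
          (+ ((r + i) % n) ℤ.+ + ((r + i) / n) ℤ.* + n) ℤ.+ k /ℕ n ℤ.* + n
            ≡⟨ regroup (+ ((r + i) % n)) (+ ((r + i) / n)) (k /ℕ n) (+ n) ⟩
          + ((r + i) % n) ℤ.+ (k /ℕ n ℤ.+ + ((r + i) / n)) ℤ.* + n ∎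

      EdgeFrom : ℕ → ℕ → Set
      EdgeFrom = Adj on vertexFrom

      EdgeFrom? : ∀ i j → Dec (EdgeFrom i j)
      EdgeFrom? i j = Adj? (vertexFrom i) (vertexFrom j)

      windowFrom : Window N EdgeFrom
      windowFrom = Window-resp
        (λ {i} {j} → subst₂ Adj (sym (vertexFrom-v i)) (sym (vertexFrom-v j)))
        (λ {i} {j} → subst₂ Adj (vertexFrom-v i) (vertexFrom-v j))
        (Rotation.rotate-by Adj-sym Adj? 0<N r v v-periodic window)

      open Counts N EdgeFrom? using (left; right)

      -- One more than the number of cells at a vertex is its degree, which does not depend on where
      -- the numbering starts. The sum over neighbours may thus be shifted by r and then split, as
      -- seen from k, into two sides of the polygon and the chords to the left and to the right.
      quiddity-left-right : ∀ u → 0 < u → u < N → quiddity T (k ℤ.+ + u) ≡ suc (left u + right u)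
      quiddity-left-right u@(suc _) _ u<N = suc-injective (begin
        suc (quiddity T (k ℤ.+ + u))
          ≡⟨ suc-cellsAt (vertexFrom u) ⟩
        ∑ n (λ w → 𝟙 (Adj? (vertexFrom u) (v w)))
          ≡⟨ ∑-rotate-by n r (λ w → 𝟙 (Adj? (vertexFrom u) (v w)))
               (λ i → cong (λ x → 𝟙 (Adj? (vertexFrom u) x)) (v-periodic i)) ⟨
        ∑ n (λ w → 𝟙 (Adj? (vertexFrom u) (v (r + w))))
          ≡⟨ ∑-cong n (λ w _ → cong (λ x → 𝟙 (Adj? (vertexFrom u) x)) (vertexFrom-v w)) ⟨
        ∑ n (λ w → 𝟙 (EdgeFrom? u w))
          ≡⟨ CellCount.degree-split EdgeFrom? windowFrom 0<N
               (λ {i} {j} → Adj-sym {vertexFrom i} {vertexFrom j}) (λ _ → Adj-irrefl) u<N ⟩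
        suc (suc (left u + right u)) ∎)
        where open ≡-Reasoning

-- The two friezes of a triangulation, the numbers of ones, and the degrees.

module DegreesOfFrieze where

  open import Defs
  open import Data.Integer.Base as ℤ using (ℤ; +_; 0ℤ; 1ℤ; ∣_∣)
  import Data.Integer.Properties as ℤ
  open import Data.Integer.Tactic.RingSolver using () renaming (solve-∀ to ℤ-solve-∀)
  open import Data.List.Base using (map; filter; length; applyUpTo; cartesianProduct)
  open import Data.List.Properties using (map-upTo; map-applyUpTo)
  open import Data.Nat.Base using (ℕ; zero; suc; _+_; _∸_; _≤_; _<_; z≤n; s≤s; z<s; s<s)
  open import Data.Nat.Properties
  open import Data.Product.Base using (_×_; _,_; proj₁; proj₂; ∃-syntax)
  open import Data.Sum.Base using (_⊎_; [_,_]′)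
  open import Function.Base using (_∘_)
  open import Relation.Binary.PropositionalEquality
    using (_≡_; refl; sym; trans; cong; cong₂; subst; subst₂; module ≡-Reasoning)
  open import Relation.Nullary using (Dec; ¬_; contradiction)
  open import Relation.Nullary.Decidable using (_×-dec_)
  open Sums
  open Polynomials
  open Friezes
  open Degrees
  open Windows using (Window; module Counts; module Cuts)
  open Polygon using (module Triangulated)
  open Counting using (module ChordCounts)

  interval-applyUpTo : ∀ k ℓ m → ℓ ℤ.+ 1ℤ ℤ.- k ≡ + m → interval k ℓ ≡ applyUpTo (λ i → k ℤ.+ + i) m
  interval-applyUpTo k ℓ m p = trans (map-upTo (λ i → k ℤ.+ + i) _) (cong (applyUpTo (λ i → k ℤ.+ + i))
    (trans (cong (λ x → ∣ x ℤ.⊔ 0ℤ ∣) p) (⊔-identityʳ m)))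

  sumℤ-applyUpTo : ∀ (f : ℕ → ℤ) (F : ℕ → ℕ) m → (∀ i → f i ≡ + F i) → sumℤ (applyUpTo f m) ≡ + ∑ m F
  sumℤ-applyUpTo f F zero    p = refl
  sumℤ-applyUpTo f F (suc m) p = trans
    (cong₂ ℤ._+_ (p 0) (sumℤ-applyUpTo (f ∘ suc) (F ∘ suc) m (p ∘ suc)))
    (cong +_ (sym (∑-head m F)))

  module Theorem {N : ℕ} (2≤N : 2 ≤ N) (T : Triangulation (suc N))
    (ζ : ℤ → ℤ → Poly) (qfrieze : IsQFrieze (suc N) (quiddity T) ζ)
    (σ : ℤ → ℤ → ℤ) (frieze : IsFrieze (suc N) (quiddity T) σ) where

    open Triangulated 2≤N T

    private
      n = suc N
      0<N : 0 < N
      0<N = ≤-trans (s≤s z≤n) 2≤N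

    c : ℤ → ℕ → ℕ
    c k j = quiddity T (k ℤ.+ + j)

    c-shift : ∀ k j → c (k ℤ.+ + 1) j ≡ c k (suc j)
    c-shift k j = cong (quiddity T) (ℤ.+-assoc k (+ 1) (+ j))

    -- Taking u - 1 as base point puts u at position 1, where `quiddity-left-right` applies. The
    -- bound makes the truncated c - 1 exact and the absolute value in the exponent harmless.
    quiddity≥1 : ∀ u → 1 ≤ quiddity T u
    quiddity≥1 u = subst (λ x → 1 ≤ quiddity T x) (predecessor u)
      (subst (1 ≤_) (sym (quiddity-left-right (u ℤ.- + 1) 1 z<s 2≤N)) (s≤s z≤n))
      where
      predecessor : ∀ u → (u ℤ.- + 1) ℤ.+ + 1 ≡ u
      predecessor = ℤ-solve-∀

    Σ[c-1]-∑ : ∀ k ℓ m → ℓ ℤ.+ 1ℤ ℤ.- (k ℤ.+ + 1) ≡ + m →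
               Σ[c-1] (quiddity T) (k ℤ.+ + 1) ℓ ≡ + ∑ m (λ u → c k (suc u) ∸ 1)
    Σ[c-1]-∑ k ℓ m p = trans (cong (λ xs → sumℤ (map (λ u → + quiddity T u ℤ.- 1ℤ) xs))
        (interval-applyUpTo (k ℤ.+ + 1) ℓ m p))
      (trans (cong sumℤ (map-applyUpTo (λ i → (k ℤ.+ + 1) ℤ.+ + i) (λ u → + quiddity T u ℤ.- 1ℤ) m))
        (sumℤ-applyUpTo _ (λ u → c k (suc u) ∸ 1) m (λ u → trans
          (cong (λ a → + a ℤ.- 1ℤ) (c-shift k u)) (pred-ℤ (quiddity≥1 (k ℤ.+ + suc u))))))
      where
      pred-ℤ : ∀ {a} → 1 ≤ a → + a ℤ.- 1ℤ ≡ + (a ∸ 1)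
      pred-ℤ {suc a} _ = refl

    module View (k : ℤ) where

      open Windows.Window (windowFrom k) public using (noncrossing)
      open Counts N (EdgeFrom? k) public
      open ChordCounts N (EdgeFrom? k) public

      abstract
        cut : Cut (EdgeFrom k) left right 0 N (left N) (right 0)
        cut = Cuts.cut (EdgeFrom? k) (windowFrom k) 0<N

      not-adjacent : ∀ {m u j} → 0 < m → m < u → u < j → j ≤ N → EdgeFrom k m j → ¬ EdgeFrom k 0 u
      not-adjacent 0<m m<u u<j j≤N e f = noncrossing 0<m m<u u<j j≤N f e

      gq : ℕ → Poly
      gq = ℤ[q].val cut 0 0ₚ 1ₚ

      g : ℕ → ℤ
      g = Int.val cut 0 0ℤ 1ℤ

      continuant-gq : ∀ u → u ≤ N → ℤ[q].continuant (c k) u ≋ (q^ ∑ u left) ⊗ gq u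
      continuant-gq = ℤ[q].continuant-val cut (left-≤1 z≤n) (left-≤1 ≤-refl) (c k) (quiddity-left-right k)

      continuant-g : ∀ u → u ≤ N → Int.continuant (c k) u ≡ g u
      continuant-g u u≤N = trans
        (Int.continuant-val cut (left-≤1 z≤n) (left-≤1 ≤-refl) (c k) (quiddity-left-right k) u u≤N)
        (ℤ.*-identityˡ (g u))

      gq-constant : ∀ {u} → 0 < u → coeff (gq u) 0 ≡ 1ℤ
      gq-constant = val-constant cut 0 0ₚ 1ₚ refl

      gq-Monic : ∀ {u} → 0 < u → u ≤ N → Monic (gq u) (over u)
      gq-Monic = val-Monic₀ N over left⁺ over-suc not-adjacent
        (λ u 1<u _ → left-adjacent u 1<u) left-nonadjacent refl
        cut 0 1ₚ ≤-refl refl (refl , λ { (suc i) _ → refl })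

      g-adjacency : ∀ {u} → 0 < u → u ≤ N →
                    (EdgeFrom k 0 u × g u ≡ 1ℤ) ⊎ (¬ EdgeFrom k 0 u × + 2 ℤ.≤ g u)
      g-adjacency = val-adjacency not-adjacent cut 0 ≤-refl

      gq-cancel : ∀ i → 0 < i → i ≤ N → ∀ x y →
                  ℤ[q].continuant (c k) i ⊗ x ≋ ℤ[q].continuant (c k) i ⊗ y → x ≋ y
      gq-cancel i 0<i i≤N x y p = q^⊗-cancelˡ (∑ i left) (gq i) x y (gq-constant 0<i)
        (≋-trans (⊗-cong (≋-sym (continuant-gq i i≤N)) ≋-refl)
          (≋-trans p (⊗-cong (continuant-gq i i≤N) ≋-refl)))

      g-cancel : ∀ i → 0 < i → i ≤ N → ∀ x y →
                 Int.continuant (c k) i ℤ.* x ≡ Int.continuant (c k) i ℤ.* y → x ≡ y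
      g-cancel i 0<i i≤N x y p = cancel (g i) 1≤g
        (trans (cong (ℤ._* x) (sym (continuant-g i i≤N))) (trans p (cong (ℤ._* y) (continuant-g i i≤N))))
        where
        1≤g : 1ℤ ℤ.≤ g i
        1≤g = [ (λ (_ , g≡1) → ℤ.≤-reflexive (sym g≡1))
              , (λ (_ , 2≤g) → ℤ.≤-trans (ℤ.+≤+ (s≤s z≤n)) 2≤g) ]′ (g-adjacency 0<i i≤N)
        cancel : ∀ a → 1ℤ ℤ.≤ a → a ℤ.* x ≡ a ℤ.* y → x ≡ y
        cancel (+ suc a) _ = ℤ.*-cancelˡ-≡ (+ suc a) x y
        cancel (+ zero) (ℤ.+≤+ ())

    private
      index₁ : ∀ k i → k ℤ.+ (+ 3 ℤ.+ i) ℤ.- + 1 ≡ k ℤ.+ (+ 2 ℤ.+ i)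
      index₁ = ℤ-solve-∀
      index₂ : ∀ k i → k ℤ.+ (+ 3 ℤ.+ i) ≡ (k ℤ.+ + 1) ℤ.+ (+ 2 ℤ.+ i)
      index₂ = ℤ-solve-∀
      index₃ : ∀ k i → k ℤ.+ (+ 3 ℤ.+ i) ℤ.- + 1 ≡ (k ℤ.+ + 1) ℤ.+ (+ 1 ℤ.+ i)
      index₃ = ℤ-solve-∀
      index₄ : ∀ k i → k ℤ.+ (+ 3 ℤ.+ i) ℤ.- + 2 ℤ.+ 1ℤ ℤ.- (k ℤ.+ + 1) ≡ + 1 ℤ.+ i
      index₄ = ℤ-solve-∀

      lower : ∀ k i → k ℤ.+ + 3 ℤ.≤ k ℤ.+ + (3 + i)
      lower k i = ℤ.+-monoʳ-≤ k (ℤ.+≤+ (m≤m+n 3 i))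

      upper : ∀ k i → 3 + i ≤ N → k ℤ.+ + (3 + i) ℤ.≤ k ℤ.+ + (n + 1)
      upper k i 3+i≤N = ℤ.+-monoʳ-≤ k (ℤ.+≤+ (≤-trans 3+i≤N (≤-trans (n≤1+n N) (m≤m+n n 1))))

    ζ-continuant : ∀ i → i ≤ N → ∀ k → ζ k (k ℤ.+ + i) ≋ ℤ[q].continuant (c k) i
    ζ-continuant = ℤ[q].frieze-continuant N c c-shift (λ k i → ζ k (k ℤ.+ + i))
      (λ k → subst (λ x → ζ k x ≋ 0ₚ) (sym (ℤ.+-identityʳ k)) (coeffs (diag₀ k)))
      (λ k → coeffs (diag₁ k)) (λ k → coeffs (diag₂ k)) rule′ View.gq-cancel
      where
      open IsQFrieze qfrieze
      rule′ : ∀ k i → suc (suc (suc i)) ≤ N →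
        ζ k (k ℤ.+ + (2 + i)) ⊗ ζ (k ℤ.+ + 1) ((k ℤ.+ + 1) ℤ.+ + (2 + i))
          ⊖ ζ (k ℤ.+ + 1) ((k ℤ.+ + 1) ℤ.+ + (1 + i)) ⊗ ζ k (k ℤ.+ + (3 + i))
        ≋ q^ ∑ (suc i) (λ u → c k (suc u) ∸ 1)
      rule′ k i 3+i≤N = subst₂ _≋_
        (cong₂ _⊖_ (cong₂ _⊗_ (cong (ζ k) (index₁ k (+ i))) (cong (ζ (k ℤ.+ + 1)) (index₂ k (+ i))))
                   (cong (λ x → ζ (k ℤ.+ + 1) x ⊗ ζ k (k ℤ.+ + (3 + i))) (index₃ k (+ i))))
        (cong (λ e → q^ ∣ e ∣) (Σ[c-1]-∑ k (k ℤ.+ + (3 + i) ℤ.- + 2) (suc i) (index₄ k (+ i))))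
        (coeffs (rule k (k ℤ.+ + (3 + i)) (lower k i) (upper k i 3+i≤N)))

    σ-continuant : ∀ i → i ≤ N → ∀ k → σ k (k ℤ.+ + i) ≡ Int.continuant (c k) i
    σ-continuant = Int.frieze-continuant N c c-shift (λ k i → σ k (k ℤ.+ + i))
      (λ k → trans (cong (σ k) (ℤ.+-identityʳ k)) (diag₀ k)) diag₁ diag₂ rule′ View.g-cancel
      where
      open IsFrieze frieze
      rule′ : ∀ k i → suc (suc (suc i)) ≤ N →
        σ k (k ℤ.+ + (2 + i)) ℤ.* σ (k ℤ.+ + 1) ((k ℤ.+ + 1) ℤ.+ + (2 + i))
          ℤ.- σ (k ℤ.+ + 1) ((k ℤ.+ + 1) ℤ.+ + (1 + i)) ℤ.* σ k (k ℤ.+ + (3 + i))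
        ≡ 1ℤ
      rule′ k i 3+i≤N = trans (sym
        (cong₂ ℤ._-_ (cong₂ ℤ._*_ (cong (σ k) (index₁ k (+ i))) (cong (σ (k ℤ.+ + 1)) (index₂ k (+ i))))
                     (cong (λ x → σ (k ℤ.+ + 1) x ℤ.* σ k (k ℤ.+ + (3 + i))) (index₃ k (+ i)))))
        (rule k (k ℤ.+ + (3 + i)) (lower k i) (upper k i 3+i≤N))

    σ-g : ∀ k d → d ≤ N → σ k (k ℤ.+ + d) ≡ View.g k d
    σ-g k d d≤N = trans (σ-continuant d d≤N k) (View.continuant-g k d d≤N)

    σ≡1⇒edge : ∀ k d → 0 < d → d ≤ N → σ k (k ℤ.+ + d) ≡ 1ℤ → EdgeFrom k 0 d
    σ≡1⇒edge k d 0<d d≤N σ≡1 = [ proj₁ , (λ (_ , 2≤g) → contradiction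
      (subst (+ 2 ℤ.≤_) (trans (sym (σ-g k d d≤N)) σ≡1) 2≤g) λ { (ℤ.+≤+ (s≤s ())) }) ]′
      (View.g-adjacency k 0<d d≤N)

    edge⇒σ≡1 : ∀ k d → 0 < d → d ≤ N → EdgeFrom k 0 d → σ k (k ℤ.+ + d) ≡ 1ℤ
    edge⇒σ≡1 k d 0<d d≤N e = [ (λ (_ , g≡1) → trans (σ-g k d d≤N) g≡1)
      , (λ (¬e , _) → contradiction e ¬e) ]′ (View.g-adjacency k 0<d d≤N)

    module _ (k : ℤ) where

      open View k

      edge-shift : ∀ a d → EdgeFrom (k ℤ.+ + a) 0 d ≡ EdgeFrom k a (a + d)
      edge-shift a d = cong₂ (λ x y → Adj (vertex n x) (vertex n y))
        (ℤ.+-identityʳ (k ℤ.+ + a)) (ℤ.+-assoc k (+ a) (+ d))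

      -- The adjacency criterion is applied with k + a as base point, from which b lies at distance
      -- b - a; whether two vertices are joined does not depend on the base point.
      σ-chord : ∀ {a b} → suc a < b → b ≤ N → (σ (k ℤ.+ + a) (k ℤ.+ + b) ≡ 1ℤ → EdgeFrom k a b) ×
                                              (EdgeFrom k a b → σ (k ℤ.+ + a) (k ℤ.+ + b) ≡ 1ℤ)
      σ-chord {a} {b} 1+a<b b≤N with m≤n⇒∃[o]m+o≡n (<⇒≤ 1+a<b)
      ... | o , refl =
          (λ p → subst (EdgeFrom k a) (+-suc a o) (subst (λ S → S) (edge-shift a (suc o))
            (σ≡1⇒edge (k ℤ.+ + a) (suc o) z<s d≤N (trans (cong (σ (k ℤ.+ + a)) index) p))))
        , (λ e → trans (cong (σ (k ℤ.+ + a)) (sym index)) (edge⇒σ≡1 (k ℤ.+ + a) (suc o) z<s d≤N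
            (subst (λ S → S) (sym (edge-shift a (suc o))) (subst (EdgeFrom k a) (sym (+-suc a o)) e))))
        where
        d≤N : suc o ≤ N
        d≤N = ≤-trans (s≤s (m≤n+m o a)) b≤N
        index : (k ℤ.+ + a) ℤ.+ + suc o ≡ k ℤ.+ + (suc a + o)
        index = trans (ℤ.+-assoc k (+ a) (+ suc o)) (cong (λ x → k ℤ.+ + x) (+-suc a o))

      -- The offset o of the left end is 0 or 1 in the applications. The bound `o + m ≤ n` keeps all
      -- pairs within one turn of the polygon, where the entries equal to 1 are exactly the chords.
      νtri-chord : ∀ o ℓ m → ℓ ℤ.+ 1ℤ ℤ.- (k ℤ.+ + o) ≡ + m → o + m ≤ n →
        νtri σ (k ℤ.+ + o) ℓ ≡ ∑ m (λ a → ∑ m (λ b → chord (o + a) (o + b)))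
      νtri-chord o ℓ m p o+m≤n = begin
        νtri σ (k ℤ.+ + o) ℓ
          ≡⟨ cong (λ xs → length (filter P? (cartesianProduct xs xs)))
               (interval-applyUpTo (k ℤ.+ + o) ℓ m p) ⟩
        length (filter P? (cartesianProduct xs xs))
          ≡⟨ length-filter-cartesianProduct P? f m xs ⟩
        ∑ m (λ a → length (filter (λ y → P? (f a , y)) xs))
          ≡⟨ ∑-cong m (λ a _ → length-filter-applyUpTo (λ y → P? (f a , y)) f m) ⟩
        ∑ m (λ a → ∑ m (λ b → 𝟙 (P? (f a , f b))))
          ≡⟨ ∑-cong m (λ a _ → ∑-cong m (λ b b<m →
               𝟙-cong (to b<m) (from b<m) (P? (f a , f b)) (chord? (o + a) (o + b)))) ⟩
        ∑ m (λ a → ∑ m (λ b → chord (o + a) (o + b))) ∎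
        where
        open ≡-Reasoning
        f : ℕ → ℤ
        f i = (k ℤ.+ + o) ℤ.+ + i
        xs = applyUpTo f m
        P? : ∀ (ab : ℤ × ℤ) → Dec (proj₁ ab ℤ.+ + 2 ℤ.≤ proj₂ ab × σ (proj₁ ab) (proj₂ ab) ≡ 1ℤ)
        P? (a , b) = (a ℤ.+ + 2 ℤ.≤? b) ×-dec (σ a b ℤ.≟ 1ℤ)
        f≡ : ∀ a → f a ≡ k ℤ.+ + (o + a)
        f≡ a = ℤ.+-assoc k (+ o) (+ a)
        gap≡ : ∀ a → f a ℤ.+ + 2 ≡ k ℤ.+ + (2 + (o + a))
        gap≡ a = trans (cong (ℤ._+ + 2) (f≡ a)) (trans (ℤ.+-assoc k (+ (o + a)) (+ 2))
          (cong (λ x → k ℤ.+ + x) (+-comm (o + a) 2)))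
        bound : ∀ {b} → b < m → o + b ≤ N
        bound b<m = ≤-pred (≤-trans (+-monoʳ-< o b<m) o+m≤n)
        to : ∀ {a b} → b < m → f a ℤ.+ + 2 ℤ.≤ f b × σ (f a) (f b) ≡ 1ℤ →
             suc (o + a) < o + b × EdgeFrom k (o + a) (o + b)
        to {a} {b} b<m (le , s) = gap
          , proj₁ (σ-chord gap (bound b<m)) (trans (sym (cong₂ σ (f≡ a) (f≡ b))) s)
          where
          gap : suc (o + a) < o + b
          gap = ℤ.drop‿+≤+ (ℤ-cancelˡ k (subst₂ ℤ._≤_ (gap≡ a) (f≡ b) le))
            where
            ℤ-cancelˡ : ∀ k {x y} → k ℤ.+ x ℤ.≤ k ℤ.+ y → x ℤ.≤ y
            ℤ-cancelˡ k {x} {y} q = subst₂ ℤ._≤_ (drop k x) (drop k y) (ℤ.+-monoʳ-≤ (ℤ.- k) q)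
              where
              drop : ∀ k x → ℤ.- k ℤ.+ (k ℤ.+ x) ≡ x
              drop = ℤ-solve-∀
        from : ∀ {a b} → b < m → suc (o + a) < o + b × EdgeFrom k (o + a) (o + b) →
               f a ℤ.+ + 2 ℤ.≤ f b × σ (f a) (f b) ≡ 1ℤ
        from {a} {b} b<m (gap , e) =
            subst₂ ℤ._≤_ (sym (gap≡ a)) (sym (f≡ b)) (ℤ.+-monoʳ-≤ k (ℤ.+≤+ gap))
          , trans (cong₂ σ (f≡ a) (f≡ b)) (proj₂ (σ-chord gap (bound b<m)) e)

      -- The index ranges are separated by `o + p < o′`, so every pair is at distance at least 2 and
      -- the distance condition built into `chord` holds automatically.
      νrec-chord : ∀ o u p o′ ℓ s → u ℤ.+ 1ℤ ℤ.- (k ℤ.+ + o) ≡ + p → u ℤ.+ + 2 ≡ k ℤ.+ + o′ →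
        ℓ ℤ.+ 1ℤ ℤ.- (k ℤ.+ + o′) ≡ + s → o + p < o′ → o′ + s ≤ n →
        νrec σ (k ℤ.+ + o) u ℓ ≡ ∑ p (λ a → ∑ s (λ b → chord (o + a) (o′ + b)))
      νrec-chord o u p o′ ℓ s eq₁ eq₂ eq₃ o+p<o′ o′+s≤n = begin
        νrec σ (k ℤ.+ + o) u ℓ
          ≡⟨ cong₂ (λ xs ys → length (filter P? (cartesianProduct xs ys)))
               (interval-applyUpTo (k ℤ.+ + o) u p eq₁)
               (trans (cong (λ x → interval x ℓ) eq₂) (interval-applyUpTo (k ℤ.+ + o′) ℓ s eq₃)) ⟩
        length (filter P? (cartesianProduct (applyUpTo f p) (applyUpTo h s)))
          ≡⟨ length-filter-cartesianProduct P? f p (applyUpTo h s) ⟩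
        ∑ p (λ a → length (filter (λ y → P? (f a , y)) (applyUpTo h s)))
          ≡⟨ ∑-cong p (λ a _ → length-filter-applyUpTo (λ y → P? (f a , y)) h s) ⟩
        ∑ p (λ a → ∑ s (λ b → 𝟙 (P? (f a , h b))))
          ≡⟨ ∑-cong p (λ a a<p → ∑-cong s (λ b b<s → equal a<p b<s)) ⟩
        ∑ p (λ a → ∑ s (λ b → chord (o + a) (o′ + b))) ∎
        where
        open ≡-Reasoning
        f h : ℕ → ℤ
        f i = (k ℤ.+ + o) ℤ.+ + i
        h i = (k ℤ.+ + o′) ℤ.+ + i
        P? : ∀ (ab : ℤ × ℤ) → Dec (σ (proj₁ ab) (proj₂ ab) ≡ 1ℤ)
        P? (a , b) = σ a b ℤ.≟ 1ℤ
        equal : ∀ {a b} → a < p → b < s → 𝟙 (P? (f a , h b)) ≡ chord (o + a) (o′ + b)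
        equal {a} {b} a<p b<s = 𝟙-cong
          (λ q → gap , proj₁ (σ-chord gap bound) (trans (sym σ≡) q))
          (λ { (_ , e) → trans σ≡ (proj₂ (σ-chord gap bound) e) })
          (P? (f a , h b)) (chord? (o + a) (o′ + b))
          where
          gap : suc (o + a) < o′ + b
          gap = ≤-<-trans (+-monoʳ-< o a<p) (<-≤-trans o+p<o′ (m≤m+n o′ b))
          bound : o′ + b ≤ N
          bound = ≤-pred (≤-trans (+-monoʳ-< o′ b<s) o′+s≤n)
          σ≡ : σ (f a) (h b) ≡ σ (k ℤ.+ + (o + a)) (k ℤ.+ + (o′ + b))
          σ≡ = cong₂ σ (ℤ.+-assoc k (+ o) (+ a)) (ℤ.+-assoc k (+ o′) (+ b))

      private
        size₀ : ∀ k m → (k ℤ.+ (+ 1 ℤ.+ m) ℤ.- + 1) ℤ.+ 1ℤ ℤ.- (k ℤ.+ + 0) ≡ + 1 ℤ.+ m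
        size₀ = ℤ-solve-∀
        size₁ : ∀ k m → (k ℤ.+ (+ 1 ℤ.+ m)) ℤ.+ 1ℤ ℤ.- (k ℤ.+ + 1) ≡ + 1 ℤ.+ m
        size₁ = ℤ-solve-∀
        size₂ : ∀ k m → (k ℤ.+ (+ 1 ℤ.+ m) ℤ.- + 1) ℤ.+ 1ℤ ℤ.- (k ℤ.+ + 1) ≡ m
        size₂ = ℤ-solve-∀
        start : ∀ k m → (k ℤ.+ (+ 1 ℤ.+ m) ℤ.- + 1) ℤ.+ + 2 ≡ k ℤ.+ (+ 2 ℤ.+ m)
        start = ℤ-solve-∀
        size₃ : ∀ k N m → (k ℤ.+ (+ 1 ℤ.+ N) ℤ.- + 1) ℤ.+ 1ℤ ℤ.- (k ℤ.+ (+ 2 ℤ.+ m))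
                          ≡ N ℤ.- (+ 1 ℤ.+ m)
        size₃ = ℤ-solve-∀

      module _ (m : ℕ) (1+m≤N : suc m ≤ N) where

        private
          ℓ = k ℤ.+ + suc m

        νtri₀ : νtri σ k (ℓ ℤ.- + 1) ≡ triangle₀ (suc m)
        νtri₀ = trans (cong (λ x → νtri σ x (ℓ ℤ.- + 1)) (sym (ℤ.+-identityʳ k)))
          (νtri-chord 0 (ℓ ℤ.- + 1) (suc m) (size₀ k (+ m)) (≤-trans 1+m≤N (n≤1+n N)))

        νtri₁ : νtri σ (k ℤ.+ + 1) ℓ ≡ triangle₁ (suc m)
        νtri₁ = νtri-chord 1 ℓ (suc m) (size₁ k (+ m)) (s≤s 1+m≤N)

        νrec₁ : νrec σ (k ℤ.+ + 1) (ℓ ℤ.- + 1) (k ℤ.+ + n ℤ.- + 1) ≡ over (suc m)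
        νrec₁ = νrec-chord 1 (ℓ ℤ.- + 1) m (2 + m) (k ℤ.+ + n ℤ.- + 1) (N ∸ suc m)
          (size₂ k (+ m)) (start k (+ m))
          (trans (size₃ k (+ N) (+ m)) (trans (ℤ.m-n≡m⊖n N (suc m)) (ℤ.⊖-≥ 1+m≤N)))
          ≤-refl (s≤s (≤-reflexive (m+[n∸m]≡n 1+m≤N)))

        exponent : ℕ
        exponent = triangle₀ (suc m)

        ζ-factor : ζ k ℓ ≋ (q^ exponent) ⊗ gq (suc m)
        ζ-factor = ≋-trans (ζ-continuant (suc m) 1+m≤N k) (subst
          (λ e → ℤ[q].continuant (c k) (suc m) ≋ (q^ e) ⊗ gq (suc m))
          (sym (triangle₀-left (suc m) (≤-trans 1+m≤N (n≤1+n N)))) (continuant-gq (suc m) 1+m≤N))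

        ζ-trailing : HasTrailingDegree (ζ k ℓ) exponent
        ζ-trailing =
            (λ p → 1≢0 (trans (sym leading) p))
          , (λ i i<e → trans (at ζ-factor i) (coeff-q^⊗-< exponent (gq (suc m)) i i<e))
          where
          leading : coeff (ζ k ℓ) exponent ≡ 1ℤ
          leading = trans (at ζ-factor exponent) (trans
            (cong (coeff ((q^ exponent) ⊗ gq (suc m))) (sym (+-identityʳ exponent)))
            (trans (coeff-q^⊗ exponent (gq (suc m)) 0) (gq-constant z<s)))

        ζ-degree : HasDegree (ζ k ℓ) (exponent + over (suc m))
        ζ-degree = Monic⇒HasDegree (ζ k ℓ)
          (Monic-resp (≋-sym ζ-factor) (Monic-q^⊗ exponent (gq (suc m)) (gq-Monic z<s 1+m≤N)))

        degree-Σ : + (exponent + over (suc m)) ≡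
                   Σ[c-1] (quiddity T) (k ℤ.+ + 1) (ℓ ℤ.- + 1) ℤ.- + triangle₁ (suc m)
        degree-Σ = begin
          + d
            ≡⟨ cancel (+ d) (+ V) ⟩
          (+ d ℤ.+ + V) ℤ.- + V
            ≡⟨ cong (λ a → + a ℤ.- + V) (degree-balance m 1+m≤N) ⟨
          + ∑ m (λ u → left (suc u) + right (suc u)) ℤ.- + V
            ≡⟨ cong (λ a → + a ℤ.- + V) (∑-cong m (λ u u<m →
                 cong (_∸ 1) (quiddity-left-right k (suc u) z<s (<-≤-trans (s<s u<m) 1+m≤N)))) ⟨
          + ∑ m (λ u → c k (suc u) ∸ 1) ℤ.- + V
            ≡⟨ cong (ℤ._- + V) (Σ[c-1]-∑ k (ℓ ℤ.- + 1) m (size₂ k (+ m))) ⟨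
          Σ[c-1] (quiddity T) (k ℤ.+ + 1) (ℓ ℤ.- + 1) ℤ.- + V ∎
          where
          open ≡-Reasoning
          d = exponent + over (suc m)
          V = triangle₁ (suc m)
          cancel : ∀ d v → d ≡ (d ℤ.+ v) ℤ.- v
          cancel = ℤ-solve-∀

        degrees : HasTrailingDegree (ζ k ℓ) (νtri σ k (ℓ ℤ.- + 1)) ×
          (∃[ d ] HasDegree (ζ k ℓ) d ×
            (+ d ≡ Σ[c-1] (quiddity T) (k ℤ.+ + 1) (ℓ ℤ.- + 1) ℤ.- + νtri σ (k ℤ.+ + 1) ℓ) ×
            (d ≡ νtri σ k (ℓ ℤ.- + 1) + νrec σ (k ℤ.+ + 1) (ℓ ℤ.- + 1) (k ℤ.+ + n ℤ.- + 1)))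
        degrees = subst (HasTrailingDegree (ζ k ℓ)) (sym νtri₀) ζ-trailing
          , exponent + over (suc m) , ζ-degree
          , subst (λ V → + (exponent + over (suc m))
                         ≡ Σ[c-1] (quiddity T) (k ℤ.+ + 1) (ℓ ℤ.- + 1) ℤ.- + V)
                  (sym νtri₁) degree-Σ
          , sym (cong₂ _+_ νtri₀ νrec₁)

    range : ∀ k ℓ → k ℤ.+ + 1 ℤ.≤ ℓ → ℓ ℤ.≤ k ℤ.+ + n ℤ.- + 1 →
            ∃[ m ] suc m ≤ N × ℓ ≡ k ℤ.+ + suc m
    range k ℓ k<ℓ ℓ≤ = from-difference (ℓ ℤ.- k) (split ℓ k)
      (subst (ℤ._≤ ℓ ℤ.- k) (below k) (ℤ.+-monoˡ-≤ (ℤ.- k) k<ℓ))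
      (subst (ℓ ℤ.- k ℤ.≤_) (above k (+ N)) (ℤ.+-monoˡ-≤ (ℤ.- k) ℓ≤))
      where
      split : ∀ ℓ k → ℓ ≡ k ℤ.+ (ℓ ℤ.- k)
      split = ℤ-solve-∀
      below : ∀ k → (k ℤ.+ + 1) ℤ.- k ≡ + 1
      below = ℤ-solve-∀
      above : ∀ k N → (k ℤ.+ (+ 1 ℤ.+ N) ℤ.- + 1) ℤ.- k ≡ N
      above = ℤ-solve-∀
      from-difference : ∀ d → ℓ ≡ k ℤ.+ d → + 1 ℤ.≤ d → d ℤ.≤ + N →
                        ∃[ m ] suc m ≤ N × ℓ ≡ k ℤ.+ + suc m
      from-difference (+ zero) _ (ℤ.+≤+ ())
      from-difference (+ suc m) p _ (ℤ.+≤+ q) = m , q , p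

open import Defs
open import Data.Integer.Base using (ℤ; +_; _+_; _-_; _≤_)
open import Data.Nat.Base as ℕ using (ℕ; NonZero)
open import Data.Product.Base using (_×_; _,_; ∃-syntax)
open import Relation.Binary.PropositionalEquality using (_≡_; refl)
open DegreesOfFrieze using (module Theorem)

proposition4p1 : ∀ (n : ℕ) .{{_ : NonZero n}} → 3 ℕ.≤ n →
    (T : Triangulation n) →
    (ζ : ℤ → ℤ → Poly) → IsQFrieze n (quiddity T) ζ →
    (σ : ℤ → ℤ → ℤ) → IsFrieze n (quiddity T) σ →
    ∀ (k ℓ : ℤ) → k + + 1 ≤ ℓ → ℓ ≤ k + + n - + 1 →
    HasTrailingDegree (ζ k ℓ) (νtri σ k (ℓ - + 1)) ×
    (∃[ d ] HasDegree (ζ k ℓ) d ×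
    (+ d ≡ Σ[c-1] (quiddity T) (k + + 1) (ℓ - + 1) - + νtri σ (k + + 1) ℓ) ×
    (d ≡ νtri σ k (ℓ - + 1) ℕ.+ νrec σ (k + + 1) (ℓ - + 1) (k + + n - + 1)))
proposition4p1 (ℕ.suc N) (ℕ.s≤s 2≤N) T ζ qfrieze σ frieze k ℓ k<ℓ ℓ≤
  with Theorem.range 2≤N T ζ qfrieze σ frieze k ℓ k<ℓ ℓ≤
... | m , 1+m≤N , refl = Theorem.degrees 2≤N T ζ qfrieze σ frieze k m 1+m≤N
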